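{- Let $G$ be an ordered group and let $S$ be a finite subset of $G$. If $|S|\ge 4$ and $|S^2|=3|S|-2$, then $\langle S\rangle$ is either abelian or young.
   Context: An ordered group is a group $G$ with a total order $\le$ such that $a\le b$ implies $xay\le xby$ for all $a,b,x,y\in G$. For a subset $S$, $S^2=\{x_1x_2 : x_1,x_2\in S\}$, and $\langle S\rangle$ is the subgroup generated by $S$. Notation: $[a,b]=a^{ -1}b^{ -1}ab$ and $a^b=b^{ -1}ab$. An ordered group $H$ is called young if one of the following holds: (i) $H=\langle a,b\rangle$ with $[[a,b],a]=[[a,b],b]=1$; (ii) $H=\langle a\rangle\times\langle b,c\rangle$ with either $c^b=c^2$ or $(c^2)^b=c$, and $c\ne 1$; (iii) $H=\langle a,b\rangle$ with $a^b=a^2$ and $a\ne 1$; (iv) $H=\langle a,b\rangle$ with $a^{b^2}=aa^b$, $[a,a^b]=1$ and $a\ne 1$. -}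

module Defs where

open import Level using (Level; _⊔_; suc)
open import Data.Nat using (ℕ; _≥_; _*_; _∸_)
open import Data.List using (List; length)
open import Data.Product using (Σ; ∃; _×_; _,_)
open import Data.Sum using (_⊎_)
open import Relation.Nullary using (¬_)
open import Relation.Binary using (Rel; IsTotalOrder)
open import Algebra.Bundles using (Group)
import Data.List.Membership.Setoid as SetoidMembership
import Data.List.Relation.Unary.Unique.Setoid as SetoidUnique
open import Data.List.Relation.Unary.All using (All)
open import Relation.Binary.PropositionalEquality using (_≡_)

record OrderedGroup (c ℓ ℓ₂ : Level) : Set (suc (c ⊔ ℓ ⊔ ℓ₂)) where
  field
    group : Group c ℓ
  open Group group public
  field
    _≤_          : Rel Carrier ℓ₂
    isTotalOrder : IsTotalOrder _≈_ _≤_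
    compatible   : ∀ {a b} (x y : Carrier) → a ≤ b → ((x ∙ a) ∙ y) ≤ ((x ∙ b) ∙ y)

module GroupNotions {c ℓ : Level} (G : Group c ℓ) where
  open Group G
  open SetoidMembership setoid public using (_∈_)
  open SetoidUnique setoid public using (Unique)

  [_,_] : Carrier → Carrier → Carrier
  [ a , b ] = ((a ⁻¹ ∙ b ⁻¹) ∙ a) ∙ b

  _^_ : Carrier → Carrier → Carrier
  a ^ b = (b ⁻¹ ∙ a) ∙ b

  data ⟨_⟩ {p} (P : Carrier → Set p) : Carrier → Set (c ⊔ ℓ ⊔ p) where
    gen  : ∀ {x} → P x → ⟨ P ⟩ x
    one  : ⟨ P ⟩ ε
    mul  : ∀ {x y} → ⟨ P ⟩ x → ⟨ P ⟩ y → ⟨ P ⟩ (x ∙ y)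
    inv  : ∀ {x} → ⟨ P ⟩ x → ⟨ P ⟩ (x ⁻¹)
    resp : ∀ {x y} → x ≈ y → ⟨ P ⟩ x → ⟨ P ⟩ y

  _≐_ : ∀ {p q} → (Carrier → Set p) → (Carrier → Set q) → Set (c ⊔ p ⊔ q)
  P ≐ Q = (∀ x → P x → Q x) × (∀ x → Q x → P x)

  -- A finite subset given as a duplicate-free list; its elements as a predicate.
  Elem : List Carrier → Carrier → Set (c ⊔ ℓ)
  Elem S x = x ∈ S

  Sq : List Carrier → Carrier → Set (c ⊔ ℓ)
  Sq S z = ∃ λ x₁ → ∃ λ x₂ → x₁ ∈ S × x₂ ∈ S × z ≈ x₁ ∙ x₂

  HasCard : ∀ {p} → (Carrier → Set p) → ℕ → Set (c ⊔ ℓ ⊔ p)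
  HasCard P n = Σ (List Carrier) λ L →
    Unique L × All P L × (∀ x → P x → x ∈ L) × length L ≡ n

  ⟨_⟩₁ : Carrier → Carrier → Set (c ⊔ ℓ)
  ⟨ a ⟩₁ = ⟨ (λ x → x ≈ a) ⟩

  ⟨_,_⟩₂ : Carrier → Carrier → Carrier → Set (c ⊔ ℓ)
  ⟨ a , b ⟩₂ = ⟨ (λ x → x ≈ a ⊎ x ≈ b) ⟩

  _² : Carrier → Carrier
  x ² = x ∙ x

  Abelian : ∀ {p} → (Carrier → Set p) → Set (c ⊔ ℓ ⊔ p)
  Abelian H = ∀ x y → H x → H y → x ∙ y ≈ y ∙ x

  DirectProduct : ∀ {p} → (Carrier → Set p) → Carrier → Carrier → Carrier → Set (c ⊔ ℓ ⊔ p)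
  DirectProduct H a b c' =
    (H ≐ (λ x → ∃ λ u → ∃ λ v → ⟨ a ⟩₁ u × ⟨ b , c' ⟩₂ v × x ≈ u ∙ v))
    × (∀ u v → ⟨ a ⟩₁ u → ⟨ b , c' ⟩₂ v → u ∙ v ≈ v ∙ u)
    × (∀ x → ⟨ a ⟩₁ x → ⟨ b , c' ⟩₂ x → x ≈ ε)

  -- Young subgroups (cases (i)–(iv)); the order of H is the one inherited from G
  -- and plays no role in the defining conditions.
  Young : ∀ {p} → (Carrier → Set p) → Set (c ⊔ ℓ ⊔ p)
  Young H =
      (∃ λ a → ∃ λ b → (H ≐ ⟨ a , b ⟩₂)
          × [ [ a , b ] , a ] ≈ ε × [ [ a , b ] , b ] ≈ ε)
    ⊎ (∃ λ a → ∃ λ b → ∃ λ c' → DirectProduct H a b c'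
          × (c' ^ b ≈ c' ² ⊎ (c' ²) ^ b ≈ c') × ¬ c' ≈ ε)
    ⊎ (∃ λ a → ∃ λ b → (H ≐ ⟨ a , b ⟩₂) × a ^ b ≈ a ² × ¬ a ≈ ε)
    ⊎ (∃ λ a → ∃ λ b → (H ≐ ⟨ a , b ⟩₂)
          × a ^ (b ²) ≈ a ∙ (a ^ b) × [ a , a ^ b ] ≈ ε × ¬ a ≈ ε)

{-# OPTIONS --safe #-}
{-
Let S = {x₁ < … < x_k}. Removing the maximum x of a non-commuting S removes at least three products
from S²: otherwise every product x y, y x with y below the second largest element already lies in T²,
T = S \ {x}, and going down from the top one sees that all elements commute. If T commutes but x does
not centralize it, then T², x T ∪ T x and {x²} are disjoint, of sizes at least 2|T| − 1, |T| + 1 and 1.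
Hence |S²| ≥ 3k − 2 for every non-commuting S, and when equality holds and k ≥ 5 one of the two
largest elements can be removed, keeping equality, non-commutativity and the generated subgroup.

This leaves k = 4, S = {a < b < c < d}. If three elements commute, they form a progression p, p r, p r²,
and since the fourth element g satisfies |g T ∪ T g| ≤ 4, conjugation by g (or g⁻¹) shifts the
progression, giving case (i), or fixes an end and doubles r, giving case (ii). Otherwise {a,b,c} and
{b,c,d} have seven products each and ad, da ∈ {a,b,c}². Up to reversing the order and passing to the
opposite group, either ab = ba, cd = dc, ca = bc = ad, which is (i), or no two of
a, b, c commute, b = a k and c = k a; then k a² = a k² a or k a² = a k a k, leading to (iii) and (iv).
-}

module Submission where

open import Defs
open import Level using (Level; _⊔_)
open import Data.Bool using (Bool; true; false; not)
open import Data.Bool.Properties using () renaming (_≟_ to _≟ᵇ_)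
open import Data.Nat as ℕ using (ℕ; zero; suc; s≤s; z≤n; _≥_; _*_; _∸_)
import Data.Nat.Properties as ℕₚ
open import Data.Nat.Tactic.RingSolver using (solve-∀)
open import Data.Fin using (Fin; zero; suc; #_) renaming (_≟_ to _≟ᶠ_)
open import Data.List using (List; []; _∷_; _++_; length; map)
open import Data.List.Properties using (length-++; length-map)
open import Data.List.Relation.Unary.Any using (here; there)
open import Data.List.Relation.Unary.All as All using (All; []; _∷_)
open import Data.List.Relation.Unary.AllPairs as AllPairs using (AllPairs; []; _∷_)
import Data.List.Relation.Unary.All.Properties as Allₚ
import Data.List.Relation.Unary.AllPairs.Properties as AllPairsₚ
open import Data.Vec using (Vec; []; _∷_; lookup)
open import Data.Product using (∃; _×_; _,_; proj₁; proj₂)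
open import Data.Sum using (_⊎_; inj₁; inj₂; [_,_]′)
open import Data.Empty using (⊥; ⊥-elim)
open import Function using (_∘_; flip)
open import Relation.Nullary using (¬_; Dec; yes; no)
open import Relation.Nullary.Decidable using (_×-dec_; ¬?; decidable-stable)
open import Relation.Binary using (IsTotalOrder)
open import Relation.Binary.PropositionalEquality as ≡ using (_≡_; refl)
open import Algebra.Bundles using (Group)
import Algebra.Construct.Flip.Op as Op
import Algebra.Properties.Group as GroupProperties
import Relation.Binary.Construct.Flip.EqAndOrd as FlipOrder
import Relation.Binary.Construct.NonStrictToStrict as NonStrictToStrict
import Relation.Binary.Reasoning.Setoid as SetoidReasoning

-- Equality in the group is not assumed decidable, and this shapes the proof. The repetition-free
-- enumeration of `S²` decides `x y = z w` for `x`, `y`, `z`, `w` in `S`, so distinctions between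
-- equal and unequal are phrased as equations between products of two elements, and strict
-- comparisons follow from totality once an inequation is known. The cardinality hypothesis is used
-- as an upper bound on the length of repetition-free lists of products. This form passes to the
-- opposite group and to the reversed order, and most contradictions are an explicit list that is
-- one element too long. Besides the counting, the order enters through the uniqueness of square
-- roots: whatever commutes with `x²` commutes with `x`.

-- Free reduction of words and rewriting by given relations.

module WordSolver {c ℓ} (G : Group c ℓ) where
  open Group G renaming (refl to ≈-refl; sym to ≈-sym; trans to ≈-trans)
  open SetoidReasoning setoid

  infixl 7 _·_
  infix 8 _⁻

  data Expr (n : ℕ) : Set where
    var : Fin n → Expr n
    _·_ : Expr n → Expr n → Expr n
    _⁻  : Expr n → Expr n
    𝟙   : Expr n

  Word : ℕ → Set
  Word n = List (Bool × Fin n)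

  push : ∀ {n} → Bool → Fin n → Word n → Word n
  push s i [] = (s , i) ∷ []
  push s i ((t , j) ∷ w) with i ≟ᶠ j | s ≟ᵇ not t
  ... | yes _ | yes _ = w
  ... | yes _ | no _  = (s , i) ∷ (t , j) ∷ w
  ... | no _  | _     = (s , i) ∷ (t , j) ∷ w

  -- nf true e w reduces e · w, and nf false e w reduces e ⁻ · w.
  nf : ∀ {n} → Bool → Expr n → Word n → Word n
  nf s (var i) w = push s i w
  nf true (e · f) w = nf true e (nf true f w)
  nf false (e · f) w = nf false f (nf false e w)
  nf s (e ⁻) w = nf (not s) e w
  nf s 𝟙 w = w

  module _ {n : ℕ} (ρ : Vec Carrier n) where

    ⟦_⟧ : Expr n → Carrier
    ⟦ var i ⟧ = lookup ρ i
    ⟦ e · f ⟧ = ⟦ e ⟧ ∙ ⟦ f ⟧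
    ⟦ e ⁻ ⟧ = ⟦ e ⟧ ⁻¹
    ⟦ 𝟙 ⟧ = ε

    signed : Bool → Carrier → Carrier
    signed true x = x
    signed false x = x ⁻¹

    ⟦_⟧ʷ : Word n → Carrier
    ⟦ [] ⟧ʷ = ε
    ⟦ (s , i) ∷ w ⟧ʷ = signed s (lookup ρ i) ∙ ⟦ w ⟧ʷ

    private
      cancelˡ : ∀ s x y → y ≈ signed (not s) x ∙ (signed s x ∙ y)
      cancelˡ true x y =
        ≈-trans (≈-sym (identityˡ y)) (≈-trans (∙-congʳ (≈-sym (inverseˡ x))) (assoc _ _ _))
      cancelˡ false x y =
        ≈-trans (≈-sym (identityˡ y)) (≈-trans (∙-congʳ (≈-sym (inverseʳ x))) (assoc _ _ _))

    push-sound : ∀ s i w → ⟦ push s i w ⟧ʷ ≈ signed s (lookup ρ i) ∙ ⟦ w ⟧ʷ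
    push-sound s i [] = ≈-refl
    push-sound s i ((t , j) ∷ w) with i ≟ᶠ j | s ≟ᵇ not t
    ... | yes refl | yes refl = cancelˡ t (lookup ρ i) ⟦ w ⟧ʷ
    ... | yes _    | no _     = ≈-refl
    ... | no _     | _        = ≈-refl

    nf-sound : ∀ s e w → ⟦ nf s e w ⟧ʷ ≈ signed s ⟦ e ⟧ ∙ ⟦ w ⟧ʷ
    nf-sound s (var i) w = push-sound s i w
    nf-sound true (e · f) w =
      ≈-trans (nf-sound true e _) (≈-trans (∙-congˡ (nf-sound true f w)) (≈-sym (assoc _ _ _)))
    nf-sound false (e · f) w = begin
      ⟦ nf false f (nf false e w) ⟧ʷ          ≈⟨ nf-sound false f _ ⟩
      ⟦ f ⟧ ⁻¹ ∙ ⟦ nf false e w ⟧ʷ            ≈⟨ ∙-congˡ (nf-sound false e w) ⟩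
      ⟦ f ⟧ ⁻¹ ∙ (⟦ e ⟧ ⁻¹ ∙ ⟦ w ⟧ʷ)          ≈⟨ assoc _ _ _ ⟨
      ⟦ f ⟧ ⁻¹ ∙ ⟦ e ⟧ ⁻¹ ∙ ⟦ w ⟧ʷ            ≈⟨ ∙-congʳ (GroupProperties.⁻¹-anti-homo-∙ G _ _) ⟨
      (⟦ e ⟧ ∙ ⟦ f ⟧) ⁻¹ ∙ ⟦ w ⟧ʷ             ∎
    nf-sound true (e ⁻) w = nf-sound false e w
    nf-sound false (e ⁻) w =
      ≈-trans (nf-sound true e w) (∙-congʳ (≈-sym (GroupProperties.⁻¹-involutive G _)))
    nf-sound true 𝟙 w = ≈-sym (identityˡ _)
    nf-sound false 𝟙 w =
      ≈-sym (≈-trans (∙-congʳ (GroupProperties.ε⁻¹≈ε G)) (identityˡ _))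

    solve : ∀ e f → nf true e [] ≡ nf true f [] → ⟦ e ⟧ ≈ ⟦ f ⟧
    solve e f eq = ≈-trans (reduce e) (≈-trans (reflexive (≡.cong ⟦_⟧ʷ eq)) (≈-sym (reduce f)))
      where
      reduce : ∀ e → ⟦ e ⟧ ≈ ⟦ nf true e [] ⟧ʷ
      reduce e = ≈-sym (≈-trans (nf-sound true e []) (identityʳ _))

    record Rule : Set ℓ where
      constructor rule
      field
        lhs rhs : Expr n
        holds   : ⟦ lhs ⟧ ≈ ⟦ rhs ⟧

    -- A pair (p , l → r) rewrites p · l · q to p · r · q, for any q.
    rewriteAll : List (Expr n × Rule) → Expr n → Expr n
    rewriteAll [] e = e
    rewriteAll ((p , rule l r _) ∷ rs) e = rewriteAll rs ((p · r) · (p · l) ⁻ · e)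

    rewriteAll-sound : ∀ rs e → ⟦ rewriteAll rs e ⟧ ≈ ⟦ e ⟧
    rewriteAll-sound [] e = ≈-refl
    rewriteAll-sound ((p , rule l r h) ∷ rs) e = ≈-trans (rewriteAll-sound rs _)
      (≈-trans (∙-congʳ (≈-trans (∙-congʳ (∙-congˡ (≈-sym h))) (inverseʳ _))) (identityˡ _))

    -- Every inserted factor equals `ε`, so a rule never has to match. The prefix may be any
    -- expression, in particular an inverse: this multiplies a relation by a common factor and
    -- leaves the cancellation to free reduction.
    derive : ∀ e f (rs : List (Expr n × Rule)) →
             nf true (rewriteAll rs e) [] ≡ nf true f [] → ⟦ e ⟧ ≈ ⟦ f ⟧
    derive e f rs eq = ≈-trans (≈-sym (rewriteAll-sound rs e)) (solve (rewriteAll rs e) f eq)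

  infix 9 _ʳ
  _ʳ : ∀ {n} {ρ : Vec Carrier n} → Rule ρ → Rule ρ
  rule l r h ʳ = rule r l (≈-sym h)

-- Strict order and monotonicity of multiplication.

module OrderedGroupProperties {c ℓ ℓ₂ : Level} (G : OrderedGroup c ℓ ℓ₂) where
  open OrderedGroup G public
    renaming (refl to ≈-refl; sym to ≈-sym; trans to ≈-trans; _≤_ to infix 4 _≤_)
  open GroupNotions group public
  open WordSolver group public
  open GroupProperties group public using (∙-cancelˡ; ∙-cancelʳ; ⁻¹-involutive)
  private module T = IsTotalOrder isTotalOrder
  open T public using (total; antisym)
    renaming (refl to ≤-refl; trans to ≤-trans; reflexive to ≤-reflexive)
  private module Strict = NonStrictToStrict _≈_ _≤_
  open Strict public using (_<_; <⇒≤; <⇒≉)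

  <-trans : ∀ {x y z} → x < y → y < z → x < z
  <-trans = Strict.<-trans T.isPartialOrder

  <-≤-trans : ∀ {x y z} → x < y → y ≤ z → x < z
  <-≤-trans = Strict.<-≤-trans ≈-sym ≤-trans antisym (proj₁ T.≤-resp-≈)

  ≤-<-trans : ∀ {x y z} → x ≤ y → y < z → x < z
  ≤-<-trans = Strict.≤-<-trans ≤-trans antisym (proj₂ T.≤-resp-≈)

  <-≈-trans : ∀ {x y z} → x < y → y ≈ z → x < z
  <-≈-trans x<y y≈z = <-≤-trans x<y (≤-reflexive y≈z)

  ≈-<-trans : ∀ {x y z} → x ≈ y → y < z → x < z
  ≈-<-trans x≈y y<z = ≤-<-trans (≤-reflexive x≈y) y<z

  <-asym : ∀ {x y} → x < y → ¬ y < x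
  <-asym = Strict.<-asym antisym

  >⇒≉ : ∀ {x y} → y < x → x ≉ y
  >⇒≉ y<x x≈y = <⇒≉ y<x (≈-sym x≈y)

  <-connex : ∀ {x y} → x ≉ y → x < y ⊎ y < x
  <-connex {x} {y} x≉y with total x y
  ... | inj₁ x≤y = inj₁ (x≤y , x≉y)
  ... | inj₂ y≤x = inj₂ (y≤x , λ e → x≉y (≈-sym e))

  ∙-monoˡ-≤ : ∀ {x y} z → x ≤ y → x ∙ z ≤ y ∙ z
  ∙-monoˡ-≤ z x≤y = ≤-trans (≤-reflexive (∙-congʳ (≈-sym (identityˡ _))))
    (≤-trans (compatible ε z x≤y) (≤-reflexive (∙-congʳ (identityˡ _))))

  ∙-monoʳ-≤ : ∀ {x y} z → x ≤ y → z ∙ x ≤ z ∙ y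
  ∙-monoʳ-≤ z x≤y = ≤-trans (≤-reflexive (≈-sym (identityʳ _)))
    (≤-trans (compatible z ε x≤y) (≤-reflexive (identityʳ _)))

  ∙-monoˡ-< : ∀ {x y} z → x < y → x ∙ z < y ∙ z
  ∙-monoˡ-< z (x≤y , x≉y) = ∙-monoˡ-≤ z x≤y , λ e → x≉y (∙-cancelʳ _ _ _ e)

  ∙-monoʳ-< : ∀ {x y} z → x < y → z ∙ x < z ∙ y
  ∙-monoʳ-< z (x≤y , x≉y) = ∙-monoʳ-≤ z x≤y , λ e → x≉y (∙-cancelˡ _ _ _ e)

  ∙-mono-< : ∀ {x y u v} → x < y → u < v → x ∙ u < y ∙ v
  ∙-mono-< {y = y} {u = u} x<y u<v = <-trans (∙-monoˡ-< u x<y) (∙-monoʳ-< y u<v)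

  ∙-mono-<-≤ : ∀ {x y u v} → x < y → u ≤ v → x ∙ u < y ∙ v
  ∙-mono-<-≤ {y = y} {u = u} x<y u≤v = <-≤-trans (∙-monoˡ-< u x<y) (∙-monoʳ-≤ y u≤v)

  ∙-mono-≤-< : ∀ {x y u v} → x ≤ y → u < v → x ∙ u < y ∙ v
  ∙-mono-≤-< {y = y} {u = u} x≤y u<v = ≤-<-trans (∙-monoˡ-≤ u x≤y) (∙-monoʳ-< y u<v)

  ∙-mono-≤ : ∀ {x y u v} → x ≤ y → u ≤ v → x ∙ u ≤ y ∙ v
  ∙-mono-≤ {y = y} {u = u} x≤y u≤v = ≤-trans (∙-monoˡ-≤ u x≤y) (∙-monoʳ-≤ y u≤v)

  -- In `x u ≤ y u ≤ y v` equality of the ends forces equality in the first step.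
  ∙-cancelˡ-≤-≈ : ∀ {x y u v} → x ≤ y → u ≤ v → x ∙ u ≈ y ∙ v → x ≈ y
  ∙-cancelˡ-≤-≈ {y = y} {u = u} x≤y u≤v e =
    ∙-cancelʳ u _ _ (antisym (∙-monoˡ-≤ u x≤y)
      (≤-trans (∙-monoʳ-≤ y u≤v) (≤-reflexive (≈-sym e))))

  Commute : Carrier → Carrier → Set ℓ
  Commute x y = x ∙ y ≈ y ∙ x

  square-injective : ∀ {x y} → x ∙ x ≈ y ∙ y → x ≈ y
  square-injective {x} {y} e with total x y
  ... | inj₁ x≤y = ∙-cancelˡ-≤-≈ x≤y x≤y e
  ... | inj₂ y≤x = ≈-sym (∙-cancelˡ-≤-≈ y≤x y≤x (≈-sym e))

-- Centralizers and generated subgroups.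

module Commutation {c ℓ ℓ₂ : Level} (G : OrderedGroup c ℓ ℓ₂) where
  open OrderedGroupProperties G

  private
    X : Expr 3
    X = var zero
    Y : Expr 3
    Y = var (suc zero)
    Z : Expr 3
    Z = var (suc (suc zero))

  commute-∙ : ∀ {x y z} → Commute x y → Commute x z → Commute x (y ∙ z)
  commute-∙ {x} {y} {z} xy xz = derive ρ (X · (Y · Z)) ((Y · Z) · X)
    ((𝟙 , rule (X · Y) (Y · X) xy) ∷ (Y , rule (X · Z) (Z · X) xz) ∷ []) refl
    where ρ = x ∷ y ∷ z ∷ []

  commute-⁻¹ : ∀ {x y} → Commute x y → Commute x (y ⁻¹)
  commute-⁻¹ {x} {y} xy = derive ρ (X · Y ⁻) (Y ⁻ · X)
    ((Y ⁻ , rule (Y · X) (X · Y) (≈-sym xy)) ∷ []) refl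
    where ρ = x ∷ y ∷ y ∷ []

  commute-resp : ∀ {x y y′} → y ≈ y′ → Commute x y → Commute x y′
  commute-resp y≈y′ xy = ≈-trans (∙-congˡ (≈-sym y≈y′)) (≈-trans xy (∙-congʳ y≈y′))

  commute-ε : ∀ {x} → Commute x ε
  commute-ε = ≈-trans (identityʳ _) (≈-sym (identityˡ _))

  commute-cancelˡ : ∀ {x y z} → Commute x y → Commute x (y ∙ z) → Commute x z
  commute-cancelˡ {x} {y} {z} xy xyz =
    commute-resp (solve (x ∷ y ∷ z ∷ []) (Y ⁻ · (Y · Z)) Z refl) (commute-∙ (commute-⁻¹ xy) xyz)

  commute-cancelʳ : ∀ {x y z} → Commute x z → Commute x (y ∙ z) → Commute x y
  commute-cancelʳ {x} {y} {z} xz xyz =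
    commute-resp (solve (x ∷ y ∷ z ∷ []) ((Y · Z) · Z ⁻) Y refl) (commute-∙ xyz (commute-⁻¹ xz))

  -- The conjugate of `x` by `y` has the same square as `x`, and square roots are unique.
  square-commute : ∀ {x y} → Commute y (x ∙ x) → Commute y x
  square-commute {x} {y} yxx = derive ρ (Y · X) (X · Y)
    ((Y , rule X (Y ⁻ · X · Y) conj) ∷ []) refl
    where
    ρ = x ∷ y ∷ y ∷ []
    conj : x ≈ y ⁻¹ ∙ x ∙ y
    conj = square-injective (derive ρ (X · X) ((Y ⁻ · X · Y) · (Y ⁻ · X · Y))
      ((Y ⁻ , rule (Y · (X · X)) ((X · X) · Y) yxx) ∷ []) refl)

  ⟨⟩-minimal : ∀ {p q} {P : Carrier → Set p} {Q : Carrier → Set q} →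
               (∀ {x} → P x → ⟨ Q ⟩ x) → ∀ {x} → ⟨ P ⟩ x → ⟨ Q ⟩ x
  ⟨⟩-minimal P⊆Q (gen px) = P⊆Q px
  ⟨⟩-minimal P⊆Q one = one
  ⟨⟩-minimal P⊆Q (mul u v) = mul (⟨⟩-minimal P⊆Q u) (⟨⟩-minimal P⊆Q v)
  ⟨⟩-minimal P⊆Q (inv u) = inv (⟨⟩-minimal P⊆Q u)
  ⟨⟩-minimal P⊆Q (resp e u) = resp e (⟨⟩-minimal P⊆Q u)

  ⟨⟩-commute : ∀ {p} {P : Carrier → Set p} {x} →
               (∀ {y} → P y → Commute x y) → ∀ {y} → ⟨ P ⟩ y → Commute x y
  ⟨⟩-commute h (gen py) = h py
  ⟨⟩-commute h one = commute-ε
  ⟨⟩-commute h (mul u v) = commute-∙ (⟨⟩-commute h u) (⟨⟩-commute h v)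
  ⟨⟩-commute h (inv u) = commute-⁻¹ (⟨⟩-commute h u)
  ⟨⟩-commute h (resp e u) = commute-resp e (⟨⟩-commute h u)

  ⟨⟩-abelian : ∀ {p} {P : Carrier → Set p} →
               (∀ {x y} → P x → P y → Commute x y) → Abelian ⟨ P ⟩
  ⟨⟩-abelian h x y u v = ⟨⟩-commute (λ py → ≈-sym (⟨⟩-commute (λ px → h py px) u)) v

-- Product sets and the removal of the maximum.

module Squares {c ℓ ℓ₂ : Level} (G : OrderedGroup c ℓ ℓ₂) where
  open OrderedGroupProperties G
  open Commutation G

  Decreasing : List Carrier → Set (ℓ ⊔ ℓ₂ ⊔ c)
  Decreasing = AllPairs (flip _<_)

  decreasing⇒unique : ∀ {L} → Decreasing L → Unique L
  decreasing⇒unique = AllPairs.map >⇒≉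

  infix 4 _⊆_
  _⊆_ : List Carrier → List Carrier → Set (c ⊔ ℓ)
  T ⊆ S = ∀ {z} → z ∈ T → z ∈ S

  -- Exactly what an enumeration of `S²` can decide; commutation of two elements of `S` is an
  -- instance.
  DecSq : List Carrier → Set (c ⊔ ℓ)
  DecSq S = ∀ {x y z w} → x ∈ S → y ∈ S → z ∈ S → w ∈ S → Dec (x ∙ y ≈ z ∙ w)

  DecSq-⊆ : ∀ {S T} → T ⊆ S → DecSq S → DecSq T
  DecSq-⊆ T⊆S _≟_ x y z w = (T⊆S x ≟ T⊆S y) (T⊆S z) (T⊆S w)

  sq : ∀ {S x y} → x ∈ S → y ∈ S → Sq S (x ∙ y)
  sq x∈S y∈S = _ , _ , x∈S , y∈S , ≈-refl

  Sq-⊆ : ∀ {S T z} → T ⊆ S → Sq T z → Sq S z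
  Sq-⊆ T⊆S (x , y , x∈T , y∈T , e) = x , y , T⊆S x∈T , T⊆S y∈T , e

  Sq-resp : ∀ {S z w} → z ≈ w → Sq S z → Sq S w
  Sq-resp e (x , y , x∈S , y∈S , h) = x , y , x∈S , y∈S , ≈-trans (≈-sym e) h

  lookup< : ∀ {T b x} → All (_< b) T → x ∈ T → x < b
  lookup< (t<b ∷ _) (here e) = ≈-<-trans e t<b
  lookup< (_ ∷ T<b) (there h) = lookup< T<b h

  search : ∀ {p} {P : Carrier → Set p} L → (∀ {x y} → x ≈ y → P x → P y) →
           (∀ {x} → x ∈ L → Dec (P x)) →
           (∃ λ x → x ∈ L × P x) ⊎ (∀ {x} → x ∈ L → ¬ P x)
  search [] P-resp P? = inj₂ λ ()
  search (y ∷ L) P-resp P? with P? (here ≈-refl) | search L P-resp (P? ∘ there)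
  ... | yes py | _ = inj₁ (y , here ≈-refl , py)
  ... | no _ | inj₁ (x , x∈L , px) = inj₁ (x , there x∈L , px)
  ... | no ¬py | inj₂ none = inj₂ λ where
    (here e) px → ¬py (P-resp e px)
    (there h) px → none h px

  sq? : ∀ {S} T → T ⊆ S → DecSq S → ∀ {x y} → x ∈ S → y ∈ S → Dec (Sq T (x ∙ y))
  sq? T T⊆S _≟_ {x} {y} x∈S y∈S
    with search {P = λ t → ∃ λ u → u ∈ T × x ∙ y ≈ t ∙ u} T
           (λ e (u , u∈T , h) → u , u∈T , ≈-trans h (∙-congʳ e)) second?
    where
    second? : ∀ {t} → t ∈ T → Dec (∃ λ u → u ∈ T × x ∙ y ≈ t ∙ u)
    second? {t} t∈T with search {P = λ u → x ∙ y ≈ t ∙ u} T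
                           (λ e h → ≈-trans h (∙-congˡ e))
                           (λ u∈T → (x∈S ≟ y∈S) (T⊆S t∈T) (T⊆S u∈T))
    ... | inj₁ found = yes found
    ... | inj₂ none = no λ (u , u∈T , h) → none u∈T h
  ... | inj₁ (t , t∈T , u , u∈T , h) = yes (t , u , t∈T , u∈T , h)
  ... | inj₂ none = no λ (t , u , t∈T , u∈T , h) → none t∈T (u , u∈T , h)

  PairwiseCommuting : List Carrier → Set (c ⊔ ℓ)
  PairwiseCommuting T = ∀ {x y} → x ∈ T → y ∈ T → Commute x y

  NonCommuting : List Carrier → Set (c ⊔ ℓ)
  NonCommuting T = ∃ λ x → ∃ λ y → x ∈ T × y ∈ T × ¬ Commute x y

  commute? : ∀ {S x y} → DecSq S → x ∈ S → y ∈ S → Dec (Commute x y)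
  commute? _≟_ x∈S y∈S = (x∈S ≟ y∈S) y∈S x∈S

  commuting? : ∀ T → DecSq T → NonCommuting T ⊎ PairwiseCommuting T
  commuting? T _≟_
    with search {P = λ x → ∃ λ y → y ∈ T × ¬ Commute x y} T
           (λ e (y , y∈T , h) → y , y∈T , λ k → h (≈-trans (∙-congʳ e) (≈-trans k (∙-congˡ (≈-sym e)))))
           partner?
    where
    partner? : ∀ {x} → x ∈ T → Dec (∃ λ y → y ∈ T × ¬ Commute x y)
    partner? {x} x∈T with search {P = λ y → ¬ Commute x y} T
                            (λ e h k → h (commute-resp (≈-sym e) k))
                            (λ y∈T → ¬? (commute? _≟_ x∈T y∈T))
    ... | inj₁ found = yes found
    ... | inj₂ none = no λ (y , y∈T , h) → none y∈T h
  ... | inj₁ (x , x∈T , y , y∈T , h) = inj₁ (x , y , x∈T , y∈T , h)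
  ... | inj₂ none = inj₂ λ x∈T y∈T →
    decidable-stable (commute? _≟_ x∈T y∈T) λ h → none x∈T (_ , y∈T , h)

  unique-++ : ∀ {p q} {P : Carrier → Set p} {Q : Carrier → Set q} {xs ys} →
              (∀ {x y} → P x → Q y → x ≉ y) →
              Unique xs → All P xs → Unique ys → All Q ys → Unique (xs ++ ys)
  unique-++ disjoint uxs pxs uys qys =
    AllPairsₚ.++⁺ uxs uys (All.map (λ px → All.map (disjoint px) qys) pxs)

  module Maximum (x t : Carrier) (T′ : List Carrier)
                 (decreasing : Decreasing (x ∷ t ∷ T′)) (_≟_ : DecSq (x ∷ t ∷ T′)) where

    T S : List Carrier
    T = t ∷ T′
    S = x ∷ T

    private
      x∈S : x ∈ S
      x∈S = here ≈-refl

      T<x : ∀ {u} → u ∈ T → u < x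
      T<x = lookup< (AllPairs.head decreasing)

      T′<t : ∀ {u} → u ∈ T′ → u < t
      T′<t = lookup< (AllPairs.head (AllPairs.tail decreasing))

      t<x : t < x
      t<x = T<x (here ≈-refl)

      T≤t : ∀ {u} → u ∈ T → u ≤ t
      T≤t (here e) = ≤-reflexive e
      T≤t (there h) = <⇒≤ (T′<t h)

    New : Carrier → Set (c ⊔ ℓ)
    New z = Sq S z × ¬ Sq T z

    xx-new : New (x ∙ x)
    xx-new = sq x∈S x∈S ,
      λ (u , v , u∈T , v∈T , e) → <⇒≉ (∙-mono-< (T<x u∈T) (T<x v∈T)) (≈-sym e)

    private
      xt-new : New (x ∙ t)
      xt-new = sq x∈S (there (here ≈-refl)) ,
        λ (u , v , u∈T , v∈T , e) → <⇒≉ (∙-mono-<-≤ (T<x u∈T) (T≤t v∈T)) (≈-sym e)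

      tx-new : New (t ∙ x)
      tx-new = sq (there (here ≈-refl)) x∈S ,
        λ (u , v , u∈T , v∈T , e) → <⇒≉ (∙-mono-≤-< (T≤t u∈T) (T<x v∈T)) (≈-sym e)

      Absorbed : Carrier → Set (c ⊔ ℓ)
      Absorbed u = Sq T (x ∙ u) × Sq T (u ∙ x)

      absorbed? : ∀ {u} → u ∈ T′ → Dec (Absorbed u)
      absorbed? u∈T′ with sq? T there _≟_ x∈S (there (there u∈T′)) | sq? T there _≟_ (there (there u∈T′)) x∈S
      ... | yes p | yes q = yes (p , q)
      ... | no ¬p | _ = no (¬p ∘ proj₁)
      ... | yes _ | no ¬q = no (¬q ∘ proj₂)

      module Absorption (absorbed : ∀ {u} → u ∈ T′ → Absorbed u) where

        module Extend {s} {P R : List Carrier} (s∈T′ : s ∈ T′) (x∈P : x ∈ P)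
                 (R<s : ∀ {u} → u ∈ R → u < s)
                 (P-commuting : PairwiseCommuting P)
                 (split : ∀ {u} → u ∈ S → u ∈ P ⊎ u ≈ s ⊎ u ∈ R) where

          private
            above : ∀ {u} → u ∈ T → s < u → u ∈ P
            above u∈T s<u with split (there u∈T)
            ... | inj₁ u∈P = u∈P
            ... | inj₂ (inj₁ u≈s) = ⊥-elim (<⇒≉ s<u (≈-sym u≈s))
            ... | inj₂ (inj₂ u∈R) = ⊥-elim (<-asym s<u (R<s u∈R))

            P-or-≤ : ∀ {u} → u ∈ T → u ∈ P ⊎ u ≤ s
            P-or-≤ u∈T with split (there u∈T)
            ... | inj₁ u∈P = inj₁ u∈P
            ... | inj₂ (inj₁ u≈s) = inj₂ (≤-reflexive u≈s)
            ... | inj₂ (inj₂ u∈R) = inj₂ (<⇒≤ (R<s u∈R))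

            -- If x s < s x = u v with u, v < x, then s < u, so u commutes with x; also v ≤ s
            -- (otherwise u v commutes with x), whence u v < x s, a contradiction.
            x-commutes : Commute x s
            x-commutes = decidable-stable (commute? _≟_ x∈S (there (there s∈T′)))
              λ noncomm → [ xs<sx noncomm , sx<xs noncomm ]′ (<-connex noncomm)
              where
              xs<sx : ¬ Commute x s → x ∙ s < s ∙ x → ⊥
              xs<sx noncomm lt with proj₂ (absorbed s∈T′)
              ... | u , v , u∈T , v∈T , e with P-or-≤ u∈T
              ... | inj₂ u≤s = <⇒≉ (∙-mono-≤-< u≤s (T<x v∈T)) (≈-sym e)
              ... | inj₁ u∈P with P-or-≤ v∈T
              ... | inj₁ v∈P = noncomm (commute-cancelʳ ≈-refl (commute-resp (≈-sym e)
                                 (commute-∙ (P-commuting x∈P u∈P) (P-commuting x∈P v∈P))))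
              ... | inj₂ v≤s = <-asym lt (≈-<-trans e (∙-mono-<-≤ (T<x u∈T) v≤s))
              sx<xs : ¬ Commute x s → s ∙ x < x ∙ s → ⊥
              sx<xs noncomm lt with proj₁ (absorbed s∈T′)
              ... | u , v , u∈T , v∈T , e with P-or-≤ v∈T
              ... | inj₂ v≤s = <⇒≉ (∙-mono-<-≤ (T<x u∈T) v≤s) (≈-sym e)
              ... | inj₁ v∈P with P-or-≤ u∈T
              ... | inj₁ u∈P = noncomm (commute-cancelˡ ≈-refl (commute-resp (≈-sym e)
                                 (commute-∙ (P-commuting x∈P u∈P) (P-commuting x∈P v∈P))))
              ... | inj₂ u≤s = <-asym lt (≈-<-trans e (∙-mono-≤-< u≤s (T<x v∈T)))

            -- Let `x s = s x = u v` with `u` and `v` below `x`. Both must exceed `s`, hence lie in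
            -- `P`. So `p` commutes with `u v = x s` and with `x`, hence with `s`.
            P-commutes : ∀ {p} → p ∈ P → Commute p s
            P-commutes {p} p∈P with proj₁ (absorbed s∈T′)
            ... | u , v , u∈T , v∈T , e =
              commute-cancelˡ (P-commuting p∈P x∈P) (commute-resp (≈-sym e)
                (commute-∙ (P-commuting p∈P (above u∈T s<u)) (P-commuting p∈P (above v∈T s<v))))
              where
              s<v : s < v
              s<v with <-connex {s} {v} (λ s≈v → <⇒≉ (∙-mono-<-≤ (T<x u∈T) (≤-reflexive (≈-sym s≈v))) (≈-sym e))
              ... | inj₁ s<v = s<v
              ... | inj₂ v<s = ⊥-elim (<⇒≉ (∙-mono-< (T<x u∈T) v<s) (≈-sym e))
              sx≈uv : s ∙ x ≈ u ∙ v
              sx≈uv = ≈-trans (≈-sym x-commutes) e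
              s<u : s < u
              s<u with <-connex {s} {u} (λ s≈u → <⇒≉ (∙-mono-≤-< (≤-reflexive (≈-sym s≈u)) (T<x v∈T)) (≈-sym sx≈uv))
              ... | inj₁ s<u = s<u
              ... | inj₂ u<s = ⊥-elim (<⇒≉ (∙-mono-< u<s (T<x v∈T)) (≈-sym sx≈uv))

          extended : PairwiseCommuting (s ∷ P)
          extended (here e) (here e′) = ≈-trans (∙-cong e e′) (∙-cong (≈-sym e′) (≈-sym e))
          extended (here e) (there h) =
            ≈-sym (commute-resp (≈-sym e) (P-commutes h))
          extended (there h) (here e) = commute-resp (≈-sym e) (P-commutes h)
          extended (there h) (there h′) = P-commuting h h′

        -- Elements move from `R` to `P` from the top down. As `R` is decreasing, its head `s` is
        -- the largest element left, so every factor above `s` is already in `P`.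
        commuting : ∀ P R → x ∈ P → Decreasing R → R ⊆ T′ → PairwiseCommuting P →
                    (∀ {u} → u ∈ S → u ∈ P ⊎ u ∈ R) → PairwiseCommuting S
        commuting P [] x∈P _ _ P-commuting split u∈S v∈S =
          P-commuting (inP (split u∈S)) (inP (split v∈S))
          where
          inP : ∀ {u} → u ∈ P ⊎ u ∈ [] → u ∈ P
          inP (inj₁ h) = h
        commuting P (s ∷ R) x∈P (R<s ∷ R-decreasing) R⊆T′ P-commuting split =
          commuting (s ∷ P) R (there x∈P) R-decreasing (R⊆T′ ∘ there)
            (Extend.extended (R⊆T′ (here ≈-refl)) x∈P (lookup< R<s) P-commuting (split′ ∘ split))
            (regroup ∘ split)
          where
          split′ : ∀ {u} → u ∈ P ⊎ u ∈ s ∷ R → u ∈ P ⊎ u ≈ s ⊎ u ∈ R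
          split′ (inj₁ h) = inj₁ h
          split′ (inj₂ (here e)) = inj₂ (inj₁ e)
          split′ (inj₂ (there h)) = inj₂ (inj₂ h)
          regroup : ∀ {u} → u ∈ P ⊎ u ∈ s ∷ R → u ∈ s ∷ P ⊎ u ∈ R
          regroup (inj₁ h) = inj₁ (there h)
          regroup (inj₂ (here e)) = inj₁ (here e)
          regroup (inj₂ (there h)) = inj₂ h

    three-new : NonCommuting S → ∃ λ L → Unique L × All New L × length L ≡ 3
    three-new (y , z , y∈S , z∈S , yz) with commute? _≟_ x∈S (there (here ≈-refl))
    ... | no xt =
      x ∙ x ∷ x ∙ t ∷ t ∙ x ∷ [] ,
      (>⇒≉ (∙-monoʳ-< x t<x) ∷ >⇒≉ (∙-monoˡ-< x t<x) ∷ []) ∷ (xt ∷ []) ∷ [] ∷ [] ,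
      xx-new ∷ xt-new ∷ tx-new ∷ [] , refl
    ... | yes xt with search {P = λ u → ¬ Absorbed u} T′
                        (λ e h (p , q) → h (Sq-resp (∙-congˡ (≈-sym e)) p , Sq-resp (∙-congʳ (≈-sym e)) q))
                        (λ u∈T′ → ¬? (absorbed? u∈T′))
    ... | inj₂ none = ⊥-elim (yz (Absorption.commuting
            (λ u∈T′ → decidable-stable (absorbed? u∈T′) (none u∈T′))
            (t ∷ x ∷ []) T′ (there (here ≈-refl)) (AllPairs.tail (AllPairs.tail decreasing))
            (λ h → h) top split y∈S z∈S))
      where
      top : PairwiseCommuting (t ∷ x ∷ [])
      top (here e) (here e′) = ≈-trans (∙-cong e e′) (∙-cong (≈-sym e′) (≈-sym e))
      top (here e) (there (here e′)) = ≈-trans (∙-cong e e′) (≈-trans (≈-sym xt) (∙-cong (≈-sym e′) (≈-sym e)))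
      top (there (here e)) (here e′) = ≈-trans (∙-cong e e′) (≈-trans xt (∙-cong (≈-sym e′) (≈-sym e)))
      top (there (here e)) (there (here e′)) = ≈-trans (∙-cong e e′) (∙-cong (≈-sym e′) (≈-sym e))
      split : ∀ {u} → u ∈ S → u ∈ t ∷ x ∷ [] ⊎ u ∈ T′
      split (here e) = inj₁ (there (here e))
      split (there (here e)) = inj₁ (here e)
      split (there (there h)) = inj₂ h
    ... | inj₁ (u , u∈T′ , ¬absorbed) with sq? T there _≟_ x∈S (there (there u∈T′))
    ... | no xu =
      x ∙ x ∷ x ∙ t ∷ x ∙ u ∷ [] ,
      (>⇒≉ (∙-monoʳ-< x t<x) ∷ >⇒≉ (∙-monoʳ-< x (T<x (there u∈T′))) ∷ []) ∷
      (>⇒≉ (∙-monoʳ-< x (T′<t u∈T′)) ∷ []) ∷ [] ∷ [] ,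
      xx-new ∷ xt-new ∷ (sq x∈S (there (there u∈T′)) , xu) ∷ [] , refl
    -- `x u` is an old product, so the list uses products with `x` on the right; these are ordered
    -- by their left factors.
    ... | yes xu =
      x ∙ x ∷ t ∙ x ∷ u ∙ x ∷ [] ,
      (>⇒≉ (∙-monoˡ-< x t<x) ∷ >⇒≉ (∙-monoˡ-< x (T<x (there u∈T′))) ∷ []) ∷
      (>⇒≉ (∙-monoˡ-< x (T′<t u∈T′)) ∷ []) ∷ [] ∷ [] ,
      xx-new ∷ tx-new ∷ (sq (there (there u∈T′)) x∈S , λ ux → ¬absorbed (xu , ux)) ∷ [] , refl

-- The lower bound for non-commuting sets.

module LowerBound {c ℓ ℓ₂ : Level} (G : OrderedGroup c ℓ ℓ₂) where
  open OrderedGroupProperties G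
  open Commutation G
  open Squares G

  -- The usual witness for `|T²| ≥ 2|T| − 1`: on a decreasing list, each product of neighbours lies
  -- strictly between their squares.
  chain : List Carrier → List Carrier
  chain [] = []
  chain (t ∷ []) = t ∙ t ∷ []
  chain (t ∷ s ∷ T) = t ∙ t ∷ t ∙ s ∷ chain (s ∷ T)

  chain-≤ : ∀ t T → Decreasing (t ∷ T) → All (_≤ t ∙ t) (chain (t ∷ T))
  chain-≤ t [] _ = ≤-refl ∷ []
  chain-≤ t (s ∷ T) ((s<t ∷ _) ∷ T-dec) =
    ≤-refl ∷ ∙-monoʳ-≤ t (<⇒≤ s<t) ∷
    All.map (λ z≤ → ≤-trans z≤ (∙-mono-≤ (<⇒≤ s<t) (<⇒≤ s<t))) (chain-≤ s T T-dec)

  chain-decreasing : ∀ T → Decreasing T → Decreasing (chain T)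
  chain-decreasing [] _ = []
  chain-decreasing (t ∷ []) _ = [] ∷ []
  chain-decreasing (t ∷ s ∷ T) ((s<t ∷ _) ∷ T-dec) =
    (∙-monoʳ-< t s<t ∷ All.map (λ z≤ → ≤-<-trans z≤ (∙-mono-< s<t s<t)) below) ∷
    All.map (λ z≤ → ≤-<-trans z≤ (∙-monoˡ-< s s<t)) below ∷
    chain-decreasing (s ∷ T) T-dec
    where
    below = chain-≤ s T T-dec

  chain-⊆ : ∀ T → All (Sq T) (chain T)
  chain-⊆ [] = []
  chain-⊆ (t ∷ []) = sq (here ≈-refl) (here ≈-refl) ∷ []
  chain-⊆ (t ∷ s ∷ T) =
    sq (here ≈-refl) (here ≈-refl) ∷ sq (here ≈-refl) (there (here ≈-refl)) ∷
    All.map (Sq-⊆ there) (chain-⊆ (s ∷ T))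

  length-chain : ∀ t T → suc (length (chain (t ∷ T))) ≡ 2 ℕ.* length (t ∷ T)
  length-chain t [] = refl
  length-chain t (s ∷ T) = ≡.trans (≡.cong (2 ℕ.+_) (length-chain s T)) (≡.sym (ℕₚ.*-suc 2 (length (s ∷ T))))

  Translate : Carrier → List Carrier → Carrier → Set (c ⊔ ℓ)
  Translate g T z = ∃ λ t → t ∈ T × (z ≈ g ∙ t ⊎ z ≈ t ∙ g)

  translateˡ : ∀ {g T t} → t ∈ T → Translate g T (g ∙ t)
  translateˡ t∈T = _ , t∈T , inj₁ ≈-refl

  translateʳ : ∀ {g T t} → t ∈ T → Translate g T (t ∙ g)
  translateʳ t∈T = _ , t∈T , inj₂ ≈-refl

  Translate-there : ∀ {g t T z} → Translate g T z → Translate g (t ∷ T) z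
  Translate-there (u , u∈T , h) = u , there u∈T , h

  tabulate∈ : ∀ {p} {P : Carrier → Set p} {T} → (∀ {t} → t ∈ T → P t) → All P T
  tabulate∈ {T = []} h = []
  tabulate∈ {T = t ∷ T} h = h (here ≈-refl) ∷ tabulate∈ (h ∘ there)

  private
    map-∈ : ∀ {p} {P : Carrier → Set p} {f : Carrier → Carrier} T →
            (∀ {t} → t ∈ T → P (f t)) → All P (map f T)
    map-∈ T h = Allₚ.map⁺ (tabulate∈ h)

  map-decreasing : ∀ {f : Carrier → Carrier} → (∀ {x y} → x < y → f x < f y) →
                   ∀ {T} → Decreasing T → Decreasing (map f T)
  map-decreasing f-mono T-dec = AllPairsₚ.map⁺ (AllPairs.map f-mono T-dec)

  -- g T and T g are listed in the same order, so they differ unless g centralizes T.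
  translates : ∀ g T → Decreasing T → (∀ {t} → t ∈ T → Dec (Commute g t)) →
               (∃ λ t → t ∈ T × ¬ Commute g t) →
               ∃ λ L → Decreasing L × All (Translate g T) L × length L ≡ suc (length T)
  translates g (t ∷ T) (T<t ∷ T-dec) comm? (w , w∈T , gw) with comm? (here ≈-refl)
  ... | no gt with <-connex gt
  -- The larger of `g t` and `t g` lies above the whole translate that contains the smaller one.
  ... | inj₁ gt<tg =
    t ∙ g ∷ map (g ∙_) (t ∷ T) ,
    (gt<tg ∷ map-∈ T (λ u∈T → <-trans (∙-monoʳ-< g (lookup< T<t u∈T)) gt<tg)) ∷
      map-decreasing (∙-monoʳ-< g) (T<t ∷ T-dec) ,
    translateʳ (here ≈-refl) ∷ map-∈ (t ∷ T) translateˡ ,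
    ≡.cong suc (length-map _ (t ∷ T))
  ... | inj₂ tg<gt =
    g ∙ t ∷ map (_∙ g) (t ∷ T) ,
    (tg<gt ∷ map-∈ T (λ u∈T → <-trans (∙-monoˡ-< g (lookup< T<t u∈T)) tg<gt)) ∷
      map-decreasing (∙-monoˡ-< g) (T<t ∷ T-dec) ,
    translateˡ (here ≈-refl) ∷ map-∈ (t ∷ T) translateʳ ,
    ≡.cong suc (length-map _ (t ∷ T))
  translates g (t ∷ T) (T<t ∷ T-dec) comm? (w , w∈T , gw) | yes gt
    with translates g T T-dec (comm? ∘ there) (w , in-tail w∈T , gw)
    where
    in-tail : w ∈ t ∷ T → w ∈ T
    in-tail (here e) = ⊥-elim (gw (commute-resp (≈-sym e) gt))
    in-tail (there h) = h
  -- If the largest element commutes with `g`, the common value `g t` lies above both translates of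
  -- the rest.
  ... | L , L-dec , L⊆ , eq =
    g ∙ t ∷ L , All.map below L⊆ ∷ L-dec ,
    translateˡ (here ≈-refl) ∷ All.map Translate-there L⊆ , ≡.cong suc eq
    where
    below : ∀ {z} → Translate g T z → z < g ∙ t
    below (u , u∈T , inj₁ e) = ≈-<-trans e (∙-monoʳ-< g (lookup< T<t u∈T))
    below (u , u∈T , inj₂ e) =
      ≈-<-trans e (<-≈-trans (∙-monoˡ-< g (lookup< T<t u∈T)) (≈-sym gt))

  module CommutingPart {g T} (T-commuting : PairwiseCommuting T)
                       {w} (w∈T : w ∈ T) (gw : ¬ Commute g w) where

    -- The centralizer of `w` separates the three kinds of products: it contains `T²`, but no `g t`,
    -- no `t g` and not `g²`, since each of these would put `g` into it.
    Sq-commutes : ∀ {z} → Sq T z → Commute w z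
    Sq-commutes (x , y , x∈T , y∈T , e) =
      commute-resp (≈-sym e) (commute-∙ (T-commuting w∈T x∈T) (T-commuting w∈T y∈T))

    translate-noncommuting : ∀ {z} → Translate g T z → ¬ Commute w z
    translate-noncommuting (t , t∈T , inj₁ e) wz =
      gw (≈-sym (commute-cancelʳ (T-commuting w∈T t∈T) (commute-resp e wz)))
    translate-noncommuting (t , t∈T , inj₂ e) wz =
      gw (≈-sym (commute-cancelˡ (T-commuting w∈T t∈T) (commute-resp e wz)))

    Sq-≉-translate : ∀ {x y} → Sq T x → Translate g T y → x ≉ y
    Sq-≉-translate p q e = translate-noncommuting q (commute-resp e (Sq-commutes p))

    Sq-≉-square : ∀ {x y} → Sq T x → y ≈ g ∙ g → x ≉ y
    Sq-≉-square p q e = gw (≈-sym (square-commute (commute-resp (≈-trans e q) (Sq-commutes p))))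

    translate-≉-square : ∀ {x y} → Translate g T x → y ≈ g ∙ g → x ≉ y
    translate-≉-square (t , t∈T , inj₁ h) q e = gw (≈-sym (commute-resp
      (∙-cancelˡ g _ _ (≈-trans (≈-sym h) (≈-trans e q))) (T-commuting w∈T t∈T)))
    translate-≉-square (t , t∈T , inj₂ h) q e = gw (≈-sym (commute-resp
      (∙-cancelʳ g _ _ (≈-trans (≈-sym h) (≈-trans e q))) (T-commuting w∈T t∈T)))

    assemble : ∀ {C D} → Unique C → All (Sq T) C → Unique D → All (Translate g T) D →
               let L = C ++ D ++ g ∙ g ∷ [] in
               Unique L × All (Sq (g ∷ T)) L × length L ≡ length C ℕ.+ suc (length D)
    assemble {C} {D} uC pC uD pD =
      unique-++ {P = Sq T} {Q = λ z → Translate g T z ⊎ z ≈ g ∙ g}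
        (λ p → [ Sq-≉-translate p , Sq-≉-square p ]′) uC pC
        (unique-++ translate-≉-square uD pD ([] ∷ []) (≈-refl ∷ []))
        (Allₚ.++⁺ (All.map inj₁ pD) (inj₂ ≈-refl ∷ [])) ,
      Allₚ.++⁺ (All.map (Sq-⊆ there) pC)
        (Allₚ.++⁺ (All.map translate⊆ pD) (sq (here ≈-refl) (here ≈-refl) ∷ [])) ,
      ≡.trans (length-++ C) (≡.cong (length C ℕ.+_)
        (≡.trans (length-++ D) (ℕₚ.+-comm (length D) 1)))
      where
      translate⊆ : ∀ {z} → Translate g T z → Sq (g ∷ T) z
      translate⊆ (t , t∈T , inj₁ e) = Sq-resp (≈-sym e) (sq (here ≈-refl) (there t∈T))
      translate⊆ (t , t∈T , inj₂ e) = Sq-resp (≈-sym e) (sq (there t∈T) (here ≈-refl))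

  outlier : ∀ {g T} → PairwiseCommuting T → NonCommuting (g ∷ T) → ∃ λ t → t ∈ T × ¬ Commute g t
  outlier T-commuting (x , y , here e , here e′ , xy) =
    ⊥-elim (xy (≈-trans (∙-cong e e′) (∙-cong (≈-sym e′) (≈-sym e))))
  outlier T-commuting (x , y , here e , there y∈T , xy) =
    y , y∈T , λ gy → xy (≈-sym (commute-resp (≈-sym e) (≈-sym gy)))
  outlier T-commuting (x , y , there x∈T , here e , xy) =
    x , x∈T , λ gx → xy (commute-resp (≈-sym e) (≈-sym gx))
  outlier T-commuting (x , y , there x∈T , there y∈T , xy) = ⊥-elim (xy (T-commuting x∈T y∈T))

  -- The length is exact and written with `+ 2`, so that it can be substituted into later counts
  -- without truncated subtraction.
  lower-bound : ∀ S → Decreasing S → DecSq S → NonCommuting S →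
                ∃ λ L → Unique L × All (Sq S) L × length L ℕ.+ 2 ≡ 3 ℕ.* length S
  lower-bound (x ∷ []) _ _ noncomm with outlier (λ ()) noncomm
  ... | _ , () , _
  lower-bound (x ∷ t ∷ T′) dec@(_ ∷ T-dec) _≟_ noncomm
    with commuting? (t ∷ T′) (DecSq-⊆ there _≟_)
  ... | inj₁ T-noncomm
    with lower-bound (t ∷ T′) T-dec (DecSq-⊆ there _≟_) T-noncomm
       | Maximum.three-new x t T′ dec _≟_ noncomm
  ... | L , uL , L⊆ , eq | N , uN , N-new , eqN =
    N ++ L ,
    unique-++ (λ (_ , z∉) w∈ e → z∉ (Sq-resp (≈-sym e) w∈)) uN N-new uL L⊆ ,
    Allₚ.++⁺ (All.map proj₁ N-new) (All.map (Sq-⊆ there) L⊆) ,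
    (begin
      length (N ++ L) ℕ.+ 2           ≡⟨ ≡.cong (ℕ._+ 2) (length-++ N) ⟩
      length N ℕ.+ length L ℕ.+ 2     ≡⟨ ≡.cong (λ n → n ℕ.+ length L ℕ.+ 2) eqN ⟩
      3 ℕ.+ (length L ℕ.+ 2)          ≡⟨ ≡.cong (3 ℕ.+_) eq ⟩
      3 ℕ.+ 3 ℕ.* length (t ∷ T′)     ≡⟨ ℕₚ.*-suc 3 (length (t ∷ T′)) ⟨
      3 ℕ.* length (x ∷ t ∷ T′)       ∎)
    where open ≡.≡-Reasoning
  lower-bound (x ∷ t ∷ T′) dec@(_ ∷ T-dec) _≟_ noncomm | inj₂ T-comm
    with outlier T-comm noncomm
  ... | w , w∈T , xw
    with translates x (t ∷ T′) T-dec (λ u∈T → commute? _≟_ (here ≈-refl) (there u∈T)) (w , w∈T , xw)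
  ... | D , D-dec , D⊆ , eqD
    with CommutingPart.assemble T-comm w∈T xw
           (decreasing⇒unique (chain-decreasing (t ∷ T′) T-dec)) (chain-⊆ (t ∷ T′))
           (decreasing⇒unique D-dec) D⊆
  ... | uL , L⊆ , eqL = _ , uL , L⊆ ,
    (begin
      _ ℕ.+ 2                                              ≡⟨ ≡.cong (ℕ._+ 2) eqL ⟩
      length C ℕ.+ suc (length D) ℕ.+ 2                    ≡⟨ ≡.cong (λ n → length C ℕ.+ suc n ℕ.+ 2) eqD ⟩
      length C ℕ.+ suc (suc m) ℕ.+ 2                       ≡⟨ arith (length C) m ⟩
      suc (length C) ℕ.+ m ℕ.+ 3                           ≡⟨ ≡.cong (λ n → n ℕ.+ m ℕ.+ 3) (length-chain t T′) ⟩
      2 ℕ.* m ℕ.+ m ℕ.+ 3                                  ≡⟨ arith′ m ⟩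
      3 ℕ.* suc m                                          ∎)
    where
    open ≡.≡-Reasoning
    C = chain (t ∷ T′)
    m = length (t ∷ T′)
    arith : ∀ p m → p ℕ.+ suc (suc m) ℕ.+ 2 ≡ suc p ℕ.+ m ℕ.+ 3
    arith = solve-∀
    arith′ : ∀ m → 2 ℕ.* m ℕ.+ m ℕ.+ 3 ≡ 3 ℕ.* suc m
    arith′ = solve-∀

-- Descent from larger sets to four elements.

module Descent {c ℓ ℓ₂ : Level} (G : OrderedGroup c ℓ ℓ₂) where
  open OrderedGroupProperties G
  open Commutation G
  open Squares G
  open LowerBound G

  -- Only the upper half of `|S²| = 3|S| − 2` is carried along; for non-commuting sets `lower-bound`
  -- supplies the other half.
  Small : List Carrier → Set (c ⊔ ℓ)
  Small S = ∀ L → Unique L → All (Sq S) L → length L ℕ.+ 2 ℕ.≤ 3 ℕ.* length S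

  Young-resp : ∀ {p q} {H : Carrier → Set p} {K : Carrier → Set q} →
               (∀ {x} → H x → K x) → (∀ {x} → K x → H x) → Young H → Young K
  Young-resp {H = H} {K} H⊆K K⊆H = λ where
      (inj₁ (a , b , h , r)) → inj₁ (a , b , conv h , r)
      (inj₂ (inj₁ (a , b , d , (h , p) , r))) → inj₂ (inj₁ (a , b , d , (conv h , p) , r))
      (inj₂ (inj₂ (inj₁ (a , b , h , r)))) → inj₂ (inj₂ (inj₁ (a , b , conv h , r)))
      (inj₂ (inj₂ (inj₂ (a , b , h , r)))) → inj₂ (inj₂ (inj₂ (a , b , conv h , r)))
    where
    conv : ∀ {q′} {Q : Carrier → Set q′} → H ≐ Q → K ≐ Q
    conv (f , g) = (λ x k → f x (K⊆H k)) , (λ x q → H⊆K (g x q))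

  YoungSpan : List Carrier → Set (c ⊔ ℓ)
  YoungSpan S = Young ⟨ Elem S ⟩

  YoungSpan-⊆ : ∀ {S T} → T ⊆ S → (∀ {x} → x ∈ S → ⟨ Elem T ⟩ x) → YoungSpan T → YoungSpan S
  YoungSpan-⊆ T⊆S S⊆⟨T⟩ = Young-resp (⟨⟩-minimal (λ h → gen (T⊆S h))) (⟨⟩-minimal S⊆⟨T⟩)

  ⟨Sq⟩ : ∀ {T z} → Sq T z → ⟨ Elem T ⟩ z
  ⟨Sq⟩ (x , y , x∈T , y∈T , e) = resp (≈-sym e) (mul (gen x∈T) (gen y∈T))

  ⟨⟩-cancelˡ : ∀ {p} {P : Carrier → Set p} {x y} → ⟨ P ⟩ x → ⟨ P ⟩ (x ∙ y) → ⟨ P ⟩ y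
  ⟨⟩-cancelˡ {x = x} {y} x∈ xy∈ = resp (≈-trans (≈-sym (assoc _ _ _))
    (≈-trans (∙-congʳ (inverseˡ x)) (identityˡ y))) (mul (inv x∈) xy∈)

  ⟨⟩-cancelʳ : ∀ {p} {P : Carrier → Set p} {x y} → ⟨ P ⟩ (x ∙ y) → ⟨ P ⟩ y → ⟨ P ⟩ x
  ⟨⟩-cancelʳ {x = x} {y} xy y∈ =
    resp (≈-trans (assoc _ _ _) (≈-trans (∙-congˡ (inverseʳ y)) (identityʳ x))) (mul xy (inv y∈))

  three-new⇒small : ∀ {S T} → (∃ λ N → Unique N × All (λ z → Sq S z × ¬ Sq T z) N × length N ≡ 3) →
                    T ⊆ S → length S ≡ suc (length T) → Small S → Small T
  three-new⇒small {S} {T} (N , uN , N-new , eqN) T⊆S eqS small L uL L⊆ =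
    ℕₚ.+-cancelˡ-≤ 3 _ _ (begin
      3 ℕ.+ (length L ℕ.+ 2)          ≡⟨ ≡.cong (λ n → n ℕ.+ length L ℕ.+ 2) eqN ⟨
      length N ℕ.+ length L ℕ.+ 2     ≡⟨ ≡.cong (ℕ._+ 2) (length-++ N) ⟨
      length (N ++ L) ℕ.+ 2           ≤⟨ small (N ++ L)
                                          (unique-++ (λ (_ , z∉) w∈ e → z∉ (Sq-resp (≈-sym e) w∈)) uN N-new uL L⊆)
                                          (Allₚ.++⁺ (All.map proj₁ N-new) (All.map (Sq-⊆ T⊆S) L⊆)) ⟩
      3 ℕ.* length S                  ≡⟨ ≡.cong (3 ℕ.*_) eqS ⟩
      3 ℕ.* suc (length T)            ≡⟨ ℕₚ.*-suc 3 _ ⟩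
      3 ℕ.+ 3 ℕ.* length T            ∎)
    where open ℕₚ.≤-Reasoning

  -- A non-commuting `T` already uses `3|T| − 2` of the products allowed for `x ∷ T`, which leaves
  -- room for three.
  few-new : ∀ {x T} → Decreasing T → DecSq T → NonCommuting T → Small (x ∷ T) →
            ∀ N → Unique N → All (λ z → Sq (x ∷ T) z × ¬ Sq T z) N → length N ℕ.≤ 3
  few-new {x} {T} T-dec _≟_ noncomm small N uN N-new with lower-bound T T-dec _≟_ noncomm
  ... | L , uL , L⊆ , eqL =
    ℕₚ.+-cancelʳ-≤ (3 ℕ.* length T) _ _ (begin
      length N ℕ.+ 3 ℕ.* length T         ≡⟨ ≡.cong (length N ℕ.+_) eqL ⟨
      length N ℕ.+ (length L ℕ.+ 2)       ≡⟨ ℕₚ.+-assoc (length N) _ 2 ⟨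
      length N ℕ.+ length L ℕ.+ 2         ≡⟨ ≡.cong (ℕ._+ 2) (length-++ N) ⟨
      length (N ++ L) ℕ.+ 2               ≤⟨ small (N ++ L)
                                              (unique-++ (λ (_ , z∉) w∈ e → z∉ (Sq-resp (≈-sym e) w∈)) uN N-new uL L⊆)
                                              (Allₚ.++⁺ (All.map proj₁ N-new) (All.map (Sq-⊆ there) L⊆)) ⟩
      3 ℕ.* suc (length T)                ≡⟨ ℕₚ.*-suc 3 _ ⟩
      3 ℕ.+ 3 ℕ.* length T                ∎)
    where open ℕₚ.≤-Reasoning

  -- Otherwise T² has at least 2 |T| elements, one too many.
  top-progression : ∀ {x t u v R} → let T = t ∷ u ∷ v ∷ R in
                    Decreasing T → DecSq (x ∷ T) → Small (x ∷ T) → PairwiseCommuting T →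
                    (∃ λ w → w ∈ T × ¬ Commute x w) → t ∙ v ≈ u ∙ u
  top-progression {x} {t} {u} {v} {R} T-dec@((u<t ∷ v<t ∷ _) ∷ (v<u ∷ _) ∷ R-dec) _≟_ small T-comm (w , w∈T , xw) =
    decidable-stable ((there (here ≈-refl) ≟ there (there (there (here ≈-refl))))
             (there (there (here ≈-refl))) (there (there (here ≈-refl)))) contra
    where
    T = t ∷ u ∷ v ∷ R
    t∈ : t ∈ T
    t∈ = here ≈-refl
    u∈ : u ∈ T
    u∈ = there (here ≈-refl)
    v∈ : v ∈ T
    v∈ = there (there (here ≈-refl))
    E = chain (v ∷ R)

    -- `y` and `z` are `t v` and `u²` in whichever order they stand: both fit between `t u` and
    -- `u v`, where `chain` has only `u²`.
    long : ∀ {y z} → y < t ∙ u → z < y → u ∙ v < z → Sq T y → Sq T z → ⊥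
    long {y} {z} y<tu z<y uv<z y∈ z∈
      with translates x T T-dec (λ h → commute? _≟_ (here ≈-refl) (there h)) (w , w∈T , xw)
    ... | D , D-dec , D⊆ , eqD
      with CommutingPart.assemble {g = x} T-comm w∈T xw (decreasing⇒unique C-dec) C⊆ (decreasing⇒unique D-dec) D⊆
      where
      below : ∀ {b} → u ∙ v < b → All (_< b) E
      below uv<b = All.map (λ h → <-trans (≤-<-trans h (∙-monoˡ-< v v<u)) uv<b) (chain-≤ v R R-dec)
      uv<y = <-trans uv<z z<y
      uv<tu = <-trans uv<y y<tu
      C-dec : Decreasing (t ∙ t ∷ t ∙ u ∷ y ∷ z ∷ u ∙ v ∷ E)
      C-dec =
        (∙-monoʳ-< t u<t ∷ <-trans y<tu tu<tt ∷ <-trans (<-trans z<y y<tu) tu<tt ∷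
          <-trans uv<tu tu<tt ∷ below (<-trans uv<tu tu<tt)) ∷
        (y<tu ∷ <-trans z<y y<tu ∷ uv<tu ∷ below uv<tu) ∷
        (z<y ∷ uv<y ∷ below uv<y) ∷
        (uv<z ∷ below uv<z) ∷
        All.map (λ h → ≤-<-trans h (∙-monoˡ-< v v<u)) (chain-≤ v R R-dec) ∷
        chain-decreasing (v ∷ R) R-dec
        where tu<tt = ∙-monoʳ-< t u<t
      C⊆ : All (Sq T) (t ∙ t ∷ t ∙ u ∷ y ∷ z ∷ u ∙ v ∷ E)
      C⊆ = sq t∈ t∈ ∷ sq t∈ u∈ ∷ y∈ ∷ z∈ ∷ sq u∈ v∈ ∷
           All.map (Sq-⊆ (there ∘ there)) (chain-⊆ (v ∷ R))
    ... | uL , L⊆ , eqL = ℕₚ.1+n≰n (begin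
      suc (3 ℕ.* suc (length T))                       ≡⟨ arith (length (v ∷ R)) ⟨
      2 ℕ.* length (v ∷ R) ℕ.+ (3 ℕ.+ length (v ∷ R)) ℕ.+ 7
        ≡⟨ ≡.cong (λ n → n ℕ.+ (3 ℕ.+ length (v ∷ R)) ℕ.+ 7) (length-chain v R) ⟨
      suc (length E) ℕ.+ (3 ℕ.+ length (v ∷ R)) ℕ.+ 7  ≡⟨ ≡.cong (λ n → suc (length E) ℕ.+ n ℕ.+ 7) eqD ⟨
      suc (length E) ℕ.+ length D ℕ.+ 7                ≡⟨ arith′ (length E) (length D) ⟩
      5 ℕ.+ length E ℕ.+ suc (length D) ℕ.+ 2          ≡⟨ ≡.cong (ℕ._+ 2) eqL ⟨
      _                                                ≤⟨ small _ uL L⊆ ⟩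
      3 ℕ.* suc (length T)                             ∎)
      where
      open ℕₚ.≤-Reasoning
      arith : ∀ n → 2 ℕ.* n ℕ.+ (3 ℕ.+ n) ℕ.+ 7 ≡ suc (3 ℕ.* (3 ℕ.+ n))
      arith = solve-∀
      arith′ : ∀ p q → suc p ℕ.+ q ℕ.+ 7 ≡ 5 ℕ.+ p ℕ.+ suc q ℕ.+ 2
      arith′ = solve-∀

    contra : ¬ ¬ (t ∙ v ≈ u ∙ u)
    contra tv≉uu with <-connex tv≉uu
    ... | inj₁ tv<uu = long (∙-monoˡ-< u u<t) tv<uu (∙-monoˡ-< v u<t) (sq u∈ u∈) (sq t∈ v∈)
    ... | inj₂ uu<tv = long (∙-monoʳ-< t v<u) uu<tv (∙-monoʳ-< u v<u) (sq t∈ v∈) (sq u∈ u∈)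

  -- The three products are `t²`, `t u` and the larger of `x t` and `t x`. The first two exceed
  -- every product of `T⁻`, the third exceeds both translates of `T⁻` by `x`, and products of
  -- different kinds differ by `CommutingPart`.
  second-new : ∀ {x t u R} → let T = t ∷ u ∷ R ; T⁻ = u ∷ R in
               Decreasing T → DecSq (x ∷ T) → PairwiseCommuting T →
               (∃ λ w → w ∈ T × ¬ Commute x w) →
               ∃ λ N → Unique N × All (λ z → Sq (x ∷ T) z × ¬ Sq (x ∷ T⁻) z) N × length N ≡ 3
  second-new {x} {t} {u} {R} ((u<t ∷ R<t) ∷ R<u ∷ _) _≟_ T-comm (w , w∈T , xw) =
    result (big (commute? _≟_ (here ≈-refl) (there (here ≈-refl))))
    where
    T = t ∷ u ∷ R
    T⁻ = u ∷ R
    open CommutingPart {g = x} T-comm w∈T xw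

    below : ∀ {z} → z ∈ T⁻ → z < t
    below = lookup< (u<t ∷ R<t)

    ≤u : ∀ {z} → z ∈ T⁻ → z ≤ u
    ≤u (here e) = ≤-reflexive e
    ≤u (there h) = <⇒≤ (lookup< R<u h)

    split : ∀ {z} → Sq (x ∷ T⁻) z → Sq T⁻ z ⊎ Translate x T⁻ z ⊎ z ≈ x ∙ x
    split (p , q , here e , here e′ , h) = inj₂ (inj₂ (≈-trans h (∙-cong e e′)))
    split (p , q , here e , there q∈ , h) = inj₂ (inj₁ (q , q∈ , inj₁ (≈-trans h (∙-congʳ e))))
    split (p , q , there p∈ , here e , h) = inj₂ (inj₁ (p , p∈ , inj₂ (≈-trans h (∙-congˡ e))))
    split (p , q , there p∈ , there q∈ , h) = inj₁ (p , q , p∈ , q∈ , h)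

    Sq-new : ∀ {z} → Sq T z → (∀ {p q} → p ∈ T⁻ → q ∈ T⁻ → p ∙ q < z) →
             Sq (x ∷ T) z × ¬ Sq (x ∷ T⁻) z
    Sq-new z∈ above = Sq-⊆ there z∈ , λ h → case (split h)
      where
      case : _ → ⊥
      case (inj₁ (p , q , p∈ , q∈ , e)) = <⇒≉ (above p∈ q∈) (≈-sym e)
      case (inj₂ (inj₁ h)) = Sq-≉-translate z∈ (Translate-there h) ≈-refl
      case (inj₂ (inj₂ e)) = Sq-≉-square z∈ e ≈-refl

    Big : Carrier → Set _
    Big z = Translate x T z × x ∙ t ≤ z × t ∙ x ≤ z

    big : Dec (Commute x t) → ∃ Big
    big (yes xt) = x ∙ t , translateˡ (here ≈-refl) , ≤-refl , ≤-reflexive (≈-sym xt)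
    big (no xt) with <-connex xt
    ... | inj₁ lt = t ∙ x , translateʳ (here ≈-refl) , <⇒≤ lt , ≤-refl
    ... | inj₂ lt = x ∙ t , translateˡ (here ≈-refl) , ≤-refl , <⇒≤ lt

    big-new : ∀ {z} → Big z → Sq (x ∷ T) z × ¬ Sq (x ∷ T⁻) z
    big-new (z∈@(p , p∈ , e) , xt≤z , tx≤z) = member e , λ h → case (split h)
      where
      member : _ → Sq (x ∷ T) _
      member (inj₁ e) = Sq-resp (≈-sym e) (sq (here ≈-refl) (there p∈))
      member (inj₂ e) = Sq-resp (≈-sym e) (sq (there p∈) (here ≈-refl))
      case : _ → ⊥
      case (inj₁ h) = Sq-≉-translate (Sq-⊆ there h) z∈ ≈-refl
      case (inj₂ (inj₁ (q , q∈ , inj₁ e))) = >⇒≉ (<-≤-trans (∙-monoʳ-< x (below q∈)) xt≤z) e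
      case (inj₂ (inj₁ (q , q∈ , inj₂ e))) = >⇒≉ (<-≤-trans (∙-monoˡ-< x (below q∈)) tx≤z) e
      case (inj₂ (inj₂ e)) = translate-≉-square z∈ e ≈-refl

    result : ∃ Big → _
    result (z , z-big@(z∈ , _)) =
      t ∙ t ∷ t ∙ u ∷ z ∷ [] ,
      (>⇒≉ (∙-monoʳ-< t u<t) ∷ Sq-≉-translate tt∈ z∈ ∷ []) ∷ (Sq-≉-translate tu∈ z∈ ∷ []) ∷ [] ∷ [] ,
      Sq-new tt∈ (λ p q → ∙-mono-< (below p) (below q)) ∷
        Sq-new tu∈ (λ p q → ∙-mono-<-≤ (below p) (≤u q)) ∷ big-new z-big ∷ [] ,
      refl
      where
      tt∈ : Sq T (t ∙ t)
      tt∈ = sq (here ≈-refl) (here ≈-refl)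
      tu∈ : Sq T (t ∙ u)
      tu∈ = sq (here ≈-refl) (there (here ≈-refl))

  BaseCase : Set (c ⊔ ℓ ⊔ ℓ₂)
  BaseCase = ∀ {a b d e} → let S = e ∷ d ∷ b ∷ a ∷ [] in
             Decreasing S → DecSq S → Small S → NonCommuting S → YoungSpan S

  descent : BaseCase → ∀ n S → length S ≡ 4 ℕ.+ n →
            Decreasing S → DecSq S → Small S → NonCommuting S → YoungSpan S
  descent base zero (_ ∷ _ ∷ _ ∷ _ ∷ []) refl = base
  descent base (suc n) (x ∷ t ∷ u ∷ v ∷ R) eq S-dec@(T<x ∷ T-dec) _≟_ small noncomm
    with commuting? (t ∷ u ∷ v ∷ R) (DecSq-⊆ there _≟_)
  ... | inj₁ T-noncomm = YoungSpan-⊆ there S⊆⟨T⟩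
          (descent base n T (ℕₚ.suc-injective eq) T-dec (DecSq-⊆ there _≟_)
            (three-new⇒small (three-new noncomm) there refl small) T-noncomm)
    where
    T = t ∷ u ∷ v ∷ R
    open Maximum x t (u ∷ v ∷ R) S-dec _≟_ using (three-new; xx-new)
    u<t = All.head (AllPairs.head T-dec)
    v<t = All.head (All.tail (AllPairs.head T-dec))
    v<u = All.head (AllPairs.head (AllPairs.tail T-dec))
    v<x = All.head (All.tail (All.tail T<x))

    -- If no `x y` with `y` in `T` fell into `T²`, then `x²`, `x t`, `x u` and `x v` would be four
    -- new products.
    x∈⟨T⟩ : ⟨ Elem T ⟩ x
    x∈⟨T⟩ with search {P = λ y → Sq T (x ∙ y)} T (λ e → Sq-resp (∙-congˡ e))
                (λ y∈T → sq? T there _≟_ (here ≈-refl) (there y∈T))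
    ... | inj₁ (y , y∈T , h) = ⟨⟩-cancelʳ (⟨Sq⟩ h) (gen y∈T)
    ... | inj₂ none = ⊥-elim (ℕₚ.1+n≰n (few-new T-dec (DecSq-⊆ there _≟_) T-noncomm small
            (x ∙ x ∷ x ∙ t ∷ x ∙ u ∷ x ∙ v ∷ [])
            (decreasing⇒unique (map-decreasing (∙-monoʳ-< x) {x ∷ t ∷ u ∷ v ∷ []}
              ((All.head T<x ∷ All.head (All.tail T<x) ∷ v<x ∷ []) ∷
               (u<t ∷ v<t ∷ []) ∷ (v<u ∷ []) ∷ [] ∷ [])))
            (xx-new ∷ new (here ≈-refl) ∷ new (there (here ≈-refl)) ∷ new (there (there (here ≈-refl))) ∷ [])))
      where
      new : ∀ {y} → y ∈ T → Sq (x ∷ T) (x ∙ y) × ¬ Sq T (x ∙ y)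
      new y∈T = sq (here ≈-refl) (there y∈T) , none y∈T

    S⊆⟨T⟩ : ∀ {y} → y ∈ x ∷ T → ⟨ Elem T ⟩ y
    S⊆⟨T⟩ (here e) = resp (≈-sym e) x∈⟨T⟩
    S⊆⟨T⟩ (there h) = gen h
  ... | inj₂ T-comm = YoungSpan-⊆ S⁻⊆S S⊆⟨S⁻⟩
          (descent base n S⁻ (ℕₚ.suc-injective eq) (All.tail T<x ∷ AllPairs.tail T-dec)
            (DecSq-⊆ S⁻⊆S _≟_)
            (three-new⇒small (second-new T-dec _≟_ T-comm witness) S⁻⊆S refl small) S⁻-noncomm)
    where
    T = t ∷ u ∷ v ∷ R
    S⁻ = x ∷ u ∷ v ∷ R
    witness = outlier T-comm noncomm

    S⁻⊆S : S⁻ ⊆ (x ∷ T)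
    S⁻⊆S (here e) = here e
    S⁻⊆S (there h) = there (there h)

    tv≈uu : t ∙ v ≈ u ∙ u
    tv≈uu = top-progression T-dec _≟_ small T-comm witness

    S⊆⟨S⁻⟩ : ∀ {y} → y ∈ x ∷ T → ⟨ Elem S⁻ ⟩ y
    S⊆⟨S⁻⟩ (here e) = gen (here e)
    -- The progression recovers the removed element as `t = u² v⁻¹`.
    S⊆⟨S⁻⟩ (there (here e)) = resp (≈-sym e) (⟨⟩-cancelʳ
      (resp (≈-sym tv≈uu) (mul (gen (there (here ≈-refl))) (gen (there (here ≈-refl)))))
      (gen (there (there (here ≈-refl)))))
    S⊆⟨S⁻⟩ (there (there h)) = gen (there h)

    S⁻-noncomm : NonCommuting S⁻
    S⁻-noncomm with commuting? S⁻ (DecSq-⊆ S⁻⊆S _≟_)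
    ... | inj₁ h = h
    ... | inj₂ S⁻-comm = ⊥-elim (abelian noncomm)
      where
      abelian : ¬ NonCommuting (x ∷ T)
      abelian (y , z , y∈ , z∈ , yz) =
        yz (⟨⟩-abelian S⁻-comm y z (S⊆⟨S⁻⟩ y∈) (S⊆⟨S⁻⟩ z∈))

-- Relations that make a generated subgroup young.

module YoungCriteria {c ℓ ℓ₂ : Level} (G : OrderedGroup c ℓ ℓ₂) where
  open OrderedGroupProperties G
  open Commutation G

  private
    A B R : Expr 3
    A = var zero
    B = var (suc zero)
    R = var (suc (suc zero))

  ⟨⟩-mutual : ∀ {p} {P : Carrier → Set p} {a b} → ⟨ P ⟩ a → ⟨ P ⟩ b →
              (∀ {x} → P x → ⟨ a , b ⟩₂ x) → ⟨ P ⟩ ≐ ⟨ a , b ⟩₂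
  ⟨⟩-mutual a∈ b∈ P⊆ =
    (λ _ → ⟨⟩-minimal P⊆) ,
    (λ _ → ⟨⟩-minimal λ where
      (inj₁ e) → resp (≈-sym e) a∈
      (inj₂ e) → resp (≈-sym e) b∈)

  commutator-ε : ∀ {x y} → Commute x y → [ x , y ] ≈ ε
  commutator-ε {x} {y} xy = derive (x ∷ y ∷ []) (X ⁻ · Y ⁻ · X · Y) 𝟙
    ((X ⁻ · Y ⁻ , rule (X · Y) (Y · X) xy) ∷ []) refl
    where
    X Y : Expr 2
    X = var zero
    Y = var (suc zero)

  -- The first relation forces `r = [ a , b ]`. Keeping `r` as a variable lets it be the ratio of a
  -- progression.
  young-nilpotent : ∀ {p} {P : Carrier → Set p} {a b r} →
    ⟨ P ⟩ a → ⟨ P ⟩ b → (∀ {x} → P x → ⟨ a , b ⟩₂ x) →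
    a ∙ b ≈ b ∙ a ∙ r → Commute a r → Commute b r → Young ⟨ P ⟩
  young-nilpotent {a = a} {b} {r} a∈ b∈ P⊆ ab ar br =
    inj₁ (a , b , ⟨⟩-mutual a∈ b∈ P⊆ ,
          commutator-ε (≈-sym (commute-resp r≈[a,b] ar)) , commutator-ε (≈-sym (commute-resp r≈[a,b] br)))
    where
    r≈[a,b] : r ≈ [ a , b ]
    r≈[a,b] = ≈-sym (derive (a ∷ b ∷ r ∷ []) (A ⁻ · B ⁻ · A · B) R
      ((A ⁻ · B ⁻ , rule (A · B) (B · A · R) ab) ∷ []) refl)

  young-baumslag-solitar : ∀ {p} {P : Carrier → Set p} {a b} →
    ⟨ P ⟩ a → ⟨ P ⟩ b → (∀ {x} → P x → ⟨ a , b ⟩₂ x) →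
    a ∙ b ≈ b ∙ (a ∙ a) → ¬ a ≈ ε → Young ⟨ P ⟩
  young-baumslag-solitar {a = a} {b} a∈ b∈ P⊆ ab a≉ε =
    inj₂ (inj₂ (inj₁ (a , b , ⟨⟩-mutual a∈ b∈ P⊆ ,
      derive (a ∷ b ∷ ε ∷ []) (B ⁻ · A · B) (A · A)
        ((B ⁻ , rule (A · B) (B · (A · A)) ab) ∷ []) refl ,
      a≉ε)))

  -- With `a′ = a ^ b`, the first relation is `a ^ (b ²) = a′ a`. Given it, multiplying
  -- `a a′ = a′ a` by `b a b` on the left yields the second, so that one says that `a` and `a′`
  -- commute. Conjugation by `b` then follows the Fibonacci recurrence.
  young-fibonacci : ∀ {p} {P : Carrier → Set p} {a b} →
    ⟨ P ⟩ a → ⟨ P ⟩ b → (∀ {x} → P x → ⟨ a , b ⟩₂ x) →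
    a ∙ b ∙ b ≈ b ∙ a ∙ b ∙ a → a ∙ b ∙ (a ∙ b) ≈ b ∙ a ∙ (a ∙ b ∙ a) → ¬ a ≈ ε → Young ⟨ P ⟩
  young-fibonacci {a = a} {b} a∈ b∈ P⊆ recurrence h a≉ε =
    inj₂ (inj₂ (inj₂ (a , b , ⟨⟩-mutual a∈ b∈ P⊆ ,
      derive ρ ((B · B) ⁻ · A · (B · B)) (A · (B ⁻ · A · B))
        ((B ⁻ · B ⁻ , F) ∷ (B ⁻ · B ⁻ · B , commuting) ∷ []) refl ,
      commutator-ε (derive ρ (A · (B ⁻ · A · B)) ((B ⁻ · A · B) · A) ((𝟙 , conj) ∷ []) refl) ,
      a≉ε)))
    where
    ρ = a ∷ b ∷ ε ∷ []
    F : Rule ρ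
    F = rule (A · B · B) (B · A · B · A) recurrence
    conj : Rule ρ
    conj = rule (A · (B ⁻ · A · B)) ((B ⁻ · A · B) · A)
      (derive ρ (A · (B ⁻ · A · B)) ((B ⁻ · A · B) · A)
        (((B · A · B) ⁻ , F ʳ) ∷ ((B · A · B) ⁻ , rule (A · B · (A · B)) (B · A · (A · B · A)) h) ∷ []) refl)
    commuting : Rule ρ
    commuting = rule (A · B · A) (B · A · (B ⁻ · A · B))
      (derive ρ (A · B · A) (B · A · (B ⁻ · A · B)) ((B , conj ʳ) ∷ []) refl)

  -- The relation of the Baumslag-Solitar group BS(1, 2). The aim is that `⟨ g , r ⟩₂` has trivial
  -- centre, which gives the trivial intersection in the direct product of case (ii).
  module BaumslagSolitar {g r : Carrier} (rg : r ∙ g ≈ g ∙ (r ∙ r)) where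

    ⟨r⟩-commute : ∀ {u v} → ⟨ r ⟩₁ u → ⟨ r ⟩₁ v → Commute u v
    ⟨r⟩-commute {u} {v} u∈ v∈ =
      ⟨⟩-abelian (λ e e′ → ≈-trans (∙-cong e e′) (∙-cong (≈-sym e′) (≈-sym e))) u v u∈ v∈

    double : ∀ {u} → ⟨ r ⟩₁ u → u ∙ g ≈ g ∙ (u ∙ u)
    double (gen e) = ≈-trans (∙-congʳ e) (≈-trans rg (∙-congˡ (∙-cong (≈-sym e) (≈-sym e))))
    double one = ≈-trans (identityˡ g) (≈-sym (≈-trans (∙-congˡ (identityˡ ε)) (identityʳ g)))
    double (mul {x} {y} u v) = derive (x ∷ y ∷ g ∷ []) (A · B · R) (R · ((A · B) · (A · B)))
      ((A , rule (B · R) (R · (B · B)) (double v)) ∷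
       (𝟙 , rule (A · R) (R · (A · A)) (double u)) ∷
       (R · A , rule (A · B) (B · A) (⟨r⟩-commute u v)) ∷ []) refl
    double (inv {x} u) = derive (x ∷ g ∷ g ∷ []) (A ⁻ · B) (B · (A ⁻ · A ⁻))
      ((A ⁻ , rule (B · (A · A)) (A · B) (≈-sym (double u))) ∷ []) refl
    double (resp e u) = ≈-trans (∙-congʳ (≈-sym e)) (≈-trans (double u) (∙-congˡ (∙-cong e e)))

    pow : ℕ → Carrier
    pow zero = ε
    pow (suc n) = pow n ∙ g

    pow-+ : ∀ m n → pow (m ℕ.+ n) ≈ pow m ∙ pow n
    pow-+ m zero = ≈-trans (reflexive (≡.cong pow (ℕₚ.+-identityʳ m))) (≈-sym (identityʳ _))
    pow-+ m (suc n) = ≈-trans (reflexive (≡.cong pow (ℕₚ.+-suc m n)))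
      (≈-trans (∙-congʳ (pow-+ m n)) (assoc _ _ _))

    pow-double : ∀ n {u} → ⟨ r ⟩₁ u → ∃ λ v → ⟨ r ⟩₁ v × u ∙ pow n ≈ pow n ∙ v
    pow-double zero {u} u∈ = u , u∈ , commute-ε
    pow-double (suc n) {u} u∈ with pow-double n u∈
    ... | v , v∈ , h = v ∙ v , mul v∈ v∈ ,
      ≈-trans (≈-sym (assoc _ _ _)) (≈-trans (∙-congʳ h) (≈-trans (assoc _ _ _)
        (≈-trans (∙-congˡ (double v∈)) (≈-sym (assoc _ _ _)))))

    -- Either `r` or its inverse is a positive `s`. Conjugation by `g` squares the elements of
    -- `⟨ r ⟩₁`, so it moves `s` strictly upwards and no positive power of `g` can fix it.
    pow-noncommuting : ¬ r ≈ ε → ∀ n → ¬ Commute (pow (suc n)) r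
    pow-noncommuting r≉ε n comm = noncomm positive
      where
      positive : ∃ λ s → ⟨ r ⟩₁ s × ε < s
      positive with <-connex r≉ε
      ... | inj₁ r<ε = r ⁻¹ , inv (gen ≈-refl) ,
        ≈-<-trans (≈-sym (inverseˡ r)) (<-≈-trans (∙-monoʳ-< (r ⁻¹) r<ε) (identityʳ _))
      ... | inj₂ ε<r = r , gen ≈-refl , ε<r

      growth : ∀ n {s} → ⟨ r ⟩₁ s → ε < s → ∃ λ v → ⟨ r ⟩₁ v × s ≤ v × s ∙ pow n ≈ pow n ∙ v
      growth zero {s} s∈ _ = s , s∈ , ≤-refl , commute-ε
      growth (suc n) {s} s∈ ε<s with growth n s∈ ε<s
      ... | v , v∈ , s≤v , h = v ∙ v , mul v∈ v∈ ,
        ≤-trans (≤-reflexive (≈-sym (identityˡ s))) (∙-mono-≤ (≤-trans (<⇒≤ ε<s) s≤v) s≤v) ,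
        ≈-trans (≈-sym (assoc _ _ _)) (≈-trans (∙-congʳ h) (≈-trans (assoc _ _ _)
          (≈-trans (∙-congˡ (double v∈)) (≈-sym (assoc _ _ _)))))

      noncomm : (∃ λ s → ⟨ r ⟩₁ s × ε < s) → ⊥
      noncomm (s , s∈ , ε<s) with growth n s∈ ε<s
      ... | v , v∈ , s≤v , h = <⇒≉ s<vv (∙-cancelˡ (pow (suc n)) _ _ (begin-comm))
        where
        s<vv : s < v ∙ v
        s<vv = ≤-<-trans s≤v (≈-<-trans (≈-sym (identityˡ v)) (∙-monoˡ-< v (<-≤-trans ε<s s≤v)))
        begin-comm : pow (suc n) ∙ s ≈ pow (suc n) ∙ (v ∙ v)
        begin-comm = ≈-trans (⟨⟩-commute (λ e → commute-resp (≈-sym e) comm) s∈)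
          (≈-trans (≈-sym (assoc _ _ _)) (≈-trans (∙-congʳ h) (≈-trans (assoc _ _ _)
            (≈-trans (∙-congˡ (double v∈)) (≈-sym (assoc _ _ _))))))

    -- The normal form of an ascending HNN extension: positive powers of `g` can be moved to the
    -- left past `⟨ r ⟩₁`, negative ones to the right.
    NormalForm : Carrier → Set (c ⊔ ℓ)
    NormalForm x = ∃ λ i → ∃ λ j → ∃ λ u → ⟨ r ⟩₁ u × x ≈ pow i ∙ u ∙ pow j ⁻¹

    private
      module _ {i u j k v l w z : Carrier} where
        private
          ρ : Vec Carrier 8
          ρ = i ∷ u ∷ j ∷ k ∷ v ∷ l ∷ w ∷ z ∷ []
          I U J K V L W Z : Expr 8
          I = var (# 0)
          U = var (# 1)
          J = var (# 2)
          K = var (# 3)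
          V = var (# 4)
          L = var (# 5)
          W = var (# 6)
          Z = var (# 7)

        multiply-≤ : k ≈ j ∙ w → u ∙ w ≈ w ∙ z →
                     (i ∙ u ∙ j ⁻¹) ∙ (k ∙ v ∙ l ⁻¹) ≈ i ∙ w ∙ (z ∙ v) ∙ l ⁻¹
        multiply-≤ k≈jw uw≈wz = derive ρ
          ((I · U · J ⁻) · (K · V · L ⁻)) (I · W · (Z · V) · L ⁻)
          ((I · U · J ⁻ , rule K (J · W) k≈jw) ∷ (I , rule (U · W) (W · Z) uw≈wz) ∷ []) refl

        multiply-≥ : j ≈ k ∙ w → v ∙ w ≈ w ∙ z →
                     (i ∙ u ∙ j ⁻¹) ∙ (k ∙ v ∙ l ⁻¹) ≈ i ∙ (u ∙ z) ∙ (l ∙ w) ⁻¹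
        multiply-≥ j≈kw vw≈wz = derive ρ
          ((I · U · J ⁻) · (K · V · L ⁻)) (I · (U · Z) · (L · W) ⁻)
          ((I · U · J ⁻ , rule J (K · W) j≈kw ʳ) ∷ (I · U · W ⁻ , rule (V · W) (W · Z) vw≈wz) ∷ []) refl

    pow-∸ : ∀ {m n} → m ℕ.≤ n → pow n ≈ pow m ∙ pow (n ℕ.∸ m)
    pow-∸ {m} {n} m≤n =
      ≈-trans (reflexive (≡.cong pow (≡.sym (ℕₚ.m+[n∸m]≡n m≤n)))) (pow-+ m (n ℕ.∸ m))

    normalForm : ∀ {x} → ⟨ g , r ⟩₂ x → NormalForm x
    normalForm (gen (inj₁ e)) = 1 , 0 , ε , one , ≈-trans e (solve (g ∷ ε ∷ ε ∷ []) A ((𝟙 · A) · 𝟙 · 𝟙 ⁻) refl)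
    normalForm (gen (inj₂ e)) = 0 , 0 , r , gen ≈-refl , ≈-trans e (solve (r ∷ ε ∷ ε ∷ []) A (𝟙 · A · 𝟙 ⁻) refl)
    normalForm one = 0 , 0 , ε , one , solve (r ∷ ε ∷ ε ∷ []) 𝟙 (𝟙 · 𝟙 · 𝟙 ⁻) refl
    normalForm (inv x∈) with normalForm x∈
    ... | i , j , u , u∈ , e = j , i , u ⁻¹ , inv u∈ , ≈-trans (⁻¹-cong e)
      (solve (pow i ∷ u ∷ pow j ∷ []) ((A · B · R ⁻) ⁻) (R · B ⁻ · A ⁻) refl)
    normalForm (resp h x∈) with normalForm x∈
    ... | i , j , u , u∈ , e = i , j , u , u∈ , ≈-trans (≈-sym h) e
    normalForm (mul x∈ y∈) with normalForm x∈ | normalForm y∈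
    -- The inner factor `g^(k−j)` is moved left past `u` if its exponent is non-negative, and right
    -- past `v` otherwise.
    ... | i , j , u , u∈ , e | k , l , v , v∈ , f with ℕₚ.≤-total j k
    ... | inj₁ j≤k with pow-double (k ℕ.∸ j) u∈
    ... | z , z∈ , h = i ℕ.+ (k ℕ.∸ j) , l , z ∙ v , mul z∈ v∈ ,
      ≈-trans (∙-cong e f) (≈-trans (multiply-≤ (pow-∸ j≤k) h)
        (∙-congʳ (∙-congʳ (≈-sym (pow-+ i (k ℕ.∸ j))))))
    normalForm (mul x∈ y∈) | i , j , u , u∈ , e | k , l , v , v∈ , f | inj₂ k≤j
      with pow-double (j ℕ.∸ k) v∈
    ... | z , z∈ , h = i , l ℕ.+ (j ℕ.∸ k) , u ∙ z , mul u∈ z∈ ,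
      ≈-trans (∙-cong e f) (≈-trans (multiply-≥ (pow-∸ k≤j) h)
        (∙-congˡ (⁻¹-cong (≈-sym (pow-+ l (j ℕ.∸ k))))))

    commute-pow : ∀ {x} → Commute x g → ∀ n → Commute x (pow n)
    commute-pow xg zero = commute-ε
    commute-pow xg (suc n) = commute-∙ (commute-pow xg n) xg

    -- A central g^i u g^(-j) equals u g^(i-j); it commutes with r only if i = j, and with g only
    -- if moreover u = u².
    trivial-centre : ¬ r ≈ ε → ∀ {x} → ⟨ g , r ⟩₂ x → Commute x g → Commute x r → x ≈ ε
    trivial-centre r≉ε {x} x∈ xg xr with normalForm x∈
    ... | i , j , u , u∈ , e = [ smaller , larger ]′ (ℕₚ.≤-total i j)
      where
      module _ (d : ℕ) where
        ρ : Vec Carrier 5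
        ρ = x ∷ pow i ∷ pow j ∷ u ∷ pow d ∷ []
        X I J U W : Expr 5
        X = var (# 0)
        I = var (# 1)
        J = var (# 2)
        U = var (# 3)
        W = var (# 4)
        central : Rule ρ
        central = rule (X · I) (I · X) (commute-pow xg i)
        central′ : Rule ρ
        central′ = rule (X · J) (J · X) (commute-pow xg j)
        form : Rule ρ
        form = rule X (I · U · J ⁻) e

      ru : Commute r u
      ru = ⟨r⟩-commute (gen ≈-refl) u∈

      finish : ∀ d → Commute r (pow d) → (pow d ≈ ε → x ≈ u) → x ≈ ε
      finish zero _ x≈u = ≈-trans (x≈u ≈-refl) (∙-cancelˡ u _ _ (∙-cancelˡ g _ _ (≈-trans
        (≈-sym (double u∈)) (≈-trans (≈-sym (commute-resp (x≈u ≈-refl) (≈-sym xg)))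
          (∙-congˡ (≈-sym (identityʳ u)))))))
      finish (suc d) rd _ = ⊥-elim (pow-noncommuting r≉ε d (≈-sym rd))

      smaller : i ℕ.≤ j → x ≈ ε
      smaller i≤j = finish d (commute-cancelˡ (≈-sym xr) (commute-resp (≈-sym xw≈u) ru))
          (λ w≈ε → ≈-trans (≈-sym (≈-trans (∙-congˡ w≈ε) (identityʳ x))) xw≈u)
        where
        d = j ℕ.∸ i
        xw≈u : x ∙ pow d ≈ u
        xw≈u = derive (ρ d) (X d · W d) (U d)
          ((I d ⁻ , central d ʳ) ∷ (I d ⁻ , form d) ∷
           (U d · J d ⁻ , rule (J d) (I d · W d) (pow-∸ i≤j) ʳ) ∷ []) refl

      larger : j ℕ.≤ i → x ≈ ε
      larger j≤i = finish d (commute-cancelʳ ru (commute-resp x≈wu (≈-sym xr)))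
          (λ w≈ε → ≈-trans x≈wu (≈-trans (∙-congʳ w≈ε) (identityˡ u)))
        where
        d = i ℕ.∸ j
        x≈wu : x ≈ pow d ∙ u
        x≈wu = derive (ρ d) (X d) (W d · U d)
          ((J d ⁻ , central′ d ʳ) ∷ (J d ⁻ , form d) ∷
           (J d ⁻ , rule (I d) (J d · W d) (pow-∸ j≤i)) ∷ []) refl

  -- As `z` commutes with `g` and `r`, the intersection of `⟨ z ⟩₁` and `⟨ g , r ⟩₂` is central in
  -- the latter, hence trivial.
  young-product : ∀ {p} {P : Carrier → Set p} {z g r} →
    ⟨ P ⟩ z → ⟨ P ⟩ g → ⟨ P ⟩ r → (∀ {x} → P x → ⟨ (λ y → y ≈ z ⊎ y ≈ g ⊎ y ≈ r) ⟩ x) →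
    Commute z g → Commute z r → r ∙ g ≈ g ∙ (r ∙ r) → ¬ r ≈ ε → Young ⟨ P ⟩
  young-product {P = P} {z} {g} {r} z∈ g∈ r∈ P⊆ zg zr rg r≉ε =
    inj₂ (inj₁ (z , g , r ,
      (((λ _ → to ∘ ⟨⟩-minimal P⊆) , λ _ → from) ,
       (λ u v → commuting) ,
       λ x x∈⟨z⟩ x∈⟨g,r⟩ → BaumslagSolitar.trivial-centre rg r≉ε x∈⟨g,r⟩
         (commuting x∈⟨z⟩ (gen (inj₁ ≈-refl))) (commuting x∈⟨z⟩ (gen (inj₂ ≈-refl)))) ,
      inj₁ (derive (z ∷ g ∷ r ∷ []) (B ⁻ · R · B) (R · R) ((B ⁻ , rule (R · B) (B · (R · R)) rg) ∷ []) refl) ,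
      r≉ε))
    where
    Product : Carrier → Set _
    Product x = ∃ λ u → ∃ λ v → ⟨ z ⟩₁ u × ⟨ g , r ⟩₂ v × x ≈ u ∙ v

    commuting : ∀ {u v} → ⟨ z ⟩₁ u → ⟨ g , r ⟩₂ v → Commute u v
    commuting u∈ v∈ = ≈-sym (⟨⟩-commute (λ e → commute-resp (≈-sym e) (≈-sym (⟨⟩-commute
      (λ where
        (inj₁ h) → commute-resp (≈-sym h) zg
        (inj₂ h) → commute-resp (≈-sym h) zr) v∈))) u∈)

    to : ∀ {x} → ⟨ (λ y → y ≈ z ⊎ y ≈ g ⊎ y ≈ r) ⟩ x → Product x
    to (gen (inj₁ e)) = z , ε , gen ≈-refl , one , ≈-trans e (≈-sym (identityʳ z))
    to (gen (inj₂ (inj₁ e))) = ε , g , one , gen (inj₁ ≈-refl) , ≈-trans e (≈-sym (identityˡ g))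
    to (gen (inj₂ (inj₂ e))) = ε , r , one , gen (inj₂ ≈-refl) , ≈-trans e (≈-sym (identityˡ r))
    to one = ε , ε , one , one , ≈-sym (identityˡ ε)
    to (mul x∈ y∈) with to x∈ | to y∈
    ... | u , v , u∈ , v∈ , e | u′ , v′ , u′∈ , v′∈ , e′ =
      u ∙ u′ , v ∙ v′ , mul u∈ u′∈ , mul v∈ v′∈ , ≈-trans (∙-cong e e′)
        (derive (u ∷ v ∷ u′ ∷ v′ ∷ []) ((var (# 0) · var (# 1)) · (var (# 2) · var (# 3)))
          ((var (# 0) · var (# 2)) · (var (# 1) · var (# 3)))
          ((var (# 0) , rule (var (# 1) · var (# 2)) (var (# 2) · var (# 1)) (≈-sym (commuting u′∈ v∈))) ∷ []) refl)
    to (inv x∈) with to x∈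
    ... | u , v , u∈ , v∈ , e = u ⁻¹ , v ⁻¹ , inv u∈ , inv v∈ , ≈-trans (⁻¹-cong (≈-trans e (commuting u∈ v∈)))
      (solve (u ∷ v ∷ v ∷ []) ((B · A) ⁻) (A ⁻ · B ⁻) refl)
    to (resp h x∈) with to x∈
    ... | u , v , u∈ , v∈ , e = u , v , u∈ , v∈ , ≈-trans (≈-sym h) e

    from : ∀ {x} → Product x → ⟨ P ⟩ x
    from (u , v , u∈ , v∈ , e) = resp (≈-sym e) (mul
      (⟨⟩-minimal (λ h → resp (≈-sym h) z∈) u∈)
      (⟨⟩-minimal (λ { (inj₁ h) → resp (≈-sym h) g∈ ; (inj₂ h) → resp (≈-sym h) r∈ }) v∈))

-- Transfer from the opposite group.

module Opposite {c ℓ ℓ₂ : Level} (G : OrderedGroup c ℓ ℓ₂) where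
  open OrderedGroupProperties G
  open Commutation G
  open YoungCriteria G

  oppositeGroup : OrderedGroup c ℓ ℓ₂
  oppositeGroup = record
    { group = Op.group group
    ; _≤_ = _≤_
    ; isTotalOrder = isTotalOrder
    ; compatible = λ x y a≤b → ∙-monoʳ-≤ y (∙-monoˡ-≤ x a≤b)
    }

  private
    module O = GroupNotions (OrderedGroup.group oppositeGroup)

    A B Z : Expr 3
    A = var zero
    B = var (suc zero)
    Z = var (suc (suc zero))

  ⟨⟩-from-op : ∀ {p} {P : Carrier → Set p} {x} → O.⟨ P ⟩ x → ⟨ P ⟩ x
  ⟨⟩-from-op (O.gen h) = gen h
  ⟨⟩-from-op O.one = one
  ⟨⟩-from-op (O.mul x y) = mul (⟨⟩-from-op y) (⟨⟩-from-op x)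
  ⟨⟩-from-op (O.inv x) = inv (⟨⟩-from-op x)
  ⟨⟩-from-op (O.resp e x) = resp e (⟨⟩-from-op x)

  ⟨⟩-to-op : ∀ {p} {P : Carrier → Set p} {x} → ⟨ P ⟩ x → O.⟨ P ⟩ x
  ⟨⟩-to-op (gen h) = O.gen h
  ⟨⟩-to-op one = O.one
  ⟨⟩-to-op (mul x y) = O.mul (⟨⟩-to-op y) (⟨⟩-to-op x)
  ⟨⟩-to-op (inv x) = O.inv (⟨⟩-to-op x)
  ⟨⟩-to-op (resp e x) = O.resp e (⟨⟩-to-op x)

  private
    ≐-from-op : ∀ {p q} {P : Carrier → Set p} {Q : Carrier → Set q} →
                O.⟨ P ⟩ O.≐ O.⟨ Q ⟩ → ⟨ P ⟩ ≐ ⟨ Q ⟩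
    ≐-from-op (f , g) = (λ x h → ⟨⟩-from-op (f x (⟨⟩-to-op h))) , (λ x h → ⟨⟩-from-op (g x (⟨⟩-to-op h)))

    invert : ∀ {p} {P : Carrier → Set p} {a b} → P ≐ ⟨ a , b ⟩₂ → P ≐ ⟨ a , b ⁻¹ ⟩₂
    invert {b = b} (f , g) =
      (λ x h → ⟨⟩-minimal (λ where
        (inj₁ e) → gen (inj₁ e)
        (inj₂ e) → resp (≈-trans (⁻¹-involutive b) (≈-sym e)) (inv (gen (inj₂ ≈-refl)))) (f x h)) ,
      (λ x h → g x (⟨⟩-minimal (λ where
        (inj₁ e) → gen (inj₁ e)
        (inj₂ e) → resp (≈-sym e) (inv (gen (inj₂ ≈-refl)))) h))

  -- Conjugation by b in the opposite group is conjugation by b⁻¹.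
  Young-from-op : ∀ {p} {P : Carrier → Set p} → O.Young O.⟨ P ⟩ → Young ⟨ P ⟩
  Young-from-op (inj₁ (a , b , span , ka , kb)) =
    inj₁ (a , b , ≐-from-op span ,
      commutator-ε (≈-sym (central A aq)) , commutator-ε (≈-sym (central B bq)))
    where
    ρ = a ∷ b ∷ b ∷ []
    Q : Expr 3
    -- This is the commutator computed in the opposite group. Since it commutes with `a` and `b`,
    -- its inverse is `[ a , b ]`.
    Q = B · (A · (B ⁻ · A ⁻))
    q = ⟦ ρ ⟧ Q
    aq : Commute a q
    aq = derive ρ (A · Q) (Q · A) ((𝟙 , rule (A · (Q · (A ⁻ · Q ⁻))) 𝟙 ka) ∷ []) refl
    bq : Commute b q
    bq = derive ρ (B · Q) (Q · B) ((𝟙 , rule (B · (Q · (B ⁻ · Q ⁻))) 𝟙 kb) ∷ []) refl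
    [a,b]≈q⁻¹ : [ a , b ] ≈ q ⁻¹
    [a,b]≈q⁻¹ = derive ρ (A ⁻ · B ⁻ · A · B) (Q ⁻)
      (((Q · (B · A)) ⁻ , rule (Q · (B · A)) (B · A · Q) (commute-∙ (≈-sym bq) (≈-sym aq)) ʳ) ∷ []) refl
    central : ∀ E → Commute (⟦ ρ ⟧ E) q → Commute (⟦ ρ ⟧ E) [ a , b ]
    central E Eq = commute-resp (≈-sym [a,b]≈q⁻¹) (commute-⁻¹ Eq)
  Young-from-op (inj₂ (inj₁ (a , b , d , ((f , g) , comm , disjoint) , rel , d≉ε))) =
    inj₂ (inj₁ (a , b , d ,
      (((λ x h → let u , v , u∈ , v∈ , e = f x (⟨⟩-to-op h) in
           u , v , ⟨⟩-from-op u∈ , ⟨⟩-from-op v∈ , ≈-trans e (comm u v u∈ v∈)) ,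
        (λ { x (u , v , u∈ , v∈ , e) → ⟨⟩-from-op (g x (u , v , ⟨⟩-to-op u∈ , ⟨⟩-to-op v∈ ,
           ≈-trans e (≈-sym (comm u v (⟨⟩-to-op u∈) (⟨⟩-to-op v∈))))) })) ,
       (λ u v u∈ v∈ → ≈-sym (comm u v (⟨⟩-to-op u∈) (⟨⟩-to-op v∈))) ,
       (λ x x∈ x∈′ → disjoint x (⟨⟩-to-op x∈) (⟨⟩-to-op x∈′))) ,
      relation rel , d≉ε))
    where
    ρ = d ∷ b ∷ b ∷ []
    -- Here `b` is kept, and the two alternatives of case (ii) trade places.
    relation : _ → _
    relation (inj₁ h) = inj₂ (derive ρ (B ⁻ · (A · A) · B) A
      ((B ⁻ , rule (B · (A · B ⁻)) (A · A) h ʳ) ∷ []) refl)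
    relation (inj₂ h) = inj₁ (derive ρ (B ⁻ · A · B) (A · A)
      ((B ⁻ , rule (B · ((A · A) · B ⁻)) A h ʳ) ∷ []) refl)
  Young-from-op (inj₂ (inj₂ (inj₁ (a , b , span , rel , a≉ε)))) =
    inj₂ (inj₂ (inj₁ (a , b ⁻¹ , invert (≐-from-op span) ,
      derive (a ∷ b ∷ b ∷ []) ((B ⁻) ⁻ · A · B ⁻) (A · A) ((𝟙 , rule (B · (A · B ⁻)) (A · A) rel) ∷ []) refl ,
      a≉ε)))
  -- The product in the recurrence arrives with its factors swapped; the commutator relation
  -- restores their order.
  Young-from-op (inj₂ (inj₂ (inj₂ (a , b , span , rel , comm , a≉ε)))) =
    inj₂ (inj₂ (inj₂ (a , b ⁻¹ , invert (≐-from-op span) ,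
      derive ρ ((B ⁻ · B ⁻) ⁻ · A · (B ⁻ · B ⁻)) (A · ((B ⁻) ⁻ · A · B ⁻))
        ((𝟙 , rule (B · B · (A · (B · B) ⁻)) (C · A) rel) ∷ (𝟙 , rule (C · (A · (C ⁻ · A ⁻))) 𝟙 comm) ∷ []) refl ,
      derive ρ (A ⁻ · D ⁻ · A · D) 𝟙
        ((A ⁻ · C ⁻ , rule (C · (A · (C ⁻ · A ⁻))) 𝟙 comm ʳ) ∷ []) refl ,
      a≉ε)))
    where
    ρ = a ∷ b ∷ b ∷ []
    C D : Expr 3
    C = B · (A · B ⁻)
    D = (B ⁻) ⁻ · A · B ⁻

-- Four elements, three of which commute.

module CommutingTriple {c ℓ ℓ₂ : Level} (G : OrderedGroup c ℓ ℓ₂) where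
  open OrderedGroupProperties G
  open Commutation G
  open Squares G
  open LowerBound G
  open Descent G
  open YoungCriteria G

  module _ {g s q p : Carrier}
           (T-dec : Decreasing (s ∷ q ∷ p ∷ [])) (_≟_ : DecSq (g ∷ s ∷ q ∷ p ∷ []))
           (small : Small (g ∷ s ∷ q ∷ p ∷ [])) (T-comm : PairwiseCommuting (s ∷ q ∷ p ∷ []))
           (witness : ∃ λ w → w ∈ s ∷ q ∷ p ∷ [] × ¬ Commute g w) where

    private
      T S : List Carrier
      T = s ∷ q ∷ p ∷ []
      S = g ∷ T

      q<s = All.head (AllPairs.head T-dec)
      p<q = All.head (AllPairs.head (AllPairs.tail T-dec))

      g∈ : g ∈ S
      g∈ = here ≈-refl
      s∈ : s ∈ T
      s∈ = here ≈-refl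
      q∈ : q ∈ T
      q∈ = there (here ≈-refl)
      p∈ : p ∈ T
      p∈ = there (there (here ≈-refl))

      sp≈qq : s ∙ p ≈ q ∙ q
      sp≈qq = top-progression T-dec _≟_ small T-comm witness

      -- Of the ten products allowed, five are taken by `chain T` and one by `g²`. In the count, 8
      -- is these six plus the 2 from `Small`.
      few-translates : ∀ D → Unique D → All (Translate g T) D → length D ℕ.≤ 4
      few-translates D uD D⊆
        with CommutingPart.assemble T-comm (proj₁ (proj₂ witness)) (proj₂ (proj₂ witness))
               (decreasing⇒unique (chain-decreasing T T-dec)) (chain-⊆ T) uD D⊆
      ... | uL , L⊆ , eqL = ℕₚ.+-cancelˡ-≤ 8 _ _ (≡.subst (ℕ._≤ 12)
              (≡.trans (≡.cong (ℕ._+ 2) eqL) (≡.cong (6 ℕ.+_) (ℕₚ.+-comm (length D) 2))) (small _ uL L⊆))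

      five-translates : ∀ {u v w x y} → Unique (u ∷ v ∷ w ∷ x ∷ y ∷ []) →
                        ¬ All (Translate g T) (u ∷ v ∷ w ∷ x ∷ y ∷ [])
      five-translates uD D⊆ = ℕₚ.1+n≰n (few-translates _ uD D⊆)

      not-central : ¬ (Commute g p × Commute g q × Commute g s)
      not-central (gp , gq , gs) = proj₂ (proj₂ witness) (central (proj₁ (proj₂ witness)))
        where
        central : ∀ {w} → w ∈ T → Commute g w
        central (here e) = commute-resp (≈-sym e) gs
        central (there (here e)) = commute-resp (≈-sym e) gq
        central (there (there (here e))) = commute-resp (≈-sym e) gp

      module Endpoint {x y z} (x∈ : x ∈ T) (y∈ : y ∈ T) (z∈ : z ∈ T)
               (cover : ∀ {w} → w ∈ T → w ≈ x ⊎ w ≈ y ⊎ w ≈ z)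
               (x≉y : x ≉ y) (y≉z : y ≉ z) (x≉z : x ≉ z) (zx≈yy : z ∙ x ≈ y ∙ y)
               (not-central : ¬ (Commute g x × Commute g y × Commute g z))
               (gx : Commute g x) where
        r : Carrier
        r = x ⁻¹ ∙ y

        ρ : Vec Carrier 5
        ρ = g ∷ x ∷ y ∷ z ∷ r ∷ []
        Γ X Y Z R : Expr 5
        Γ = var (# 0)
        X = var (# 1)
        Y = var (# 2)
        Z = var (# 3)
        R = var (# 4)

        y≈xr : y ≈ x ∙ r
        y≈xr = solve ρ Y (X · (X ⁻ · Y)) refl

        xr : Commute x r
        xr = commute-cancelˡ ≈-refl (commute-resp y≈xr (T-comm x∈ y∈))

        z≈xrr : z ≈ x ∙ (r ∙ r)
        z≈xrr = derive ρ Z (X · (R · R))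
          ((𝟙 , rule (Z · X) (Y · Y) zx≈yy) ∷ (𝟙 , rule Y (X · R) y≈xr) ∷ (X · R , rule Y (X · R) y≈xr) ∷
           (X · R , rule (X · R) (R · X) xr) ∷ []) refl

        gy : ¬ Commute g y
        gy gy = not-central (gx , gy , commute-cancelʳ gx (commute-resp (≈-sym zx≈yy) (commute-∙ gy gy)))

        gz : ¬ Commute g z
        gz gz = gy (square-commute (commute-resp zx≈yy (commute-∙ gz gx)))

        r≉ε : ¬ r ≈ ε
        r≉ε e = x≉y (≈-sym (≈-trans y≈xr (≈-trans (∙-congˡ e) (identityʳ x))))

        generated : ∀ {h w} → ⟨ (λ y → y ≈ x ⊎ y ≈ h ⊎ y ≈ r) ⟩ g →
                    w ∈ S → ⟨ (λ y → y ≈ x ⊎ y ≈ h ⊎ y ≈ r) ⟩ w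
        generated g∈ (here e) = resp (≈-sym e) g∈
        generated g∈ (there w∈) with cover w∈
        ... | inj₁ e = gen (inj₁ e)
        ... | inj₂ (inj₁ e) = resp (≈-sym (≈-trans e y≈xr))
                (mul (gen (inj₁ ≈-refl)) (gen (inj₂ (inj₂ ≈-refl))))
        ... | inj₂ (inj₂ e) = resp (≈-sym (≈-trans e z≈xrr))
                (mul (gen (inj₁ ≈-refl)) (mul (gen (inj₂ (inj₂ ≈-refl))) (gen (inj₂ (inj₂ ≈-refl)))))

        r∈⟨S⟩ : ⟨ Elem S ⟩ r
        r∈⟨S⟩ = mul (inv (gen (there x∈))) (gen (there y∈))

        -- Among `g x = x g`, `g y`, `y g`, `g z`, `z g` two must coincide, and only `y g = g z` or
        -- `z g = g y` is possible. With `y = x r` and `z = x r²` this says that `g`, respectively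
        -- `g⁻¹`, conjugates `r` to `r²`.
        young : YoungSpan S
        young with (there y∈ ≟ g∈) g∈ (there z∈) | (there z∈ ≟ g∈) g∈ (there y∈)
        ... | yes yg≈gz | _ = young-product (gen (there x∈)) (gen g∈) r∈⟨S⟩
                (generated (gen (inj₂ (inj₁ ≈-refl)))) (≈-sym gx) xr
                (derive ρ (R · Γ) (Γ · (R · R))
                  ((X ⁻ , rule Y (X · R) y≈xr ʳ) ∷ (X ⁻ , rule (Y · Γ) (Γ · Z) yg≈gz) ∷
                   (X ⁻ · Γ , rule Z (X · (R · R)) z≈xrr) ∷ (X ⁻ , rule (Γ · X) (X · Γ) gx) ∷ []) refl)
                r≉ε
        ... | no _ | yes zg≈gy = young-product (gen (there x∈)) (inv (gen g∈)) r∈⟨S⟩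
                (generated (resp (⁻¹-involutive g) (inv (gen (inj₂ (inj₁ ≈-refl))))))
                (commute-⁻¹ (≈-sym gx)) xr
                (≈-sym (derive ρ (Γ ⁻ · (R · R)) (R · Γ ⁻)
                  ((Γ ⁻ · X ⁻ , rule Z (X · (R · R)) z≈xrr ʳ) ∷ (Γ ⁻ · X ⁻ , rule (Z · Γ) (Γ · Y) zg≈gy) ∷
                   (Γ ⁻ · X ⁻ · Γ , rule Y (X · R) y≈xr) ∷ (Γ ⁻ · X ⁻ , rule (Γ · X) (X · Γ) gx) ∷ []) refl))
                r≉ε
        ... | no yg≉gz | no zg≉gy = ⊥-elim (five-translates
                (((λ e → x≉y (∙-cancelˡ g _ _ e)) ∷ (λ e → x≉y (∙-cancelʳ g _ _ (≈-trans (≈-sym gx) e))) ∷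
                  (λ e → x≉z (∙-cancelˡ g _ _ e)) ∷ (λ e → x≉z (∙-cancelʳ g _ _ (≈-trans (≈-sym gx) e))) ∷ []) ∷
                 (gy ∷ (λ e → y≉z (∙-cancelˡ g _ _ e)) ∷ (λ e → zg≉gy (≈-sym e)) ∷ []) ∷
                 (yg≉gz ∷ (λ e → y≉z (∙-cancelʳ g _ _ e)) ∷ []) ∷
                 (gz ∷ []) ∷ [] ∷ [])
                (translateˡ x∈ ∷ translateˡ y∈ ∷ translateʳ y∈ ∷ translateˡ z∈ ∷ translateʳ z∈ ∷ []))

      -- Otherwise `g q` lies above `g p` and `p g` and below `g s` and `s g`. As `s p = q²`,
      -- neither `p` nor `s` would commute with `g`, so these are five translates.
      q-noncommuting : ¬ Commute g q
      q-noncommuting gq = five-translates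
          ((<⇒≉ gp<gq ∷ <⇒≉ (<-trans gp<gq gq<gs) ∷ gp ∷ <⇒≉ (<-trans gp<gq gq<sg) ∷ []) ∷
           (<⇒≉ gq<gs ∷ >⇒≉ pg<gq ∷ <⇒≉ gq<sg ∷ []) ∷
           (>⇒≉ (<-trans pg<gq gq<gs) ∷ gs ∷ []) ∷
           (<⇒≉ (<-trans pg<gq gq<sg) ∷ []) ∷ [] ∷ [])
          (translateˡ p∈ ∷ translateˡ q∈ ∷ translateˡ s∈ ∷ translateʳ p∈ ∷ translateʳ s∈ ∷ [])
        where
        gp<gq = ∙-monoʳ-< g p<q
        gq<gs = ∙-monoʳ-< g q<s
        pg<gq = <-≈-trans (∙-monoˡ-< g p<q) (≈-sym gq)
        gq<sg = ≈-<-trans gq (∙-monoˡ-< g q<s)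
        gp : ¬ Commute g p
        gp gp = not-central (gp , gq , commute-cancelʳ gp (commute-resp (≈-sym sp≈qq) (commute-∙ gq gq)))
        gs : ¬ Commute g s
        gs gs = not-central (commute-cancelˡ gs (commute-resp (≈-sym sp≈qq) (commute-∙ gq gq)) , gq , gs)

      -- Two increasing triples with at most four values, the first starting lower and without
      -- common values in equal positions, are shifts of each other.
      interleave : ∀ {x₁ x₂ x₃ y₁ y₂ y₃} → x₁ < x₂ → x₂ < x₃ → y₁ < y₂ → y₂ < y₃ → x₁ < y₁ →
                   x₂ ≉ y₂ → x₃ ≉ y₃ → Dec (x₂ ≈ y₁) → Dec (x₃ ≈ y₂) → Dec (x₂ ≈ y₃) →
                   All (Translate g T) (x₁ ∷ x₂ ∷ x₃ ∷ []) → All (Translate g T) (y₁ ∷ y₂ ∷ y₃ ∷ []) →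
                   x₂ ≈ y₁ × x₃ ≈ y₂
      interleave x₁<x₂ x₂<x₃ y₁<y₂ y₂<y₃ x₁<y₁ x₂≉y₂ x₃≉y₃ x₂≟y₁ x₃≟y₂ x₂≟y₃
                 (X₁ ∷ X₂ ∷ X₃ ∷ []) Ys@(Y₁ ∷ Y₂ ∷ Y₃ ∷ [])
        with x₂≟y₁ | x₃≟y₂ | x₂≟y₃
      ... | yes x₂≈y₁ | yes x₃≈y₂ | _ = x₂≈y₁ , x₃≈y₂
      ... | yes x₂≈y₁ | no x₃≉y₂ | _ = ⊥-elim (five-translates
          ((<⇒≉ (<-trans x₁<x₂ x₂<x₃) ∷ <⇒≉ x₁<y₁ ∷ <⇒≉ x₁<y₂ ∷ <⇒≉ (<-trans x₁<y₂ y₂<y₃) ∷ []) ∷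
           (>⇒≉ (≈-<-trans (≈-sym x₂≈y₁) x₂<x₃) ∷ x₃≉y₂ ∷ x₃≉y₃ ∷ []) ∷
           (<⇒≉ y₁<y₂ ∷ <⇒≉ (<-trans y₁<y₂ y₂<y₃) ∷ []) ∷ (<⇒≉ y₂<y₃ ∷ []) ∷ [] ∷ [])
          (X₁ ∷ X₃ ∷ Ys))
        where x₁<y₂ = <-trans x₁<y₁ y₁<y₂
      ... | no _ | _ | yes x₂≈y₃ = ⊥-elim (five-translates
          ((<⇒≉ x₁<y₁ ∷ <⇒≉ x₁<y₂ ∷ <⇒≉ (<-trans x₁<y₂ y₂<y₃) ∷ <⇒≉ (<-trans x₁<x₂ x₂<x₃) ∷ []) ∷
           (<⇒≉ y₁<y₂ ∷ <⇒≉ (<-trans y₁<y₂ y₂<y₃) ∷ <⇒≉ (<-trans (<-trans y₁<y₂ y₂<y₃) y₃<x₃) ∷ []) ∷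
           (<⇒≉ y₂<y₃ ∷ <⇒≉ (<-trans y₂<y₃ y₃<x₃) ∷ []) ∷ (<⇒≉ y₃<x₃ ∷ []) ∷ [] ∷ [])
          (X₁ ∷ Y₁ ∷ Y₂ ∷ Y₃ ∷ X₃ ∷ []))
        where
        x₁<y₂ = <-trans x₁<y₁ y₁<y₂
        y₃<x₃ = ≈-<-trans (≈-sym x₂≈y₃) x₂<x₃
      ... | no x₂≉y₁ | _ | no x₂≉y₃ = ⊥-elim (five-translates
          ((<⇒≉ x₁<x₂ ∷ <⇒≉ x₁<y₁ ∷ <⇒≉ x₁<y₂ ∷ <⇒≉ (<-trans x₁<y₂ y₂<y₃) ∷ []) ∷
           (x₂≉y₁ ∷ x₂≉y₂ ∷ x₂≉y₃ ∷ []) ∷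
           (<⇒≉ y₁<y₂ ∷ <⇒≉ (<-trans y₁<y₂ y₂<y₃) ∷ []) ∷ (<⇒≉ y₂<y₃ ∷ []) ∷ [] ∷ [])
          (X₁ ∷ X₂ ∷ Ys))
        where x₁<y₂ = <-trans x₁<y₁ y₁<y₂

    young-triple : YoungSpan S
    young-triple with commute? _≟_ g∈ (there p∈) | commute? _≟_ g∈ (there q∈) | commute? _≟_ g∈ (there s∈)
    ... | yes gp | _ | _ = Endpoint.young p∈ q∈ s∈ (λ where
            (here e) → inj₂ (inj₂ e)
            (there (here e)) → inj₂ (inj₁ e)
            (there (there (here e))) → inj₁ e)
          (<⇒≉ p<q) (<⇒≉ q<s) (<⇒≉ (<-trans p<q q<s)) sp≈qq not-central gp
    ... | no _ | yes gq | _ = ⊥-elim (q-noncommuting gq)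
    ... | no _ | no _ | yes gs = Endpoint.young s∈ q∈ p∈ (λ where
            (here e) → inj₁ e
            (there (here e)) → inj₂ (inj₁ e)
            (there (there (here e))) → inj₂ (inj₂ e))
          (>⇒≉ q<s) (>⇒≉ p<q) (>⇒≉ (<-trans p<q q<s)) (≈-trans (T-comm p∈ s∈) sp≈qq)
          (λ (x , y , z) → not-central (z , y , x)) gs
    ... | no gp | no gq | no gs = [ up , down ]′ (<-connex gp)
      where
      r : Carrier
      r = p ⁻¹ ∙ q
      ρ : Vec Carrier 5
      ρ = g ∷ p ∷ q ∷ s ∷ r ∷ []
      Γ P Q Z R : Expr 5
      Γ = var (# 0)
      P = var (# 1)
      Q = var (# 2)
      Z = var (# 3)
      R = var (# 4)

      q-rule : Rule ρ
      q-rule = rule Q (P · R) (solve ρ Q (P · (P ⁻ · Q)) refl)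
      pr : Commute p r
      pr = commute-cancelˡ ≈-refl (commute-resp (Rule.holds q-rule) (T-comm p∈ q∈))
      s-rule : Rule ρ
      s-rule = rule Z (P · (R · R)) (derive ρ Z (P · (R · R))
          ((𝟙 , rule (Z · P) (Q · Q) sp≈qq) ∷ (𝟙 , q-rule) ∷ (P · R , q-rule) ∷
           (P · R , rule (P · R) (R · P) pr) ∷ []) refl)

      r∈ : ∀ {a b} → r ≈ [ a , b ] → ⟨ a , b ⟩₂ r
      r∈ e = resp (≈-sym e) (mul (mul (mul (inv (gen (inj₁ ≈-refl))) (inv (gen (inj₂ ≈-refl))))
               (gen (inj₁ ≈-refl))) (gen (inj₂ ≈-refl)))

      generated : ∀ {a b} → ⟨ a , b ⟩₂ g → ⟨ a , b ⟩₂ p → ⟨ a , b ⟩₂ r → ∀ {w} → w ∈ S → ⟨ a , b ⟩₂ w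
      generated g∈ p∈ r∈ (here e) = resp (≈-sym e) g∈
      generated g∈ p∈ r∈ (there (here e)) =
        resp (≈-sym (≈-trans e (Rule.holds s-rule))) (mul p∈ (mul r∈ r∈))
      generated g∈ p∈ r∈ (there (there (here e))) =
        resp (≈-sym (≈-trans e (Rule.holds q-rule))) (mul p∈ r∈)
      generated g∈ p∈ r∈ (there (there (there (here e)))) = resp (≈-sym e) p∈

      gp<gq = ∙-monoʳ-< g p<q
      gq<gs = ∙-monoʳ-< g q<s
      pg<qg = ∙-monoˡ-< g p<q
      qg<sg = ∙-monoˡ-< g q<s
      gT : All (Translate g T) (g ∙ p ∷ g ∙ q ∷ g ∙ s ∷ [])
      gT = translateˡ p∈ ∷ translateˡ q∈ ∷ translateˡ s∈ ∷ []
      Tg : All (Translate g T) (p ∙ g ∷ q ∙ g ∷ s ∙ g ∷ [])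
      Tg = translateʳ p∈ ∷ translateʳ q∈ ∷ translateʳ s∈ ∷ []

      -- Here `g⁻¹ p g = q` and `g⁻¹ q g = s`, so conjugation by `g` multiplies `p` by `r` and fixes
      -- `r`. In `down` the same holds for `g⁻¹`.
      up : g ∙ p < p ∙ g → YoungSpan S
      up gp<pg with interleave gp<gq gq<gs pg<qg qg<sg gp<pg gq gs
                      ((g∈ ≟ there q∈) (there p∈) g∈) ((g∈ ≟ there s∈) (there q∈) g∈)
                      ((g∈ ≟ there q∈) (there s∈) g∈) gT Tg
      ... | gq≈pg , gs≈qg = young-nilpotent (gen (there p∈)) (gen g∈)
              (generated (gen (inj₂ ≈-refl)) (gen (inj₁ ≈-refl)) (r∈ (≈-sym (derive ρ (P ⁻ · Γ ⁻ · P · Γ) R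
                ((P ⁻ · Γ ⁻ , pg-rule) ∷ []) refl))))
              (Rule.holds pg-rule) pr
              (derive ρ (Γ · R) (R · Γ)
                ((P ⁻ , pg-rule) ∷ (P ⁻ · Γ , s-rule ʳ) ∷ (P ⁻ , rule (Γ · Z) (Q · Γ) gs≈qg) ∷
                 (P ⁻ , q-rule) ∷ []) refl)
        where
        pg-rule : Rule ρ
        pg-rule = rule (P · Γ) (Γ · P · R) (derive ρ (P · Γ) (Γ · P · R)
          ((𝟙 , rule (Γ · Q) (P · Γ) gq≈pg ʳ) ∷ (Γ , q-rule) ∷ []) refl)

      down : p ∙ g < g ∙ p → YoungSpan S
      down pg<gp with interleave pg<qg qg<sg gp<gq gq<gs pg<gp (gq ∘ ≈-sym) (gs ∘ ≈-sym)
                      ((there q∈ ≟ g∈) g∈ (there p∈)) ((there s∈ ≟ g∈) g∈ (there q∈))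
                      ((there q∈ ≟ g∈) g∈ (there s∈)) Tg gT
      ... | qg≈gp , sg≈gq = young-nilpotent (gen g∈) (gen (there p∈))
              (generated (gen (inj₁ ≈-refl)) (gen (inj₂ ≈-refl)) (r∈ (≈-sym (derive ρ (Γ ⁻ · P ⁻ · Γ · P) R
                ((Γ ⁻ · P ⁻ , gp-rule) ∷ []) refl))))
              (Rule.holds gp-rule) gr pr
        where
        qg-rule : Rule ρ
        qg-rule = rule (Q · Γ) (Γ · P) qg≈gp
        gr : Commute g r
        gr = derive ρ (Γ · R) (R · Γ)
          ((R ⁻ · P ⁻ , q-rule ʳ) ∷ (R ⁻ · P ⁻ , qg-rule) ∷ (R ⁻ · P ⁻ · Γ , q-rule ʳ) ∷
           (R ⁻ · P ⁻ , rule (Z · Γ) (Γ · Q) sg≈gq ʳ) ∷ (R ⁻ · P ⁻ , s-rule) ∷ []) refl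
        gp-rule : Rule ρ
        gp-rule = rule (Γ · P) (P · Γ · R) (derive ρ (Γ · P) (P · Γ · R)
          ((𝟙 , qg-rule ʳ) ∷ (𝟙 , q-rule) ∷ (P , rule (Γ · R) (R · Γ) gr ʳ) ∷ []) refl)

-- Four elements without a commuting triple: counting.

-- The hypotheses are closed under passing to the opposite group and under reversing the order, so
-- each fact proved from them can be reused in its mirrored forms.
record Quad {ℓ₀ ℓ ℓ₂ : Level} (G : OrderedGroup ℓ₀ ℓ ℓ₂) (a b c d : OrderedGroup.Carrier G) :
       Set (ℓ₀ ⊔ ℓ ⊔ ℓ₂) where
  open OrderedGroupProperties G
  open Squares G
  open Descent G
  field
    a<b   : a < b
    b<c   : b < c
    c<d   : c < d
    decSq : DecSq (d ∷ c ∷ b ∷ a ∷ [])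
    small : Small (d ∷ c ∷ b ∷ a ∷ [])
    abc   : ¬ (Commute a b × Commute a c × Commute b c)
    abd   : ¬ (Commute a b × Commute a d × Commute b d)
    acd   : ¬ (Commute a c × Commute a d × Commute c d)
    bcd   : ¬ (Commute b c × Commute b d × Commute c d)

module QuadFacts {ℓ₀ ℓ ℓ₂ : Level} (G : OrderedGroup ℓ₀ ℓ ℓ₂) {a b c d : OrderedGroup.Carrier G}
                 (quad : Quad G a b c d) where
  open OrderedGroupProperties G
  open Commutation G
  open Squares G
  open LowerBound G
  open Descent G
  open Quad quad public

  S T : List Carrier
  S = d ∷ c ∷ b ∷ a ∷ []
  T = c ∷ b ∷ a ∷ []

  a<c : a < c
  a<c = <-trans a<b b<c
  a<d : a < d
  a<d = <-trans a<c c<d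
  b<d : b < d
  b<d = <-trans b<c c<d

  S-dec : Decreasing S
  S-dec = (c<d ∷ b<d ∷ a<d ∷ []) ∷ (b<c ∷ a<c ∷ []) ∷ (a<b ∷ []) ∷ [] ∷ []

  d∈ : d ∈ S
  d∈ = here ≈-refl
  c∈ : c ∈ S
  c∈ = there (here ≈-refl)
  b∈ : b ∈ S
  b∈ = there (there (here ≈-refl))
  a∈ : a ∈ S
  a∈ = there (there (there (here ≈-refl)))

  T-noncommuting : NonCommuting T
  T-noncommuting with commuting? T (DecSq-⊆ there decSq)
  ... | inj₁ h = h
  ... | inj₂ h = ⊥-elim (abc (h (there (there (here ≈-refl))) (there (here ≈-refl)) ,
                              h (there (there (here ≈-refl))) (here ≈-refl) ,
                              h (there (here ≈-refl)) (here ≈-refl)))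

  T-small : Small T
  T-small = three-new⇒small (Maximum.three-new d c (b ∷ a ∷ []) S-dec decSq
    (let x , y , x∈ , y∈ , h = T-noncommuting in x , y , there x∈ , there y∈ , h)) there refl small

  -- Ten products are allowed and at least seven lie in `T²`, so at most three lie outside.
  -- `eight-in-T²` is the matching bound inside.
  four-new : ∀ {w x y z} → Unique (w ∷ x ∷ y ∷ z ∷ []) →
             ¬ All (λ u → Sq S u × ¬ Sq T u) (w ∷ x ∷ y ∷ z ∷ [])
  four-new u new = ℕₚ.1+n≰n (few-new (AllPairs.tail S-dec) (DecSq-⊆ there decSq) T-noncommuting small _ u new)

  eight-in-T² : ∀ {s t u v w x y z} → Unique (s ∷ t ∷ u ∷ v ∷ w ∷ x ∷ y ∷ z ∷ []) →
                ¬ All (Sq T) (s ∷ t ∷ u ∷ v ∷ w ∷ x ∷ y ∷ z ∷ [])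
  eight-in-T² u ⊆T = ℕₚ.1+n≰n (T-small _ u ⊆T)

  -- The arguments are listed in the order aa, ab, ac, ba, bb, bc, ca, cb, cc.
  T²-elim : ∀ {p} {A : Set p} {z} → Sq T z →
            (z ≈ a ∙ a → A) → (z ≈ a ∙ b → A) → (z ≈ a ∙ c → A) →
            (z ≈ b ∙ a → A) → (z ≈ b ∙ b → A) → (z ≈ b ∙ c → A) →
            (z ≈ c ∙ a → A) → (z ≈ c ∙ b → A) → (z ≈ c ∙ c → A) → A
  T²-elim (x , y , x∈ , y∈ , e) aa ab ac ba bb bc ca cb cc = go x∈ y∈
    where
    go : _ → _ → _
    go (here p) (here q) = cc (≈-trans e (∙-cong p q))
    go (here p) (there (here q)) = cb (≈-trans e (∙-cong p q))
    go (here p) (there (there (here q))) = ca (≈-trans e (∙-cong p q))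
    go (there (here p)) (here q) = bc (≈-trans e (∙-cong p q))
    go (there (here p)) (there (here q)) = bb (≈-trans e (∙-cong p q))
    go (there (here p)) (there (there (here q))) = ba (≈-trans e (∙-cong p q))
    go (there (there (here p))) (here q) = ac (≈-trans e (∙-cong p q))
    go (there (there (here p))) (there (here q)) = ab (≈-trans e (∙-cong p q))
    go (there (there (here p))) (there (there (here q))) = aa (≈-trans e (∙-cong p q))

  T≤c : ∀ {x} → x ∈ T → x ≤ c
  T≤c (here e) = ≤-reflexive e
  T≤c (there h) = <⇒≤ (lookup< (b<c ∷ a<c ∷ []) h)

  above-cc : ∀ {z} → c ∙ c < z → ¬ Sq T z
  above-cc cc<z (x , y , x∈ , y∈ , e) =
    <⇒≉ (≤-<-trans (∙-mono-≤ (T≤c x∈) (T≤c y∈)) cc<z) (≈-sym e)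

  cc<cd : c ∙ c < c ∙ d
  cc<cd = ∙-monoʳ-< c c<d
  cc<dc : c ∙ c < d ∙ c
  cc<dc = ∙-monoˡ-< c c<d
  cd<dd : c ∙ d < d ∙ d
  cd<dd = ∙-monoˡ-< d c<d
  dc<dd : d ∙ c < d ∙ d
  dc<dd = ∙-monoʳ-< d c<d
  ad<bd : a ∙ d < b ∙ d
  ad<bd = ∙-monoˡ-< d a<b
  bd<cd : b ∙ d < c ∙ d
  bd<cd = ∙-monoˡ-< d b<c
  db<dc : d ∙ b < d ∙ c
  db<dc = ∙-monoʳ-< d b<c

  cd-new : Sq S (c ∙ d) × ¬ Sq T (c ∙ d)
  cd-new = sq c∈ d∈ , above-cc cc<cd
  dc-new : Sq S (d ∙ c) × ¬ Sq T (d ∙ c)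
  dc-new = sq d∈ c∈ , above-cc cc<dc
  dd-new : Sq S (d ∙ d) × ¬ Sq T (d ∙ d)
  dd-new = sq d∈ d∈ , above-cc (<-trans cc<cd cd<dd)

  -- The three new products are already `d²`, `c d` and `d c`, and `b d` is smaller than the first
  -- two.
  bd≈dc : ¬ Commute c d → ¬ Sq T (b ∙ d) → b ∙ d ≈ d ∙ c
  bd≈dc cd bd∉ = decidable-stable (decSq b∈ d∈ d∈ c∈) λ h → four-new
    ((>⇒≉ cd<dd ∷ >⇒≉ dc<dd ∷ >⇒≉ (<-trans bd<cd cd<dd) ∷ []) ∷
     (cd ∷ >⇒≉ bd<cd ∷ []) ∷ ((λ e → h (≈-sym e)) ∷ []) ∷ [] ∷ [])
    (dd-new ∷ cd-new ∷ dc-new ∷ (sq b∈ d∈ , bd∉) ∷ [])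

  private
    -- A new `a d` would have to be `d c`. Then `b d > d c > c²` would be new as well and equal to
    -- `d c` by `bd≈dc`.
    cd-noncommuting⇒ad∈T² : ¬ Commute c d → Sq T (a ∙ d)
    cd-noncommuting⇒ad∈T² cd = decidable-stable (sq? T there decSq a∈ d∈) contra
      where
      contra : ¬ ¬ Sq T (a ∙ d)
      contra ad∉ with decSq a∈ d∈ d∈ c∈
      ... | no ad≉dc = four-new
        ((>⇒≉ cd<dd ∷ >⇒≉ dc<dd ∷ >⇒≉ (<-trans ad<bd (<-trans bd<cd cd<dd)) ∷ []) ∷
         (cd ∷ >⇒≉ (<-trans ad<bd bd<cd) ∷ []) ∷ ((λ e → ad≉dc (≈-sym e)) ∷ []) ∷ [] ∷ [])
        (dd-new ∷ cd-new ∷ dc-new ∷ (sq a∈ d∈ , ad∉) ∷ [])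
      ... | yes ad≈dc = <⇒≉ dc<bd (≈-sym (bd≈dc cd (above-cc (<-trans cc<dc dc<bd))))
        where
        dc<bd : d ∙ c < b ∙ d
        dc<bd = ≈-<-trans (≈-sym ad≈dc) ad<bd

    -- The larger of `b d` and `d b` exceeds every product of `T` except possibly `c²`; equality
    -- with `c²` would make `b` commute with `c`. This replaces the new product that is lost when
    -- `c d = d c`.
    bd-or-db : Commute c d → ¬ Commute b c → ∃ λ z → (Sq S z × ¬ Sq T z) × b ∙ d ≤ z × z < c ∙ d
    bd-or-db cd bc = [ larger-db , larger-bd ]′ (total (b ∙ d) (d ∙ b))
      where
      cc : ∀ {z} → z ≈ c ∙ c → Commute c z
      cc e = commute-resp (≈-sym e) (commute-∙ ≈-refl ≈-refl)

      larger-db : b ∙ d ≤ d ∙ b → _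
      larger-db bd≤db = d ∙ b , (sq d∈ b∈ , λ h → T²-elim h
          (>⇒≉ (∙-mono-< a<d a<b)) (>⇒≉ (∙-monoˡ-< b a<d)) (>⇒≉ (<-≤-trans (∙-mono-< a<b c<d) bd≤db))
          (>⇒≉ (∙-mono-< b<d a<b)) (>⇒≉ (∙-monoˡ-< b b<d)) (>⇒≉ (<-≤-trans (∙-monoʳ-< b c<d) bd≤db))
          (>⇒≉ (∙-mono-< c<d a<b)) (>⇒≉ (∙-monoˡ-< b c<d))
          (λ e → bc (≈-sym (commute-cancelˡ cd (cc e))))) ,
        bd≤db , <-≈-trans db<dc (≈-sym cd)

      larger-bd : d ∙ b ≤ b ∙ d → _
      larger-bd db≤bd = b ∙ d , (sq b∈ d∈ , λ h → T²-elim h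
          (>⇒≉ (∙-mono-< a<b a<d)) (>⇒≉ (∙-mono-< a<b b<d)) (>⇒≉ (∙-mono-< a<b c<d))
          (>⇒≉ (∙-monoʳ-< b a<d)) (>⇒≉ (∙-monoʳ-< b b<d)) (>⇒≉ (∙-monoʳ-< b c<d))
          (>⇒≉ (<-≤-trans (∙-mono-< c<d a<b) db≤bd)) (>⇒≉ (<-≤-trans (∙-monoˡ-< b c<d) db≤bd))
          (λ e → bc (≈-sym (commute-cancelʳ cd (cc e))))) ,
        ≤-refl , bd<cd

  -- Besides restricting the relations, this expresses `d` through `a`, `b` and `c`.
  ad∈T² : ¬ Commute b c ⊎ ¬ Commute c d → Sq T (a ∙ d)
  ad∈T² (inj₂ cd) = cd-noncommuting⇒ad∈T² cd
  ad∈T² (inj₁ bc) with commute? decSq c∈ d∈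
  ... | no cd = cd-noncommuting⇒ad∈T² cd
  ... | yes cd with bd-or-db cd bc
  ... | z , z-new , bd≤z , z<cd = decidable-stable (sq? T there decSq a∈ d∈) λ ad∉ → four-new
    ((>⇒≉ cd<dd ∷ >⇒≉ (<-trans z<cd cd<dd) ∷ >⇒≉ (<-trans ad<z (<-trans z<cd cd<dd)) ∷ []) ∷
     (>⇒≉ z<cd ∷ >⇒≉ (<-trans ad<z z<cd) ∷ []) ∷ (>⇒≉ ad<z ∷ []) ∷ [] ∷ [])
    (dd-new ∷ cd-new ∷ z-new ∷ (sq a∈ d∈ , ad∉) ∷ [])
    where
    ad<z = <-≤-trans ad<bd bd≤z

  -- Otherwise bd, db, dd and the larger of cd and dc are four products outside T².
  bc⇒bd : Commute b c → Commute b d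
  bc⇒bd bc = decidable-stable (commute? decSq b∈ d∈) λ bd → contra bd (total (c ∙ d) (d ∙ c))
    where
    bd∉ : ¬ Commute b d → ¬ Sq T (b ∙ d)
    bd∉ bd h = T²-elim h
      (>⇒≉ (∙-mono-< a<b a<d)) (>⇒≉ (∙-mono-< a<b b<d)) (>⇒≉ (∙-mono-< a<b c<d))
      (>⇒≉ (∙-monoʳ-< b a<d)) (>⇒≉ (∙-monoʳ-< b b<d)) (>⇒≉ (∙-monoʳ-< b c<d))
      (>⇒≉ (<-trans (∙-monoʳ-< c a<b) cb<bd)) (>⇒≉ cb<bd)
      (λ e → bd (commute-cancelˡ ≈-refl (commute-resp (≈-sym e) (commute-∙ bc bc))))
      where
      cb<bd = ≈-<-trans (≈-sym bc) (∙-monoʳ-< b c<d)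
    db∉ : ¬ Commute b d → ¬ Sq T (d ∙ b)
    db∉ bd h = T²-elim h
      (>⇒≉ (∙-mono-< a<d a<b)) (>⇒≉ (∙-monoˡ-< b a<d)) (>⇒≉ (<-trans (∙-monoˡ-< c a<b) bc<db))
      (>⇒≉ (∙-mono-< b<d a<b)) (>⇒≉ (∙-monoˡ-< b b<d)) (>⇒≉ bc<db)
      (>⇒≉ (∙-mono-< c<d a<b)) (>⇒≉ (∙-monoˡ-< b c<d))
      (λ e → bd (commute-cancelʳ ≈-refl (commute-resp (≈-sym e) (commute-∙ bc bc))))
      where
      bc<db = ≈-<-trans bc (∙-monoˡ-< b c<d)
    big : ∀ {z} → ¬ Commute b d → Sq S z × ¬ Sq T z → c ∙ d ≤ z → d ∙ c ≤ z → z < d ∙ d → ⊥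
    big bd z-new cd≤z dc≤z z<dd = four-new
      ((>⇒≉ z<dd ∷ >⇒≉ (<-trans bd<z z<dd) ∷ >⇒≉ (<-trans db<z z<dd) ∷ []) ∷
       (>⇒≉ bd<z ∷ >⇒≉ db<z ∷ []) ∷ (bd ∷ []) ∷ [] ∷ [])
      (dd-new ∷ z-new ∷ (sq b∈ d∈ , bd∉ bd) ∷ (sq d∈ b∈ , db∉ bd) ∷ [])
      where
      bd<z = <-≤-trans bd<cd cd≤z
      db<z = <-≤-trans db<dc dc≤z
    contra : ¬ Commute b d → c ∙ d ≤ d ∙ c ⊎ d ∙ c ≤ c ∙ d → ⊥
    contra bd (inj₁ cd≤dc) = big bd dc-new cd≤dc ≤-refl dc<dd
    contra bd (inj₂ dc≤cd) = big bd cd-new ≤-refl dc≤cd cd<dd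

  aa∈ : Sq T (a ∙ a)
  aa∈ = sq (there (there (here ≈-refl))) (there (there (here ≈-refl)))
  ab∈ : Sq T (a ∙ b)
  ab∈ = sq (there (there (here ≈-refl))) (there (here ≈-refl))
  ac∈ : Sq T (a ∙ c)
  ac∈ = sq (there (there (here ≈-refl))) (here ≈-refl)
  ba∈ : Sq T (b ∙ a)
  ba∈ = sq (there (here ≈-refl)) (there (there (here ≈-refl)))
  bb∈ : Sq T (b ∙ b)
  bb∈ = sq (there (here ≈-refl)) (there (here ≈-refl))
  bc∈ : Sq T (b ∙ c)
  bc∈ = sq (there (here ≈-refl)) (here ≈-refl)
  ca∈ : Sq T (c ∙ a)
  ca∈ = sq (here ≈-refl) (there (there (here ≈-refl)))
  cb∈ : Sq T (c ∙ b)
  cb∈ = sq (here ≈-refl) (there (here ≈-refl))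
  cc∈ : Sq T (c ∙ c)
  cc∈ = sq (here ≈-refl) (here ≈-refl)

  aa<ab : a ∙ a < a ∙ b
  aa<ab = ∙-monoʳ-< a a<b
  aa<ba : a ∙ a < b ∙ a
  aa<ba = ∙-monoˡ-< a a<b
  ab<ac : a ∙ b < a ∙ c
  ab<ac = ∙-monoʳ-< a b<c
  ba<ca : b ∙ a < c ∙ a
  ba<ca = ∙-monoˡ-< a b<c
  ab<bb : a ∙ b < b ∙ b
  ab<bb = ∙-monoˡ-< b a<b
  ba<bb : b ∙ a < b ∙ b
  ba<bb = ∙-monoʳ-< b a<b
  ac<bc : a ∙ c < b ∙ c
  ac<bc = ∙-monoˡ-< c a<b
  ca<cb : c ∙ a < c ∙ b
  ca<cb = ∙-monoʳ-< c a<b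
  bb<bc : b ∙ b < b ∙ c
  bb<bc = ∙-monoʳ-< b b<c
  bb<cb : b ∙ b < c ∙ b
  bb<cb = ∙-monoˡ-< b b<c
  bc<cc : b ∙ c < c ∙ c
  bc<cc = ∙-monoˡ-< c b<c
  cb<cc : c ∙ b < c ∙ c
  cb<cc = ∙-monoʳ-< c b<c

  bb<cc : b ∙ b < c ∙ c
  bb<cc = <-trans bb<bc bc<cc
  ab<bc : a ∙ b < b ∙ c
  ab<bc = <-trans ab<bb bb<bc
  ab<cb : a ∙ b < c ∙ b
  ab<cb = <-trans ab<bb bb<cb
  ba<bc : b ∙ a < b ∙ c
  ba<bc = <-trans ba<bb bb<bc
  ba<cb : b ∙ a < c ∙ b
  ba<cb = <-trans ba<bb bb<cb
  aa<bb : a ∙ a < b ∙ b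
  aa<bb = <-trans aa<ab ab<bb

  private
    below-cc : ∀ {z} → z < b ∙ b → c ∙ c ≉ z
    below-cc z<bb = >⇒≉ (<-trans z<bb bb<cc)

  -- If `a b ≠ b a`, all products of `T` are distinct up to `a c = c a`, eight in number. The only
  -- coincidence not settled by the order or the hypotheses, `a c = b²`, would make `a` commute with
  -- `b²`.
  ac⇒ab : Commute a c → ¬ Commute b c → Commute a b
  ac⇒ab ac bc = decidable-stable (commute? decSq a∈ b∈) λ ab → eight-in-T²
    ((>⇒≉ bc<cc ∷ >⇒≉ cb<cc ∷ >⇒≉ (<-trans ac<bc bc<cc) ∷
      >⇒≉ bb<cc ∷ below-cc ab<bb ∷ below-cc ba<bb ∷ below-cc aa<bb ∷ []) ∷
     (bc ∷ >⇒≉ ac<bc ∷ >⇒≉ bb<bc ∷ >⇒≉ ab<bc ∷ >⇒≉ ba<bc ∷ >⇒≉ (<-trans aa<ab ab<bc) ∷ []) ∷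
     (>⇒≉ (≈-<-trans ac ca<cb) ∷ >⇒≉ bb<cb ∷ >⇒≉ ab<cb ∷ >⇒≉ ba<cb ∷ >⇒≉ (<-trans aa<ab ab<cb) ∷ []) ∷
     ((λ e → ab (square-commute (commute-resp e (commute-∙ ≈-refl ac)))) ∷
       >⇒≉ ab<ac ∷ >⇒≉ ba<ac ∷ >⇒≉ (<-trans aa<ab ab<ac) ∷ []) ∷
     (>⇒≉ ab<bb ∷ >⇒≉ ba<bb ∷ >⇒≉ aa<bb ∷ []) ∷
     (ab ∷ >⇒≉ aa<ab ∷ []) ∷ (>⇒≉ aa<ba ∷ []) ∷ [] ∷ [])
    (cc∈ ∷ bc∈ ∷ cb∈ ∷ ac∈ ∷ bb∈ ∷ ab∈ ∷ ba∈ ∷ aa∈ ∷ [])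
    where
    ba<ac = <-≈-trans ba<ca (≈-sym ac)

  -- Either way `a` and `b` are conjugate under `c` or `c⁻¹`. These are the only possible
  -- coincidences among eight products; `b²` equals neither `a c` nor `c a`, because it commutes
  -- with `a`.
  ab⇒conjugate : Commute a b → ¬ Commute a c → ¬ Commute b c → a ∙ c ≈ c ∙ b ⊎ c ∙ a ≈ b ∙ c
  ab⇒conjugate ab ac bc with decSq a∈ c∈ c∈ b∈ | decSq c∈ a∈ b∈ c∈
  ... | yes e | _ = inj₁ e
  ... | no _ | yes e = inj₂ e
  ... | no ac≉cb | no ca≉bc = ⊥-elim (eight-in-T²
    ((>⇒≉ bc<cc ∷ >⇒≉ cb<cc ∷ >⇒≉ (<-trans ac<bc bc<cc) ∷ >⇒≉ (<-trans ca<cb cb<cc) ∷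
      >⇒≉ bb<cc ∷ below-cc ab<bb ∷ below-cc aa<bb ∷ []) ∷
     (bc ∷ >⇒≉ ac<bc ∷ (ca≉bc ∘ ≈-sym) ∷ >⇒≉ bb<bc ∷ >⇒≉ ab<bc ∷ >⇒≉ (<-trans aa<ab ab<bc) ∷ []) ∷
     ((ac≉cb ∘ ≈-sym) ∷ >⇒≉ ca<cb ∷ >⇒≉ bb<cb ∷ >⇒≉ ab<cb ∷ >⇒≉ (<-trans aa<ab ab<cb) ∷ []) ∷
     (ac ∷ (λ e → ac (commute-cancelˡ ≈-refl (commute-resp (≈-sym e) (commute-∙ ab ab)))) ∷
       >⇒≉ ab<ac ∷ >⇒≉ (<-trans aa<ab ab<ac) ∷ []) ∷
     ((λ e → ac (commute-cancelʳ ≈-refl (commute-resp (≈-sym e) (commute-∙ ab ab)))) ∷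
       >⇒≉ (≈-<-trans ab ba<ca) ∷ >⇒≉ (<-trans aa<ba ba<ca) ∷ []) ∷
     (>⇒≉ ab<bb ∷ >⇒≉ aa<bb ∷ []) ∷ (>⇒≉ aa<ab ∷ []) ∷ [] ∷ [])
    (cc∈ ∷ bc∈ ∷ cb∈ ∷ ac∈ ∷ ca∈ ∷ bb∈ ∷ ab∈ ∷ aa∈ ∷ []))

  -- All products except `c a` are listed. As `a b < a c < b c`, the forced coincidence involves
  -- `a c` and one of `b a`, `b²`, `c b`.
  noncommuting⇒ac : ¬ Commute a b → ¬ Commute a c → ¬ Commute b c →
                    a ∙ c ≈ b ∙ a ⊎ a ∙ c ≈ b ∙ b ⊎ a ∙ c ≈ c ∙ b
  noncommuting⇒ac ab ac bc with decSq a∈ c∈ b∈ a∈ | decSq a∈ c∈ b∈ b∈ | decSq a∈ c∈ c∈ b∈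
  ... | yes e | _ | _ = inj₁ e
  ... | no _ | yes e | _ = inj₂ (inj₁ e)
  ... | no _ | no _ | yes e = inj₂ (inj₂ e)
  ... | no ac≉ba | no ac≉bb | no ac≉cb = ⊥-elim (eight-in-T²
    ((>⇒≉ bc<cc ∷ >⇒≉ cb<cc ∷ >⇒≉ (<-trans ac<bc bc<cc) ∷
      >⇒≉ bb<cc ∷ below-cc ab<bb ∷ below-cc ba<bb ∷ below-cc aa<bb ∷ []) ∷
     (bc ∷ >⇒≉ ac<bc ∷ >⇒≉ bb<bc ∷ >⇒≉ ab<bc ∷ >⇒≉ ba<bc ∷ >⇒≉ (<-trans aa<ab ab<bc) ∷ []) ∷
     ((ac≉cb ∘ ≈-sym) ∷ >⇒≉ bb<cb ∷ >⇒≉ ab<cb ∷ >⇒≉ ba<cb ∷ >⇒≉ (<-trans aa<ab ab<cb) ∷ []) ∷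
     (ac≉bb ∷ >⇒≉ ab<ac ∷ ac≉ba ∷ >⇒≉ (<-trans aa<ab ab<ac) ∷ []) ∷
     (>⇒≉ ab<bb ∷ >⇒≉ ba<bb ∷ >⇒≉ aa<bb ∷ []) ∷
     (ab ∷ >⇒≉ aa<ab ∷ []) ∷ (>⇒≉ aa<ba ∷ []) ∷ [] ∷ [])
    (cc∈ ∷ bc∈ ∷ cb∈ ∷ ac∈ ∷ bb∈ ∷ ab∈ ∷ ba∈ ∷ aa∈ ∷ []))

-- The two symmetries of a quadruple.

module QuadSymmetry {ℓ₀ ℓ ℓ₂ : Level} (G : OrderedGroup ℓ₀ ℓ ℓ₂) where
  open OrderedGroupProperties G
  open Squares G
  open Descent G
  open Opposite G public using (oppositeGroup; Young-from-op)

  reversedGroup : OrderedGroup ℓ₀ ℓ ℓ₂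
  reversedGroup = record
    { group = group
    ; _≤_ = flip _≤_
    ; isTotalOrder = FlipOrder.isTotalOrder isTotalOrder
    ; compatible = compatible
    }

  private
    module O = GroupNotions (OrderedGroup.group oppositeGroup)

  Sq-from-op : ∀ {S z} → O.Sq S z → Sq S z
  Sq-from-op (x , y , x∈ , y∈ , e) = y , x , y∈ , x∈ , e

  oppositeQuad : ∀ {a b c d} → Quad G a b c d → Quad oppositeGroup a b c d
  oppositeQuad q = record
    { a<b = a<b ; b<c = b<c ; c<d = c<d
    ; decSq = λ x∈ y∈ z∈ w∈ → decSq y∈ x∈ w∈ z∈
    ; small = λ L u ⊆S → small L u (All.map Sq-from-op ⊆S)
    ; abc = λ (p , q , r) → abc (≈-sym p , ≈-sym q , ≈-sym r)
    ; abd = λ (p , q , r) → abd (≈-sym p , ≈-sym q , ≈-sym r)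
    ; acd = λ (p , q , r) → acd (≈-sym p , ≈-sym q , ≈-sym r)
    ; bcd = λ (p , q , r) → bcd (≈-sym p , ≈-sym q , ≈-sym r)
    }
    where open Quad q

  reverse-⊆ : ∀ {a b c d} → (a ∷ b ∷ c ∷ d ∷ []) ⊆ (d ∷ c ∷ b ∷ a ∷ [])
  reverse-⊆ (here e) = there (there (there (here e)))
  reverse-⊆ (there (here e)) = there (there (here e))
  reverse-⊆ (there (there (here e))) = there (here e)
  reverse-⊆ (there (there (there (here e)))) = here e

  reversedQuad : ∀ {a b c d} → Quad G a b c d → Quad reversedGroup d c b a
  reversedQuad q = record
    { a<b = flip< c<d ; b<c = flip< b<c ; c<d = flip< a<b
    ; decSq = DecSq-⊆ reverse-⊆ decSq
    ; small = λ L u ⊆S → small L u (All.map (Sq-⊆ reverse-⊆) ⊆S)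
    ; abc = λ (p , q , r) → bcd (≈-sym r , ≈-sym q , ≈-sym p)
    ; abd = λ (p , q , r) → acd (≈-sym r , ≈-sym q , ≈-sym p)
    ; acd = λ (p , q , r) → abd (≈-sym r , ≈-sym q , ≈-sym p)
    ; bcd = λ (p , q , r) → abc (≈-sym r , ≈-sym q , ≈-sym p)
    }
    where
    open Quad q
    flip< : ∀ {x y} → x < y → OrderedGroupProperties._<_ reversedGroup y x
    flip< (x≤y , x≉y) = x≤y , x≉y ∘ ≈-sym

-- Relations in two letters when no two of `a`, `b`, `c` commute.

module QuadPatterns {ℓ₀ ℓ ℓ₂ : Level} (G : OrderedGroup ℓ₀ ℓ ℓ₂) {a b c d : OrderedGroup.Carrier G}
                    (quad : Quad G a b c d) where
  open OrderedGroupProperties G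
  open Commutation G
  open Squares G
  open Descent G
  open YoungCriteria G
  open QuadFacts G quad
  open QuadSymmetry G
  private
    module Oppositely = QuadFacts oppositeGroup (oppositeQuad quad)

  da∈T² : ¬ Commute b c ⊎ ¬ Commute c d → Sq T (d ∙ a)
  da∈T² (inj₁ bc) = Sq-from-op (Oppositely.ad∈T² (inj₁ (bc ∘ ≈-sym)))
  da∈T² (inj₂ cd) = Sq-from-op (Oppositely.ad∈T² (inj₂ (cd ∘ ≈-sym)))

  T-generates : ∀ {p} {P : Carrier → Set p} → Sq T (a ∙ d) →
                ⟨ P ⟩ a → ⟨ P ⟩ b → ⟨ P ⟩ c → ∀ {w} → w ∈ S → ⟨ P ⟩ w
  T-generates {P = P} ad∈ a∈ b∈ c∈ = all
    where
    T⊆ : ∀ {w} → w ∈ T → ⟨ P ⟩ w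
    T⊆ (here e) = resp (≈-sym e) c∈
    T⊆ (there (here e)) = resp (≈-sym e) b∈
    T⊆ (there (there (here e))) = resp (≈-sym e) a∈
    all : ∀ {w} → w ∈ S → ⟨ P ⟩ w
    all (here e) = resp (≈-sym e) (⟨⟩-cancelˡ a∈ (⟨⟩-minimal T⊆ (⟨Sq⟩ ad∈)))
    all (there h) = T⊆ h

  ε<⇒< : ∀ {x y} → ε < x → y < x ∙ y
  ε<⇒< {x} {y} ε<x = ≈-<-trans (≈-sym (identityˡ y)) (∙-monoˡ-< y ε<x)

  ε<⇒<ʳ : ∀ {x y} → ε < x → y < y ∙ x
  ε<⇒<ʳ {x} {y} ε<x = ≈-<-trans (≈-sym (identityʳ y)) (∙-monoʳ-< y ε<x)

  -- This quotient turns all relations into words in two letters: `c = k a` if `a c = b a`, and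
  -- `c = k b` if `a c = b²`. Its positivity provides the order contradictions.
  k : Carrier
  k = a ⁻¹ ∙ b

  private
    ρ : Vec Carrier 5
    ρ = a ∷ k ∷ b ∷ c ∷ d ∷ []
    A K B C D : Expr 5
    A = var (# 0)
    K = var (# 1)
    B = var (# 2)
    C = var (# 3)
    D = var (# 4)

  b≈ak : b ≈ a ∙ k
  b≈ak = solve ρ B (A · (A ⁻ · B)) refl

  ε<k : ε < k
  ε<k = ≈-<-trans (≈-sym (inverseˡ a)) (∙-monoʳ-< (a ⁻¹) a<b)

  k∈⟨S⟩ : ⟨ Elem S ⟩ k
  k∈⟨S⟩ = mul (inv (gen a∈)) (gen b∈)

  k≉ε : ¬ k ≈ ε
  k≉ε = >⇒≉ ε<k

  -- Equates the two ways of computing a d a.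
  ada : ∀ {x y} → a ∙ d ≈ x → d ∙ a ≈ y → x ∙ a ≈ a ∙ y
  ada ad da = ≈-trans (∙-congʳ (≈-sym ad)) (≈-trans (assoc _ _ _) (∙-congˡ da))

  exclude : ∀ {p} {X : Set p} {x y} → y < x → x ≈ y → X
  exclude y<x x≈y = ⊥-elim (>⇒≉ y<x x≈y)

  module PatternBA (bc : ¬ Commute b c) (ac≈ba : a ∙ c ≈ b ∙ a) where

    c≈ka : c ≈ k ∙ a
    c≈ka = derive ρ C (K · A)
      ((A ⁻ , rule (A · C) (B · A) ac≈ba) ∷ (A ⁻ , rule B (A · K) b≈ak) ∷ []) refl

    ak≉ka : ¬ Commute a k
    ak≉ka e = <⇒≉ b<c (≈-trans b≈ak (≈-trans e (≈-sym c≈ka)))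

    generated : ∀ {w} → w ∈ S → ⟨ k , a ⟩₂ w
    generated = T-generates (ad∈T² (inj₁ bc)) a∈′ (resp (≈-sym b≈ak) (mul a∈′ k∈′))
                  (resp (≈-sym c≈ka) (mul k∈′ a∈′))
      where
      a∈′ : ⟨ k , a ⟩₂ a
      a∈′ = gen (inj₂ ≈-refl)
      k∈′ : ⟨ k , a ⟩₂ k
      k∈′ = gen (inj₁ ≈-refl)

    bb bc′ cb cc : Expr 5
    bb = (A · K) · (A · K)
    bc′ = (A · K) · (K · A)
    cb = (K · A) · (A · K)
    cc = (K · A) · (K · A)

    bb-holds : b ∙ b ≈ ⟦ ρ ⟧ bb
    bb-holds = ∙-cong b≈ak b≈ak
    bc-holds : b ∙ c ≈ ⟦ ρ ⟧ bc′
    bc-holds = ∙-cong b≈ak c≈ka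
    cb-holds : c ∙ b ≈ ⟦ ρ ⟧ cb
    cb-holds = ∙-cong c≈ka b≈ak
    cc-holds : c ∙ c ≈ ⟦ ρ ⟧ cc
    cc-holds = ∙-cong c≈ka c≈ka

    ada-rule : ∀ E E′ → a ∙ d ≈ ⟦ ρ ⟧ E → d ∙ a ≈ ⟦ ρ ⟧ E′ → Rule ρ
    ada-rule E E′ ad da = rule (E · A) (A · E′) (ada ad da)

    young-bc : c ∙ a ≈ b ∙ c → YoungSpan S
    young-bc ca≈bc = young-baumslag-solitar k∈⟨S⟩ (gen a∈) generated
      (derive ρ (K · A) (A · (K · K))
        ((𝟙 , rule C (K · A) c≈ka ʳ) ∷ (𝟙 , rule (C · A) bc′ (≈-trans ca≈bc bc-holds)) ∷ []) refl) k≉ε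

    module _ (ca≈bb : c ∙ a ≈ b ∙ b) where

      F : Rule ρ
      F = rule (K · A · A) (A · K · A · K) (derive ρ (K · A · A) (A · K · A · K)
        ((𝟙 , rule C (K · A) c≈ka ʳ) ∷ (𝟙 , rule (C · A) bb (≈-trans ca≈bb bb-holds)) ∷ []) refl)

      ad∈ : a ∙ d ≈ b ∙ b ⊎ a ∙ d ≈ b ∙ c ⊎ a ∙ d ≈ c ∙ b ⊎ a ∙ d ≈ c ∙ c
      ad∈ = T²-elim (ad∈T² (inj₁ bc))
        (exclude (∙-monoʳ-< a a<d)) (exclude (∙-monoʳ-< a b<d)) (exclude (∙-monoʳ-< a c<d))
        (exclude (≈-<-trans (≈-sym ac≈ba) (∙-monoʳ-< a c<d))) inj₁ (inj₂ ∘ inj₁)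
        (inj₁ ∘ flip ≈-trans ca≈bb) (inj₂ ∘ inj₂ ∘ inj₁) (inj₂ ∘ inj₂ ∘ inj₂)

      da∈ : d ∙ a ≈ b ∙ c ⊎ d ∙ a ≈ c ∙ b ⊎ d ∙ a ≈ c ∙ c
      da∈ = T²-elim (da∈T² (inj₁ bc))
        (exclude (∙-monoˡ-< a a<d)) (exclude (<-trans ab<bb bb<da)) (exclude (≈-<-trans ac≈ba (∙-monoˡ-< a b<d)))
        (exclude (∙-monoˡ-< a b<d)) (exclude bb<da) inj₁
        (exclude (∙-monoˡ-< a c<d)) (inj₂ ∘ inj₁) (inj₂ ∘ inj₂)
        where
        bb<da : b ∙ b < d ∙ a
        bb<da = ≈-<-trans (≈-sym ca≈bb) (∙-monoˡ-< a c<d)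

      -- Both values are substituted into `(a d) a = a (d a)` and written in `a` and `k`. The pair
      -- `b²`, `c²` satisfies this identically; each of the other eleven contradicts `a k ≠ k a` or
      -- `k > ε`.
      ad≈bb : (a ∙ d ≈ b ∙ b) × (d ∙ a ≈ c ∙ c)
      ad≈bb with ad∈ | da∈
      ... | inj₁ ad | inj₂ (inj₂ da) = ad , da
      ... | inj₁ ad | inj₁ da = ⊥-elim (ak≉ka (≈-sym (derive ρ (K · A) (A · K)
              ((A ⁻ , ada-rule bb bc′ (≈-trans ad bb-holds) (≈-trans da bc-holds)) ∷ []) refl)))
      ... | inj₁ ad | inj₂ (inj₁ da) = ⊥-elim (ak≉ka (≈-sym (derive ρ (K · A) (A · K)
              (((A · K · A) ⁻ , ada-rule bb cb (≈-trans ad bb-holds) (≈-trans da cb-holds)) ∷ []) refl)))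
      ... | inj₂ (inj₁ ad) | inj₁ da = ⊥-elim (ak≉ka (square-commute (≈-sym (derive ρ ((K · K) · A) (A · (K · K))
              ((A ⁻ , ada-rule bc′ bc′ (≈-trans ad bc-holds) (≈-trans da bc-holds)) ∷ []) refl))))
      ... | inj₂ (inj₁ ad) | inj₂ (inj₁ da) = ⊥-elim (ak≉ka (≈-sym (square-commute (derive ρ (K · (A · A)) ((A · A) · K)
              (((A · K) ⁻ , ada-rule bc′ cb (≈-trans ad bc-holds) (≈-trans da cb-holds)) ∷ []) refl))))
      ... | inj₂ (inj₁ ad) | inj₂ (inj₂ da) = ⊥-elim (ak≉ka (≈-sym (derive ρ (K · A) (A · K)
              (((A · K) ⁻ , ada-rule bc′ cc (≈-trans ad bc-holds) (≈-trans da cc-holds)) ∷ []) refl)))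
      ... | inj₂ (inj₂ (inj₁ ad)) | inj₁ da = ⊥-elim (k≉ε (derive ρ K 𝟙
              ((A ⁻ , F ʳ) ∷ (A ⁻ , ada-rule cb bc′ (≈-trans ad cb-holds) (≈-trans da bc-holds)) ∷ []) refl))
      ... | inj₂ (inj₂ (inj₁ ad)) | inj₂ (inj₁ da) = ⊥-elim (<-asym b<c (<-≈-trans (≈-<-trans c≈ka (ε<⇒< ε<k))
              (≈-trans (derive ρ (K · (K · A)) (A · K)
                (((A · K · A) ⁻ , F ʳ) ∷ ((A · K · A) ⁻ , ada-rule cb cb (≈-trans ad cb-holds) (≈-trans da cb-holds)) ∷ []) refl)
                (≈-sym b≈ak))))
      ... | inj₂ (inj₂ (inj₁ ad)) | inj₂ (inj₂ da) = ⊥-elim (k≉ε (derive ρ K 𝟙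
              (((A · K · A) ⁻ , F ʳ) ∷ ((A · K · A) ⁻ , ada-rule cb cc (≈-trans ad cb-holds) (≈-trans da cc-holds)) ∷ []) refl))
      ... | inj₂ (inj₂ (inj₂ ad)) | inj₁ da = ⊥-elim (>⇒≉
              (∙-mono-< (ε<⇒< ε<k) (ε<⇒<ʳ ε<k))
              (derive ρ ((K · A) · (K · K · A · K)) (A · (K · K · A))
                ((A ⁻ , F ʳ) ∷ (A ⁻ · K · A , F ʳ) ∷ (A ⁻ , ada-rule cc bc′ (≈-trans ad cc-holds) (≈-trans da bc-holds)) ∷ []) refl))
      ... | inj₂ (inj₂ (inj₂ ad)) | inj₂ (inj₁ da) = ⊥-elim (<⇒≉ (<-trans ε<k (ε<⇒< ε<k)) (≈-sym (derive ρ (K · K) 𝟙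
              (((A · K · A) ⁻ , F ʳ) ∷ ((A · K · A) ⁻ · K · A , F ʳ) ∷
               ((A · K · A) ⁻ , ada-rule cc cb (≈-trans ad cc-holds) (≈-trans da cb-holds)) ∷ []) refl)))
      ... | inj₂ (inj₂ (inj₂ ad)) | inj₂ (inj₂ da) = ⊥-elim (<-asym a<c (<-≈-trans (≈-<-trans c≈ka (ε<⇒<ʳ ε<k))
              (derive ρ (K · A · K) A
                (((A · K · A · K) ⁻ , F ʳ) ∷ ((A · K · A · K) ⁻ · K · A , F ʳ) ∷
                 ((A · K · A · K) ⁻ , ada-rule cc cc (≈-trans ad cc-holds) (≈-trans da cc-holds)) ∷ []) refl)))

      d≈kak : d ≈ k ∙ a ∙ k
      d≈kak = derive ρ D (K · A · K)
        ((A ⁻ , rule (A · D) bb (≈-trans (proj₁ ad≈bb) bb-holds)) ∷ []) refl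

      cd : ¬ Commute c d
      cd e = ak≉ka (derive ρ (A · K) (K · A)
        (((K · A · K) ⁻ , rule ((K · A) · (K · A · K)) ((K · A · K) · (K · A))
          (≈-trans (∙-cong (≈-sym c≈ka) (≈-sym d≈kak)) (≈-trans e (∙-cong d≈kak c≈ka)))) ∷ []) refl)

      -- Otherwise `a d² = b² d = b d c = d c² = d² a`. Then `a` commutes with `d`, and
      -- `b² = a d = d a = c²`.
      bd≉dc : ¬ b ∙ d ≈ d ∙ c
      bd≉dc bd≈dc = <⇒≉ bb<cc (≈-trans (≈-sym (proj₁ ad≈bb)) (≈-trans (square-commute
          (derive ρ (A · (D · D)) ((D · D) · A)
            ((𝟙 , rule (A · D) (B · B) (proj₁ ad≈bb)) ∷ (B , bd-rule) ∷ (𝟙 , bd-rule) ∷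
             (D , rule (D · A) (C · C) (proj₂ ad≈bb) ʳ) ∷ []) refl))
          (proj₂ ad≈bb)))
        where
        bd-rule : Rule ρ
        bd-rule = rule (B · D) (D · C) bd≈dc

      bd-holds : b ∙ d ≈ ⟦ ρ ⟧ ((A · K) · (K · A · K))
      bd-holds = ∙-cong b≈ak d≈kak

      -- A new `b d` would equal `d c` by `bd≈dc`. In `T²` only `c b` and `c²` are large enough, and
      -- `c b` would make `a` and `k` commute.
      bd≈cc : b ∙ d ≈ c ∙ c
      bd≈cc with sq? T there decSq b∈ d∈
      ... | no bd∉ = ⊥-elim (bd≉dc (bd≈dc cd bd∉))
      ... | yes bd∈ = T²-elim bd∈
        (exclude (∙-mono-< a<b a<d)) (exclude (∙-mono-< a<b b<d)) (exclude (∙-mono-< a<b c<d))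
        (exclude (∙-monoʳ-< b a<d)) (exclude (∙-monoʳ-< b b<d)) (exclude (∙-monoʳ-< b c<d))
        (exclude (≈-<-trans ca≈bb (∙-monoʳ-< b b<d)))
        (λ e → ⊥-elim (ak≉ka (≈-sym (derive ρ (K · A) (A · K)
          (((A · K) ⁻ , rule ((A · K) · (K · A · K)) cb (≈-trans (≈-sym bd-holds) (≈-trans e cb-holds))) ∷
           ((A · K) ⁻ , F) ∷ []) refl))))
        (λ e → e)

      young-bb : YoungSpan S
      -- In `a` and `k` the equation `c² = b d` is the second relation of `young-fibonacci`.
      young-bb = young-fibonacci k∈⟨S⟩ (gen a∈) generated (Rule.holds F)
        (≈-trans (≈-sym cc-holds) (≈-trans (≈-sym bd≈cc) (≈-trans bd-holds
          (solve ρ ((A · K) · (K · A · K)) (A · K · (K · A · K)) refl)))) k≉ε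

  -- In `b` and `k` the hypotheses become the single relation `k b² = b k b k`, which is again of
  -- Fibonacci type, but here no admissible `d` exists.
  pattern-BB : ¬ Commute b c → a ∙ c ≈ b ∙ b → c ∙ a ≈ b ∙ c → ⊥
  pattern-BB bc ac≈bb ca≈bc = contradiction ad∈ da∈
    where
    a≈bk⁻¹ : a ≈ b ∙ k ⁻¹
    a≈bk⁻¹ = derive ρ A (B · K ⁻) ((𝟙 , rule B (A · K) b≈ak ʳ) ∷ []) refl

    c≈kb : c ≈ k ∙ b
    c≈kb = derive ρ C (K · B)
      ((A ⁻ , rule (A · C) (B · B) ac≈bb) ∷ (A ⁻ , rule B (A · K) b≈ak) ∷ []) refl

    F : Rule ρ
    F = rule (K · B · B) (B · K · B · K) (derive ρ (K · B · B) (B · K · B · K)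
      ((𝟙 , rule C (K · B) c≈kb ʳ) ∷ (C , rule B (A · K) b≈ak) ∷ (𝟙 , rule (C · A) (B · C) ca≈bc) ∷
       (B , rule C (K · B) c≈kb) ∷ []) refl)

    bk≉kb : ¬ Commute b k
    bk≉kb e = bc (commute-resp (≈-sym c≈kb) (commute-∙ e ≈-refl))

    bk<kb : b ∙ k < k ∙ b
    -- If `k b < b k`, then `k b b < b k b < b k b k`, against `F`.
    bk<kb = [ (λ lt → lt) , (λ kb<bk → ⊥-elim (<⇒≉
        (<-trans (∙-monoˡ-< b kb<bk) (ε<⇒<ʳ ε<k)) (Rule.holds F))) ]′ (<-connex bk≉kb)

    ad∈ : a ∙ d ≈ b ∙ c ⊎ a ∙ d ≈ c ∙ b ⊎ a ∙ d ≈ c ∙ c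
    ad∈ = T²-elim (ad∈T² (inj₁ bc))
      (exclude (∙-monoʳ-< a a<d)) (exclude (∙-monoʳ-< a b<d)) (exclude (∙-monoʳ-< a c<d))
      (exclude (<-trans ba<bb bb<ad)) (exclude bb<ad) inj₁
      (λ e → inj₁ (≈-trans e ca≈bc)) (inj₂ ∘ inj₁) (inj₂ ∘ inj₂)
      where
      bb<ad : b ∙ b < a ∙ d
      bb<ad = ≈-<-trans (≈-sym ac≈bb) (∙-monoʳ-< a c<d)

    da∈ : d ∙ a ≈ c ∙ b ⊎ d ∙ a ≈ c ∙ c
    da∈ = T²-elim (da∈T² (inj₁ bc))
      (exclude (∙-monoˡ-< a a<d)) (exclude (<-trans ab<bc bc<da)) (exclude (<-trans ac<bc bc<da))
      (exclude (∙-monoˡ-< a b<d)) (exclude (<-trans bb<bc bc<da)) (exclude bc<da)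
      (exclude (∙-monoˡ-< a c<d)) inj₁ inj₂
      where
      bc<da : b ∙ c < d ∙ a
      bc<da = ≈-<-trans (≈-sym ca≈bc) (∙-monoˡ-< a c<d)

    bc′ cb cc : Expr 5
    bc′ = B · (K · B)
    cb = (K · B) · B
    cc = (K · B) · (K · B)

    bc-holds : b ∙ c ≈ ⟦ ρ ⟧ bc′
    bc-holds = ∙-congˡ c≈kb
    cb-holds : c ∙ b ≈ ⟦ ρ ⟧ cb
    cb-holds = ∙-congʳ c≈kb
    cc-holds : c ∙ c ≈ ⟦ ρ ⟧ cc
    cc-holds = ∙-cong c≈kb c≈kb

    ada-rule : ∀ E E′ → a ∙ d ≈ ⟦ ρ ⟧ E → d ∙ a ≈ ⟦ ρ ⟧ E′ → Rule ρ
    ada-rule E E′ ad da = rule (E · (B · K ⁻)) ((B · K ⁻) · E′)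
      (≈-trans (∙-congˡ (≈-sym a≈bk⁻¹)) (≈-trans (ada ad da) (∙-congʳ a≈bk⁻¹)))

    module _ (ad : a ∙ d ≈ b ∙ c) where

      d≈kkb : d ≈ k ∙ k ∙ b
      d≈kkb = derive ρ D (K · K · B)
        ((A ⁻ , rule (A · D) bc′ (≈-trans ad bc-holds)) ∷ (A ⁻ , rule B (A · K) b≈ak) ∷ []) refl

      bd-holds : b ∙ d ≈ ⟦ ρ ⟧ (B · (K · K · B))
      bd-holds = ∙-congˡ d≈kkb

      dc-holds : d ∙ c ≈ ⟦ ρ ⟧ ((K · K · B) · (K · B))
      dc-holds = ∙-cong d≈kkb c≈kb

      cd : ¬ Commute c d
      cd e = bk≉kb (derive ρ (B · K) (K · B)
        ((K ⁻ , rule ((K · B) · (K · K · B)) ((K · K · B) · (K · B))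
          (≈-trans (≈-sym (∙-cong c≈kb d≈kkb)) (≈-trans e dc-holds))) ∷ []) refl)

      impossible : ⊥
      impossible with sq? T there decSq b∈ d∈
      ... | no bd∉ = <-asym bk<kb (<-≈-trans (ε<⇒< ε<k) (≈-sym (derive ρ (B · K) (K · (K · B))
              ((𝟙 , rule (B · (K · K · B)) ((K · K · B) · (K · B))
                (≈-trans (≈-sym bd-holds) (≈-trans (bd≈dc cd bd∉) dc-holds))) ∷ []) refl)))
      ... | yes bd∈ = T²-elim bd∈
        (exclude (∙-mono-< a<b a<d)) (exclude (∙-mono-< a<b b<d)) (exclude (∙-mono-< a<b c<d))
        (exclude (∙-monoʳ-< b a<d)) (exclude (∙-monoʳ-< b b<d)) (exclude (∙-monoʳ-< b c<d))
        (exclude (≈-<-trans ca≈bc (∙-monoʳ-< b c<d)))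
        (λ e → bk≉kb (≈-sym (derive ρ (K · B) (B · K)
          (((B · K) ⁻ , rule (B · (K · K · B)) cb (≈-trans (≈-sym bd-holds) (≈-trans e cb-holds))) ∷
           ((B · K) ⁻ , F) ∷ []) refl)))
        (λ e → bk≉kb (derive ρ (B · K) (K · B)
          ((𝟙 , rule (B · (K · K · B)) cc (≈-trans (≈-sym bd-holds) (≈-trans e cc-holds))) ∷ []) refl))

    contradiction : _ → _ → ⊥
    contradiction (inj₁ ad) (inj₁ da) = bk≉kb (≈-sym (square-commute
      (derive ρ (K · (B · B)) ((B · B) · K)
        ((B ⁻ , ada-rule bc′ cb (≈-trans ad bc-holds) (≈-trans da cb-holds)) ∷ []) refl)))
    -- For this pair the two ways of computing `a d a` only give `F` back, so `d = k k b` is tested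
    -- on `b d` instead.
    contradiction (inj₁ ad) (inj₂ da) = impossible ad
    contradiction (inj₂ (inj₁ ad)) (inj₁ da) = <⇒≉
      (<-trans (≈-<-trans (assoc b b k) (∙-monoʳ-< b bk<kb)) (∙-monoˡ-< (k ∙ b) (ε<⇒< ε<k)))
      (derive ρ (B · B · K) ((K · B) · (K · B))
        ((B ⁻ , ada-rule cb cb (≈-trans ad cb-holds) (≈-trans da cb-holds) ʳ) ∷ (B ⁻ , F) ∷ []) refl)
    contradiction (inj₂ (inj₁ ad)) (inj₂ da) = k≉ε (derive ρ K 𝟙
      (((B · K · B) ⁻ , F ʳ) ∷ ((B · K · B) ⁻ , ada-rule cb cc (≈-trans ad cb-holds) (≈-trans da cc-holds)) ∷
       ((B · K · B) ⁻ · B , F ʳ) ∷ []) refl)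
    contradiction (inj₂ (inj₂ ad)) (inj₁ da) = <⇒≉
      (∙-monoˡ-< k (∙-mono-< (ε<⇒< ε<k) (ε<⇒< (<-trans ε<k (ε<⇒< ε<k)))))
      (≈-sym (derive ρ ((K · B) · (K · K · B) · K) (B · B · K)
        ((B ⁻ , F ʳ) ∷ (B ⁻ · K · B , F ʳ) ∷
         (B ⁻ , ada-rule cc cb (≈-trans ad cc-holds) (≈-trans da cb-holds)) ∷ []) refl))
    contradiction (inj₂ (inj₂ ad)) (inj₂ da) = <⇒≉
      (<-trans (ε<⇒< (<-trans ε<k (ε<⇒< ε<k))) (ε<⇒<ʳ ε<k))
      (≈-sym (derive ρ (K · K · B · K) B
        (((B · K · B) ⁻ , F ʳ) ∷ ((B · K · B) ⁻ · K · B , F ʳ) ∷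
         ((B · K · B) ⁻ , ada-rule cc cc (≈-trans ad cc-holds) (≈-trans da cc-holds)) ∷
         ((B · K · B) ⁻ · B , F ʳ) ∷ []) refl))

-- Commutation patterns of a quadruple.

module QuadCases {ℓ₀ ℓ ℓ₂ : Level} (G : OrderedGroup ℓ₀ ℓ ℓ₂) {a b c d : OrderedGroup.Carrier G}
                 (quad : Quad G a b c d) where
  open OrderedGroupProperties G
  open Commutation G
  open Squares G
  open Descent G
  open YoungCriteria G
  open QuadFacts G quad
  open QuadPatterns G quad
  open QuadSymmetry G
  private
    module Reversed = QuadFacts reversedGroup (reversedQuad quad)

  -- Here `b` commutes with `d`, and `c` with `a`. A value of `a d` commuting with `b` would force
  -- `a b = b a`, the value `c²` would force `c d = d c`, and the order excludes the rest of `T²`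
  -- except `b a`.
  bc⇒ad≈ba : Commute b c → a ∙ d ≈ b ∙ a
  bc⇒ad≈ba bc = T²-elim (ad∈T² (inj₂ cd))
    (exclude (∙-monoʳ-< a a<d)) (exclude (∙-monoʳ-< a b<d)) (exclude (∙-monoʳ-< a c<d))
    (λ e → e) (b-commutes (commute-∙ ≈-refl ≈-refl)) (b-commutes (commute-∙ ≈-refl bc))
    (exclude (≈-<-trans (≈-sym ac) (∙-monoʳ-< a c<d))) (b-commutes (commute-∙ bc ≈-refl))
    (λ e → ⊥-elim (cd (commute-cancelˡ (≈-sym ac) (commute-resp (≈-sym e) (commute-∙ ≈-refl ≈-refl)))))
    where
    bd : Commute b d
    bd = bc⇒bd bc
    ac : Commute a c
    ac = ≈-sym (Reversed.bc⇒bd (≈-sym bc))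
    ab : ¬ Commute a b
    ab ab = abc (ab , ac , bc)
    cd : ¬ Commute c d
    cd cd = bcd (bc , bd , cd)
    b-commutes : ∀ {z} {X : Set ℓ} → Commute b z → a ∙ d ≈ z → X
    b-commutes bz e = ⊥-elim (ab (≈-sym (commute-cancelʳ bd (commute-resp (≈-sym e) bz))))

  noncommuting⇒ca : ¬ Commute a b → ¬ Commute a c → ¬ Commute b c →
                    c ∙ a ≈ a ∙ b ⊎ c ∙ a ≈ b ∙ b ⊎ c ∙ a ≈ b ∙ c
  noncommuting⇒ca ab ac bc = QuadFacts.noncommuting⇒ac oppositeGroup (oppositeQuad quad)
    (ab ∘ ≈-sym) (ac ∘ ≈-sym) (bc ∘ ≈-sym)

  -- `z x² = x y x = x² z`.
  swap⇒commute : ∀ {x y z} → y ∙ x ≈ x ∙ z → x ∙ y ≈ z ∙ x → Commute z x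
  swap⇒commute {x} {y} {z} yx≈xz xy≈zx = square-commute (derive (x ∷ y ∷ z ∷ []) (Z · (X · X)) ((X · X) · Z)
    ((𝟙 , rule (X · Y) (Z · X) xy≈zx ʳ) ∷ (X , rule (Y · X) (X · Z) yx≈xz) ∷ []) refl)
    where
    X Y Z : Expr 3
    X = var (# 0)
    Y = var (# 1)
    Z = var (# 2)

  -- The opposite group transposes the 3 × 3 table of values of `a c` and `c a`. The diagonal
  -- contradicts non-commutation, so three entries above it remain.
  noncommuting-young : ¬ Commute a b → ¬ Commute a c → ¬ Commute b c → YoungSpan S
  noncommuting-young ab ac bc with noncommuting⇒ac ab ac bc | noncommuting⇒ca ab ac bc
  ... | inj₁ ac≈ba | inj₁ ca≈ab = ⊥-elim (ab (≈-sym (swap⇒commute ca≈ab ac≈ba)))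
  ... | inj₁ ac≈ba | inj₂ (inj₁ ca≈bb) = PatternBA.young-bb bc ac≈ba ca≈bb
  ... | inj₁ ac≈ba | inj₂ (inj₂ ca≈bc) = PatternBA.young-bc bc ac≈ba ca≈bc
  ... | inj₂ (inj₁ ac≈bb) | inj₁ ca≈ab = Young-from-op
          (QuadPatterns.PatternBA.young-bb oppositeGroup (oppositeQuad quad) (bc ∘ ≈-sym) ca≈ab ac≈bb)
  ... | inj₂ (inj₁ ac≈bb) | inj₂ (inj₁ ca≈bb) = ⊥-elim (ac (≈-trans ac≈bb (≈-sym ca≈bb)))
  ... | inj₂ (inj₁ ac≈bb) | inj₂ (inj₂ ca≈bc) = ⊥-elim (pattern-BB bc ac≈bb ca≈bc)
  ... | inj₂ (inj₂ ac≈cb) | inj₁ ca≈ab = Young-from-op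
          (QuadPatterns.PatternBA.young-bc oppositeGroup (oppositeQuad quad) (bc ∘ ≈-sym) ca≈ab ac≈cb)
  ... | inj₂ (inj₂ ac≈cb) | inj₂ (inj₁ ca≈bb) = ⊥-elim
          (QuadPatterns.pattern-BB oppositeGroup (oppositeQuad quad) (bc ∘ ≈-sym) ca≈bb ac≈cb)
  ... | inj₂ (inj₂ ac≈cb) | inj₂ (inj₂ ca≈bc) = ⊥-elim (bc (swap⇒commute ac≈cb ca≈bc))

  -- It suffices to make `a` commute with `d`. If `b d = d b`, then `d` centralizes `b`, `c`, `d`,
  -- and `d a` is a product of two of these; otherwise `d` is a conjugate of `c` by `b` or `b⁻¹`,
  -- and `a` commutes with both.
  ac-noncommuting : Commute a b → ¬ Commute b c → Commute c d → ¬ Commute a c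
  ac-noncommuting ab bc cd ac with commute? decSq b∈ d∈
  ... | yes bd = ad (≈-sym (commute-cancelˡ ≈-refl (central (Reversed.ad∈T² (inj₁ (bc ∘ ≈-sym))))))
    where
    ad : ¬ Commute a d
    ad ad = acd (ac , ad , cd)
    central : ∀ {z} → Sq (b ∷ c ∷ d ∷ []) z → Commute d z
    central (x , y , x∈ , y∈ , e) = commute-resp (≈-sym e) (commute-∙ (member x∈) (member y∈))
      where
      member : ∀ {x} → x ∈ b ∷ c ∷ d ∷ [] → Commute d x
      member (here e) = commute-resp (≈-sym e) (≈-sym bd)
      member (there (here e)) = commute-resp (≈-sym e) (≈-sym cd)
      member (there (there (here e))) = commute-resp (≈-sym e) ≈-refl
  ... | no bd with Reversed.ab⇒conjugate (≈-sym cd) (bd ∘ ≈-sym) (bc ∘ ≈-sym)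
  ... | inj₁ db≈bc = acd (ac , commute-cancelʳ ab (commute-resp (≈-sym db≈bc) (commute-∙ ab ac)) , cd)
  ... | inj₂ bd≈cb = acd (ac , commute-cancelˡ ab (commute-resp (≈-sym bd≈cb) (commute-∙ ac ab)) , cd)

  -- From `a d < b d = c b` the only value left for `a d` is `b c`. Then `d = r c`, and `r` is the
  -- commutator of `c` and `a`.
  path-young : Commute a b → Commute c d → ¬ Commute b c → ¬ Commute b d →
               c ∙ a ≈ b ∙ c → b ∙ d ≈ c ∙ b → YoungSpan S
  path-young ab cd bc bd ca≈bc bd≈cb = young-nilpotent (gen c∈) (gen a∈)
    (T-generates (ad∈T² (inj₁ bc)) a∈′ (resp (≈-sym b≈ar) (mul a∈′ r∈)) c∈′) ca≈acr
    (commute-cancelʳ ≈-refl (commute-resp d≈rc cd)) ar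
    where
    ad<cb : a ∙ d < c ∙ b
    ad<cb = <-≈-trans ad<bd bd≈cb
    ad≈bc : a ∙ d ≈ b ∙ c
    ad≈bc = T²-elim (ad∈T² (inj₁ bc))
      (exclude (∙-monoʳ-< a a<d)) (exclude (∙-monoʳ-< a b<d)) (exclude (∙-monoʳ-< a c<d))
      (exclude (≈-<-trans (≈-sym ab) (∙-monoʳ-< a b<d)))
      (λ e → ⊥-elim (bd (commute-cancelˡ (≈-sym ab) (commute-resp (≈-sym e) (commute-∙ ≈-refl ≈-refl)))))
      (λ e → e) (λ e → ≈-trans e ca≈bc)
      (λ e → ⊥-elim (<⇒≉ ad<cb e)) (λ e → ⊥-elim (<⇒≉ (<-trans ad<cb cb<cc) e))
    r : Carrier
    r = a ⁻¹ ∙ b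
    ρ : Vec Carrier 5
    ρ = a ∷ b ∷ c ∷ d ∷ r ∷ []
    A B C D R : Expr 5
    A = var (# 0)
    B = var (# 1)
    C = var (# 2)
    D = var (# 3)
    R = var (# 4)
    b≈ar : b ≈ a ∙ r
    b≈ar = solve ρ B (A · (A ⁻ · B)) refl
    ar : Commute a r
    ar = commute-cancelˡ ≈-refl (commute-resp b≈ar ab)
    d≈rc : d ≈ r ∙ c
    d≈rc = derive ρ D (R · C) ((A ⁻ , rule (A · D) (B · C) ad≈bc) ∷ (A ⁻ , rule B (A · R) b≈ar) ∷ []) refl
    cr : Commute c r
    cr = commute-cancelʳ ≈-refl (commute-resp d≈rc cd)
    ca≈acr : c ∙ a ≈ a ∙ c ∙ r
    ca≈acr = derive ρ (C · A) (A · C · R)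
      ((𝟙 , rule (C · A) (B · C) ca≈bc) ∷ (𝟙 , rule B (A · R) b≈ar) ∷
       (A , rule (R · C) (C · R) (≈-sym cr)) ∷ []) refl
    c∈′ : ⟨ c , a ⟩₂ c
    c∈′ = gen (inj₁ ≈-refl)
    a∈′ : ⟨ c , a ⟩₂ a
    a∈′ = gen (inj₂ ≈-refl)
    r∈ : ⟨ c , a ⟩₂ r
    r∈ = ⟨⟩-cancelˡ (mul a∈′ c∈′) (resp ca≈acr (mul c∈′ a∈′))

-- Conclusion for quadruples.

module QuadYoung {ℓ₀ ℓ ℓ₂ : Level} (G : OrderedGroup ℓ₀ ℓ ℓ₂) {a b c d : OrderedGroup.Carrier G}
                 (quad : Quad G a b c d) where
  open OrderedGroupProperties G
  open Commutation G
  open Squares G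
  open Descent G
  open QuadFacts G quad
  open QuadCases G quad
  open QuadSymmetry G
  private
    module Reversed = QuadFacts reversedGroup (reversedQuad quad)
    module ReversedCases = QuadCases reversedGroup (reversedQuad quad)
    module OppositeCases = QuadCases oppositeGroup (oppositeQuad quad)

  bc-noncommuting : ¬ Commute b c
  bc-noncommuting bc = abc (≈-sym ba , ≈-sym (Reversed.bc⇒bd (≈-sym bc)) , bc)
    where
    ba : Commute b a
    ba = swap⇒commute (OppositeCases.bc⇒ad≈ba (≈-sym bc)) (bc⇒ad≈ba bc)

  private
    bc : ¬ Commute b c
    bc = bc-noncommuting

    two-edges : Commute a b → Commute c d → YoungSpan S
    two-edges ab cd = decide (ab⇒conjugate ab ac bc) (Reversed.ab⇒conjugate (≈-sym cd) (bd ∘ ≈-sym) (bc ∘ ≈-sym))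
      where
      ac : ¬ Commute a c
      ac = ac-noncommuting ab bc cd
      bd : ¬ Commute b d
      bd h = ReversedCases.ac-noncommuting (≈-sym cd) (bc ∘ ≈-sym) (≈-sym ab) (≈-sym h)
      decide : a ∙ c ≈ c ∙ b ⊎ c ∙ a ≈ b ∙ c → d ∙ b ≈ b ∙ c ⊎ b ∙ d ≈ c ∙ b → YoungSpan S
      decide (inj₁ ac≈cb) (inj₁ db≈bc) = Young-from-op (OppositeCases.path-young (≈-sym ab) (≈-sym cd)
        (bc ∘ ≈-sym) (bd ∘ ≈-sym) ac≈cb db≈bc)
      -- Conjugations in opposite directions would give `a c = b d`, although `a < b` and `c < d`.
      decide (inj₁ ac≈cb) (inj₂ bd≈cb) =
        ⊥-elim (<⇒≉ (∙-mono-< a<b c<d) (≈-trans ac≈cb (≈-sym bd≈cb)))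
      decide (inj₂ ca≈bc) (inj₁ db≈bc) =
        ⊥-elim (<⇒≉ (∙-mono-< c<d a<b) (≈-trans ca≈bc (≈-sym db≈bc)))
      decide (inj₂ ca≈bc) (inj₂ bd≈cb) = path-young ab cd bc bd ca≈bc bd≈cb

    reverse : Young ⟨ Elem (a ∷ b ∷ c ∷ d ∷ []) ⟩ → YoungSpan S
    reverse = Young-resp (⟨⟩-minimal (λ h → gen (reverse-⊆ h))) (⟨⟩-minimal (λ h → gen (reverse-⊆ h)))

  -- As `b c ≠ c b`, either no two of `a`, `b`, `c` commute or `a b = b a`; by reversal the same
  -- dichotomy holds for `d`, `c`, `b`.
  quad-young : YoungSpan S
  quad-young with commute? decSq a∈ b∈ | commute? decSq a∈ c∈ | commute? decSq c∈ d∈ | commute? decSq b∈ d∈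
  ... | no ab | no ac | _ | _ = noncommuting-young ab ac bc
  ... | no ab | yes ac | _ | _ = ⊥-elim (ab (ac⇒ab ac bc))
  ... | yes ab | _ | yes cd | _ = two-edges ab cd
  ... | yes ab | _ | no cd | yes bd = ⊥-elim (cd (≈-sym (Reversed.ac⇒ab (≈-sym bd) (bc ∘ ≈-sym))))
  ... | yes ab | _ | no cd | no bd =
    reverse (ReversedCases.noncommuting-young (cd ∘ ≈-sym) (bd ∘ ≈-sym) (bc ∘ ≈-sym))

-- Four elements in general, sorting, and use of the cardinality hypothesis.

module Main {c ℓ ℓ₂ : Level} (G : OrderedGroup c ℓ ℓ₂) where
  open OrderedGroupProperties G
  open Commutation G
  open Squares G
  open LowerBound G
  open Descent G

  Small-⊆ : ∀ {S T} → T ⊆ S → length S ≡ length T → Small S → Small T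
  Small-⊆ T⊆S eq small L u L⊆ =
    ≡.subst (λ n → length L ℕ.+ 2 ℕ.≤ 3 * n) eq (small L u (All.map (Sq-⊆ T⊆S) L⊆))

  NonCommuting-⊆ : ∀ {S T} → S ⊆ T → NonCommuting S → NonCommuting T
  NonCommuting-⊆ S⊆T (x , y , x∈ , y∈ , h) = x , y , S⊆T x∈ , S⊆T y∈ , h

  to-front : ∀ {g ys} xs → (xs ++ g ∷ ys) ⊆ (g ∷ xs ++ ys)
  to-front [] h = h
  to-front (x ∷ xs) (here e) = there (here e)
  to-front (x ∷ xs) (there h) with to-front xs h
  ... | here e = here e
  ... | there h′ = there (there h′)

  from-front : ∀ {g ys} xs → (g ∷ xs ++ ys) ⊆ (xs ++ g ∷ ys)
  from-front [] h = h
  from-front (x ∷ xs) (here e) = there (from-front xs (here e))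
  from-front (x ∷ xs) (there (here e)) = here e
  from-front (x ∷ xs) (there (there h)) = there (from-front xs (there h))

  module _ {S} (decSq : DecSq S) (small : Small S) (noncomm : NonCommuting S) where

    commuting-triple-young : ∀ {g s q p} → (g ∷ s ∷ q ∷ p ∷ []) ⊆ S → S ⊆ (g ∷ s ∷ q ∷ p ∷ []) → 4 ≡ length S →
                             Decreasing (s ∷ q ∷ p ∷ []) → Commute p q × Commute p s × Commute q s → YoungSpan S
    commuting-triple-young {g} {s} {q} {p} ⊆S S⊆ eq T-dec (pq , ps , qs) =
      YoungSpan-⊆ ⊆S (gen ∘ S⊆) (CommutingTriple.young-triple G T-dec (DecSq-⊆ ⊆S decSq)
        (Small-⊆ ⊆S (≡.sym eq) small) T-comm (outlier T-comm (NonCommuting-⊆ S⊆ noncomm)))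
      where
      T-comm : PairwiseCommuting (s ∷ q ∷ p ∷ [])
      T-comm x∈ = commute-∈ (≈-sym (commute-∈ ≈-refl (≈-sym qs) (≈-sym ps) x∈))
        (≈-sym (commute-∈ qs ≈-refl (≈-sym pq) x∈)) (≈-sym (commute-∈ ps pq ≈-refl x∈))
        where
        commute-∈ : ∀ {x} → Commute x s → Commute x q → Commute x p →
                    ∀ {y} → y ∈ s ∷ q ∷ p ∷ [] → Commute x y
        commute-∈ xs xq xp (here e) = commute-resp (≈-sym e) xs
        commute-∈ xs xq xp (there (here e)) = commute-resp (≈-sym e) xq
        commute-∈ xs xq xp (there (there (here e))) = commute-resp (≈-sym e) xp

  base : BaseCase
  base {a} {b} {c} {d} S-dec@((c<d ∷ b<d ∷ a<d ∷ []) ∷ (b<c ∷ a<c ∷ []) ∷ (a<b ∷ []) ∷ [] ∷ []) decSq small noncomm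
    with triple? a∈ b∈ c∈ | triple? a∈ b∈ d∈ | triple? a∈ c∈ d∈ | triple? b∈ c∈ d∈
    where
    a∈ : a ∈ d ∷ c ∷ b ∷ a ∷ []
    a∈ = there (there (there (here ≈-refl)))
    b∈ : b ∈ d ∷ c ∷ b ∷ a ∷ []
    b∈ = there (there (here ≈-refl))
    c∈ : c ∈ d ∷ c ∷ b ∷ a ∷ []
    c∈ = there (here ≈-refl)
    d∈ : d ∈ d ∷ c ∷ b ∷ a ∷ []
    d∈ = here ≈-refl
    triple? : ∀ {x y z} → x ∈ d ∷ c ∷ b ∷ a ∷ [] → y ∈ d ∷ c ∷ b ∷ a ∷ [] → z ∈ d ∷ c ∷ b ∷ a ∷ [] →
              Dec (Commute x y × Commute x z × Commute y z)
    triple? x∈ y∈ z∈ = commute? decSq x∈ y∈ ×-dec commute? decSq x∈ z∈ ×-dec commute? decSq y∈ z∈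
  ... | yes abc | _ | _ | _ = commuting-triple-young decSq small noncomm
          (from-front []) (to-front []) refl ((b<c ∷ a<c ∷ []) ∷ (a<b ∷ []) ∷ [] ∷ []) abc
  ... | no _ | yes abd | _ | _ = commuting-triple-young decSq small noncomm
          (from-front (d ∷ [])) (to-front (d ∷ [])) refl ((b<d ∷ a<d ∷ []) ∷ (a<b ∷ []) ∷ [] ∷ []) abd
  ... | no _ | no _ | yes acd | _ = commuting-triple-young decSq small noncomm
          (from-front (d ∷ c ∷ [])) (to-front (d ∷ c ∷ [])) refl ((c<d ∷ a<d ∷ []) ∷ (a<c ∷ []) ∷ [] ∷ []) acd
  ... | no _ | no _ | no _ | yes bcd = commuting-triple-young decSq small noncomm
          (from-front (d ∷ c ∷ b ∷ [])) (to-front (d ∷ c ∷ b ∷ [])) refl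
          ((c<d ∷ b<d ∷ []) ∷ (b<c ∷ []) ∷ [] ∷ []) bcd
  ... | no abc | no abd | no acd | no bcd = QuadYoung.quad-young G (record
          { a<b = a<b ; b<c = b<c ; c<d = c<d ; decSq = decSq ; small = small
          ; abc = abc ; abd = abd ; acd = acd ; bcd = bcd })

  ≉-lookup : ∀ {x y L} → All (x ≉_) L → y ∈ L → x ≉ y
  ≉-lookup (x≉ ∷ _) (here e) x≈y = x≉ (≈-trans x≈y e)
  ≉-lookup (_ ∷ x≉L) (there h) = ≉-lookup x≉L h

  -- Without duplicates, totality of the order alone decides each comparison.
  insert : ∀ x L → Decreasing L → All (x ≉_) L →
           ∃ λ L′ → Decreasing L′ × L′ ⊆ (x ∷ L) × (x ∷ L) ⊆ L′ × length L′ ≡ suc (length L)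
  insert x [] _ _ = x ∷ [] , [] ∷ [] , (λ h → h) , (λ h → h) , refl
  insert x (y ∷ L) (L<y ∷ L-dec) (x≉y ∷ x≉L) with <-connex x≉y
  ... | inj₂ y<x = x ∷ y ∷ L , (y<x ∷ All.map (λ h → <-trans h y<x) L<y) ∷ L<y ∷ L-dec ,
                   (λ h → h) , (λ h → h) , refl
  ... | inj₁ x<y with insert x L L-dec x≉L
  ... | L′ , L′-dec , ⊆xL , xL⊆ , eq =
    y ∷ L′ , tabulate∈ (λ h → lookup< (x<y ∷ L<y) (⊆xL h)) ∷ L′-dec , into , onto , ≡.cong suc eq
    where
    into : (y ∷ L′) ⊆ (x ∷ y ∷ L)
    into (here e) = there (here e)
    into (there h) with ⊆xL h
    ... | here e = here e
    ... | there h′ = there (there h′)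
    onto : (x ∷ y ∷ L) ⊆ (y ∷ L′)
    onto (here e) = there (xL⊆ (here e))
    onto (there (here e)) = here e
    onto (there (there h)) = there (xL⊆ (there h))

  sort : ∀ L → Unique L → ∃ λ L′ → Decreasing L′ × L′ ⊆ L × L ⊆ L′ × length L′ ≡ length L
  sort [] _ = [] , [] , (λ h → h) , (λ h → h) , refl
  sort (x ∷ L) (x≉L ∷ uL) with sort L uL
  ... | L₁ , L₁-dec , L₁⊆L , L⊆L₁ , eq
    with insert x L₁ L₁-dec (tabulate∈ (λ h → ≉-lookup x≉L (L₁⊆L h)))
  ... | L₂ , L₂-dec , L₂⊆ , ⊆L₂ , eq₂ =
    L₂ , L₂-dec , (λ h → up (L₂⊆ h)) , (λ h → ⊆L₂ (down h)) , ≡.trans eq₂ (≡.cong suc eq)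
    where
    up : (x ∷ L₁) ⊆ (x ∷ L)
    up (here e) = here e
    up (there h) = there (L₁⊆L h)
    down : (x ∷ L) ⊆ (x ∷ L₁)
    down (here e) = here e
    down (there h) = there (L⊆L₁ h)

  -- Two members of a repetition-free list are equal exactly when their positions agree. Applied to
  -- the enumeration of `S²`, this is where `DecSq` comes from.
  unique-≈? : ∀ {L x y} → Unique L → x ∈ L → y ∈ L → Dec (x ≈ y)
  unique-≈? _ (here e) (here e′) = yes (≈-trans e (≈-sym e′))
  unique-≈? (≉L ∷ _) (here e) (there h) = no λ x≈y → ≉-lookup ≉L h (≈-trans (≈-sym e) x≈y)
  unique-≈? (≉L ∷ _) (there h) (here e) = no λ x≈y → ≉-lookup ≉L h (≈-sym (≈-trans x≈y e))
  unique-≈? (_ ∷ u) (there h) (there h′) = unique-≈? u h h′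

  remove : ∀ {x L} → x ∈ L → ∃ λ L′ → length L ≡ suc (length L′) × (∀ {y} → y ∈ L → x ≉ y → y ∈ L′)
  remove {x} {z ∷ L} (here e) = L , refl , λ where
    (here e′) x≉y → ⊥-elim (x≉y (≈-trans e (≈-sym e′)))
    (there h) _ → h
  remove {x} {z ∷ L} (there x∈) with remove x∈
  ... | L′ , eq , keep = z ∷ L′ , ≡.cong suc eq , λ where
    (here e′) _ → here e′
    (there h) x≉y → there (keep h x≉y)

  unique-⊆⇒length-≤ : ∀ M {L} → Unique M → (∀ {x} → x ∈ M → x ∈ L) → length M ℕ.≤ length L
  unique-⊆⇒length-≤ [] _ _ = z≤n
  unique-⊆⇒length-≤ (x ∷ M) (x≉M ∷ uM) M⊆L with remove (M⊆L (here ≈-refl))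
  ... | L′ , eq , keep = ≡.subst (suc (length M) ℕ.≤_) (≡.sym eq)
    (s≤s (unique-⊆⇒length-≤ M uM (λ h → keep (M⊆L (there h)) (≉-lookup x≉M h))))

  abelian-or-young : ∀ S → Unique S → length S ≥ 4 → HasCard (Sq S) (3 * length S ∸ 2) →
                     Abelian ⟨ Elem S ⟩ ⊎ Young ⟨ Elem S ⟩
  abelian-or-young S uS 4≤n (L , uL , _ , Sq⊆L , length-L) with sort S uS
  ... | R , R-dec , R⊆S , S⊆R , eq = conclude (commuting? R R-≟)
    where
    R-≟ : DecSq R
    R-≟ x∈ y∈ z∈ w∈ = unique-≈? uL (Sq⊆L _ (sq (R⊆S x∈) (R⊆S y∈))) (Sq⊆L _ (sq (R⊆S z∈) (R⊆S w∈)))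

    R-small : Small R
    R-small M uM M⊆ = begin
      length M ℕ.+ 2               ≤⟨ ℕₚ.+-monoˡ-≤ 2 (unique-⊆⇒length-≤ M uM
                                       (λ h → Sq⊆L _ (Sq-⊆ R⊆S (lookup-Sq M⊆ h)))) ⟩
      length L ℕ.+ 2               ≡⟨ ≡.cong (ℕ._+ 2) length-L ⟩
      -- The bound `4 ≤ |S|` makes the truncated subtraction genuine.
      3 * length S ∸ 2 ℕ.+ 2       ≡⟨ ℕₚ.m∸n+n≡m (ℕₚ.≤-trans (ℕₚ.m≤m+n 2 10) (ℕₚ.*-monoʳ-≤ 3 4≤n)) ⟩
      3 * length S                 ≡⟨ ≡.cong (3 *_) eq ⟨
      3 * length R                 ∎
      where
      open ℕₚ.≤-Reasoning
      lookup-Sq : ∀ {M z} → All (Sq R) M → z ∈ M → Sq R z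
      lookup-Sq (p ∷ _) (here e) = Sq-resp (≈-sym e) p
      lookup-Sq (_ ∷ ps) (there h) = lookup-Sq ps h

    length-R : length R ≡ 4 ℕ.+ (length S ∸ 4)
    length-R = ≡.trans eq (≡.sym (ℕₚ.m+[n∸m]≡n 4≤n))

    conclude : NonCommuting R ⊎ PairwiseCommuting R → _
    conclude (inj₁ noncomm) = inj₂ (YoungSpan-⊆ R⊆S (gen ∘ S⊆R)
      (descent base (length S ∸ 4) R length-R R-dec R-≟ R-small noncomm))
    conclude (inj₂ comm) = inj₁ (⟨⟩-abelian λ x∈ y∈ → comm (S⊆R x∈) (S⊆R y∈))

theorem2p7 : {c ℓ ℓ₂ : Level} (G : OrderedGroup c ℓ ℓ₂) →
    (S : List (OrderedGroup.Carrier G)) →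
    GroupNotions.Unique (OrderedGroup.group G) S →
    length S ≥ 4 →
    GroupNotions.HasCard (OrderedGroup.group G) (GroupNotions.Sq (OrderedGroup.group G) S) (3 * length S ∸ 2) →
    GroupNotions.Abelian (OrderedGroup.group G) (GroupNotions.⟨_⟩ (OrderedGroup.group G) (GroupNotions.Elem (OrderedGroup.group G) S))
    ⊎ GroupNotions.Young (OrderedGroup.group G) (GroupNotions.⟨_⟩ (OrderedGroup.group G) (GroupNotions.Elem (OrderedGroup.group G) S))
theorem2p7 G = Main.abelian-or-young G
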